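{- Let $\varepsilon>0$ be a constant and let $p=\frac{1+\varepsilon}{k}$. There exists a constant $c=c(\varepsilon)>0$ such that the following holds: for every graph $G$ with minimum degree $\delta(G)\ge k$, with probability tending to $1$ as $k\to\infty$ (uniformly over all such $G$), \[ h(G_p)\ \ge\ c\sqrt{\frac{k}{\log k}}. \] That is, with high probability $h(G_p)=\Omega\!\left(\sqrt{k/\log k}\right)$.
   Context: For a graph $G$ and $p\in[0,1]$, $G_p$ denotes the random subgraph of $G$ on the same vertex set obtained by retaining each edge of $G$ independently with probability $p$. $h(H)$ denotes the Hadwiger number of a graph $H$, i.e. the largest $t$ such that $H$ contains $K_t$ as a minor. $\log$ is the natural logarithm. "With high probability" means with probability tending to $1$ as $k\to\infty$; all asymptotics are as $k\to\infty$.
   Formalization: The constant ε is taken to be a positive rational rather than a positive real (the real case follows from a smaller rational ε by monotonicity of G_p in p); everything else is as stated. -}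

module Defs where

open import Data.Bool using (Bool; true; false; _∧_; _∨_; if_then_else_; T)
open import Data.Nat using (ℕ; zero; suc; _≤_) renaming (_<ᵇ_ to _<ᵇℕ_)
open import Data.Fin using (Fin; toℕ) renaming (_≟_ to _≟ᶠ_)
open import Data.Maybe using (Maybe; just)
open import Data.Product using (Σ; ∃; ∃-syntax; _×_; _,_)
open import Data.List using (List; []; _∷_; map; concatMap; allFin; length)
open import Data.Nat.ListAction using (sum)
open import Data.Vec using (Vec; []; _∷_)
open import Data.Integer using (+_)
open import Data.Rational using (ℚ; 0ℚ; 1ℚ; _+_; _*_; _-_; _/_)
  renaming (_≤_ to _≤ℚ_)
open import Relation.Nullary using (¬_)
open import Relation.Nullary.Decidable using (⌊_⌋)
open import Relation.Binary.PropositionalEquality using (_≡_)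

record Graph (n : ℕ) : Set where
  field
    adj    : Fin n → Fin n → Bool
    sym    : ∀ u v → adj u v ≡ adj v u
    irrefl : ∀ v → adj v v ≡ false
open Graph public

degree : ∀ {n} → Graph n → Fin n → ℕ
degree {n} G u = sum (map (λ v → if adj G u v then 1 else 0) (allFin n))

MinDegreeAtLeast : ∀ {n} → Graph n → ℕ → Set
MinDegreeAtLeast {n} G k = ∀ u → k ≤ degree G u

data Walk {n} (a : Fin n → Fin n → Bool) (P : Fin n → Set) : Fin n → Fin n → Set where
  here : ∀ {u} → Walk a P u u
  step : ∀ {u w v} → T (a u w) → P w → Walk a P w v → Walk a P u v

-- H contains K_t as a minor: branch sets f⁻¹(i), i : Fin t, which are
-- nonempty, pairwise disjoint (f is a function), connected, and pairwise adjacent.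
HasCliqueMinor : ∀ {n} → (Fin n → Fin n → Bool) → ℕ → Set
HasCliqueMinor {n} a t =
  Σ (Fin n → Maybe (Fin t)) λ f →
    (∀ i → ∃[ v ] f v ≡ just i) ×
    (∀ i u v → f u ≡ just i → f v ≡ just i → Walk a (λ w → f w ≡ just i) u v) ×
    (∀ i j → ¬ i ≡ j → ∃[ u ] ∃[ v ] (f u ≡ just i × f v ≡ just j × T (a u v)))

-- h(H) ≥ t  iff  H has a K_t minor (minors of K_t are cliques K_s, s ≤ t)

edges : ∀ {n} → Graph n → List (Fin n × Fin n)
edges {n} G = concatMap (λ i → concatMap (λ j →
   if (toℕ i <ᵇℕ toℕ j) ∧ adj G i j then (i , j) ∷ [] else []) (allFin n)) (allFin n)

allBits : (m : ℕ) → List (Vec Bool m)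
allBits zero    = [] ∷ []
allBits (suc m) = concatMap (λ v → (true ∷ v) ∷ (false ∷ v) ∷ []) (allBits m)

keptAdj : ∀ {n m} → List (Fin n × Fin n) → Vec Bool m → Fin n → Fin n → Bool
keptAdj []            _        u v = false
keptAdj (_ ∷ _)       []       u v = false
keptAdj ((x , y) ∷ es) (b ∷ bs) u v =
  (b ∧ ((⌊ x ≟ᶠ u ⌋ ∧ ⌊ y ≟ᶠ v ⌋) ∨ (⌊ x ≟ᶠ v ⌋ ∧ ⌊ y ≟ᶠ u ⌋))) ∨ keptAdj es bs u v

weight : ∀ {m} → ℚ → Vec Bool m → ℚ
weight p []          = 1ℚ
weight p (true ∷ bs)  = p * weight p bs
weight p (false ∷ bs) = (1ℚ - p) * weight p bs

sumℚ : List ℚ → ℚ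
sumℚ []       = 0ℚ
sumℚ (x ∷ xs) = x + sumℚ xs

-- Pr[ G_p satisfies E ] ≥ r : some set of outcomes (given by an indicator)
-- all satisfying E has total probability ≥ r.
ProbAtLeast : ∀ {n} → Graph n → ℚ → ((Fin n → Fin n → Bool) → Set) → ℚ → Set
ProbAtLeast G p E r =
  Σ (Vec Bool (length (edges G)) → Bool) λ good →
    (∀ s → T (good s) → E (keptAdj (edges G) s)) ×
    (r ≤ℚ sumℚ (map (λ s → if good s then weight p s else 0ℚ) (allBits (length (edges G)))))

-- p = (1 + ε)/k  (value at k = 0 irrelevant)

pOf : ℚ → ℕ → ℚ
pOf ε zero    = 0ℚ
pOf ε (suc k) = (1ℚ + ε) * (+ 1 / suc k)

ℕ→ℚ : ℕ → ℚ
ℕ→ℚ N = + N / 1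

-- exp q ≤ N, via the (increasing) partial sums of the exponential series

expTerm : ℚ → ℕ → ℚ
expTerm q zero    = 1ℚ
expTerm q (suc j) = expTerm q j * q * (+ 1 / suc j)

expPartial : ℚ → ℕ → ℚ
expPartial q zero    = 1ℚ
expPartial q (suc j) = expPartial q j + expTerm q (suc j)

ExpAtMost : ℚ → ℕ → Set
ExpAtMost q N = ∀ j → expPartial q j ≤ℚ ℕ→ℚ N

-- t ≥ c √(k / log k), where c2 = c²  (for k ≥ 2, t ≥ 1):
--   t² log k ≥ c² k  ⇔  exp(c² k / t²) ≤ k ;  t = 0 never satisfies it.
AtLeastBound : ℚ → ℕ → ℕ → Set
AtLeastBound c2 k zero     = Data.Empty.⊥
  where import Data.Empty
AtLeastBound c2 k (suc t') =
  ExpAtMost (c2 * ℕ→ℚ k * (+ 1 / suc t') * (+ 1 / suc t')) k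

{-# OPTIONS --safe #-}
module Submission where

-- The edges of G_p are exposed in two rounds, of probabilities (1 + ε/2)/k and Θ(ε/k).
--
-- First round: explore a forest from about √k roots, giving each vertex boundedly many
-- children and setting aside ("saturating") a vertex as soon as it has Ω(k) discovered
-- neighbours. A vertex that is not saturated has on average more than one child, so the
-- exploration only ends when a constant proportion of the N discovered vertices is
-- saturated; G then has Ω(kN) edges between discovered vertices.
--
-- Second round: cut the forest into N/√k connected parts of order √k. Every pair of parts
-- is joined by O(k) edges of G, so Ω(N) different pairs are joined in this round, and
-- contracting the parts leaves a graph of average degree Ω(√k).
--
-- Such a graph has a clique minor of order Ω(√k / √log k) by the theorem of Kostochka and
-- Thomason, in the proof of Alon, Krivelevich and Sudakov.
--
-- An event is bounded from below along the tree of answers to edge queries: the probability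
-- of an event is affine in the probability of each edge, so an answer replaces the latter
-- by its conditional value, and concentration is expressed by the potential
-- z^(successes) (1 + a (1 - z))^(queries), a supermartingale.

-- The number N of discovered vertices has no bound in terms of `k`, so losses must be measured
-- against N and no union bound over the stages is available; each round is therefore a stopped
-- process with one potential that can be evaluated whenever the process ends. The threshold of
-- saturation is σ = k/β with β of order 1/ε: an unsaturated vertex keeps (1 - 1/β)k undiscovered
-- neighbours, and the surplus ε/2 of the first round outweighs the loss 1/β. The cap 2(β + 1) on
-- the number of children costs only half of the remaining gain. The number of roots is a
-- compromise. It must tend to infinity for the failure probability to vanish, but a part can stay
-- too small only if it contains a root. With about √k roots such parts hold a small multiple of k
-- vertices, few compared with the saturated ones: one saturated vertex already forces Ω(k) of them.
-- Two rounds are needed because edges between discovered vertices may have failed in the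
-- exploration. Writing p = p₁ + (1 - p₁)p₂ leaves each of them an untouched chance p₂. All
-- estimates stay in the rationals: integer powers and Bernoulli's inequality replace exponentials.

-- Finite sums, counting and averaging over `Fin n`

module FiniteSums where

  open import Data.Bool using (Bool; true; false; _∧_; _∨_; not; T)
  open import Data.Empty using (⊥; ⊥-elim)
  open import Data.Fin using (Fin; zero; suc; toℕ)
  open import Data.Fin.Properties using (_≟_)
  open import Data.List using (map; tabulate; allFin)
  open import Data.List.Properties using (map-tabulate)
  open import Data.Nat using (ℕ; zero; suc; _+_; _*_; _≤_; _<_; z≤n; s≤s; _≤ᵇ_; _<ᵇ_)
  open import Data.Nat.ListAction using (sum)
  open import Data.Nat.Properties hiding (_≟_)
  open import Data.Nat.Tactic.RingSolver using (solve-∀)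
  open import Data.Product using (∃-syntax; _×_; _,_)
  open import Data.Sum using (_⊎_; inj₁; inj₂)
  open import Function using (_∘_; id)
  open import Relation.Nullary using (¬_; yes; no; does)
  open import Relation.Binary.PropositionalEquality using (_≡_; _≢_; refl; sym; trans; cong; cong₂)

  -- Linear arithmetic by certificate: X ≤ Y is a combination of the hypotheses and
  -- the equation, in which d is the slack, is left to the ring solver.
  linear : ∀ {X Y A B} d → X ≤ Y → A + Y + d ≡ B + X → A ≤ B
  linear {X} {Y} {A} {B} d X≤Y eq = +-cancelʳ-≤ Y A B (begin
    A + Y      ≤⟨ m≤m+n (A + Y) d ⟩
    A + Y + d  ≡⟨ eq ⟩
    B + X      ≤⟨ +-monoʳ-≤ B X≤Y ⟩
    B + Y      ∎)
    where open ≤-Reasoning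

  ∑ : ∀ {n} → (Fin n → ℕ) → ℕ
  ∑ {zero}  f = 0
  ∑ {suc n} f = f zero + ∑ (f ∘ suc)

  ι : Bool → ℕ
  ι true  = 1
  ι false = 0

  # : ∀ {n} → (Fin n → Bool) → ℕ
  # P = ∑ (ι ∘ P)

  infix 5 _==_
  _==_ : ∀ {n} → Fin n → Fin n → Bool
  i == j = does (i ≟ j)

  ==-refl : ∀ {n} (i : Fin n) → (i == i) ≡ true
  ==-refl i with i ≟ i
  ... | yes _  = refl
  ... | no i≢i = ⊥-elim (i≢i refl)

  ==⇒≡ : ∀ {n} {i j : Fin n} → (i == j) ≡ true → i ≡ j
  ==⇒≡ {i = i} {j} e with i ≟ j
  ... | yes i≡j = i≡j
  ==⇒≡ () | no _

  ≢⇒== : ∀ {n} {i j : Fin n} → i ≢ j → (i == j) ≡ false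
  ≢⇒== {i = i} {j} i≢j with i ≟ j
  ... | yes i≡j = ⊥-elim (i≢j i≡j)
  ... | no _    = refl

  ==-sym : ∀ {n} (x y : Fin n) → (x == y) ≡ (y == x)
  ==-sym x y with x ≟ y
  ... | yes refl = sym (==-refl x)
  ... | no x≢y   = sym (≢⇒== (λ e → x≢y (sym e)))

  true≢false : ∀ {b} → b ≡ true → b ≡ false → ⊥
  true≢false refl ()

  ≡true⇒T : ∀ {b} → b ≡ true → T b
  ≡true⇒T refl = _

  T⇒≡true : ∀ {b} → T b → b ≡ true
  T⇒≡true {true} _ = refl

  ∧-intro : ∀ {a b} → a ≡ true → b ≡ true → a ∧ b ≡ true
  ∧-intro refl refl = refl

  ∧-elim : ∀ {a b} → a ∧ b ≡ true → a ≡ true × b ≡ true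
  ∧-elim {true} {true} _ = refl , refl

  ∨-introˡ : ∀ {a b} → a ≡ true → a ∨ b ≡ true
  ∨-introˡ refl = refl

  ∨-introʳ : ∀ {a b} → b ≡ true → a ∨ b ≡ true
  ∨-introʳ {true}  _ = refl
  ∨-introʳ {false} e = e

  ∨-elim : ∀ {a b} → a ∨ b ≡ true → a ≡ true ⊎ b ≡ true
  ∨-elim {true}  _ = inj₁ refl
  ∨-elim {false} e = inj₂ e

  not-elim : ∀ {a} → not a ≡ true → a ≡ false
  not-elim {false} _ = refl

  ¬true⇒false : ∀ {b} → ¬ (b ≡ true) → b ≡ false
  ¬true⇒false {true}  h = ⊥-elim (h refl)
  ¬true⇒false {false} h = refl

  dec-true : ∀ b → b ≡ true ⊎ b ≡ false
  dec-true true  = inj₁ refl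
  dec-true false = inj₂ refl

  ι-mono : ∀ {a b} → (a ≡ true → b ≡ true) → ι a ≤ ι b
  ι-mono {true}  h rewrite h refl = ≤-refl
  ι-mono {false} h = z≤n

  ι-∧ : ∀ a b → ι (a ∧ b) ≡ ι a * ι b
  ι-∧ true  b = sym (+-identityʳ (ι b))
  ι-∧ false b = refl

  ι≤1 : ∀ a → ι a ≤ 1
  ι≤1 true  = ≤-refl
  ι≤1 false = z≤n

  ι-*-≤ : ∀ b {x y} → (b ≡ true → x ≤ y) → ι b * x ≤ ι b * y
  ι-*-≤ true  h = *-monoʳ-≤ 1 (h refl)
  ι-*-≤ false h = z≤n

  ∑-cong : ∀ {n} {f g : Fin n → ℕ} → (∀ i → f i ≡ g i) → ∑ f ≡ ∑ g
  ∑-cong {zero}  h = refl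
  ∑-cong {suc n} h = cong₂ _+_ (h zero) (∑-cong (h ∘ suc))

  ∑-mono : ∀ {n} {f g : Fin n → ℕ} → (∀ i → f i ≤ g i) → ∑ f ≤ ∑ g
  ∑-mono {zero}  h = z≤n
  ∑-mono {suc n} h = +-mono-≤ (h zero) (∑-mono (h ∘ suc))

  ∑-+ : ∀ {n} (f g : Fin n → ℕ) → ∑ (λ i → f i + g i) ≡ ∑ f + ∑ g
  ∑-+ {zero}  f g = refl
  ∑-+ {suc n} f g rewrite ∑-+ (f ∘ suc) (g ∘ suc) =
    interchange (f zero) (g zero) (∑ (f ∘ suc)) (∑ (g ∘ suc))
    where
    interchange : ∀ a b c d → a + b + (c + d) ≡ a + c + (b + d)
    interchange = solve-∀

  ∑-* : ∀ {n} c (f : Fin n → ℕ) → ∑ (λ i → c * f i) ≡ c * ∑ f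
  ∑-* {zero}  c f = sym (*-zeroʳ c)
  ∑-* {suc n} c f rewrite ∑-* c (f ∘ suc) = sym (*-distribˡ-+ c (f zero) _)

  ∑-*ʳ : ∀ {n} (f : Fin n → ℕ) c → ∑ (λ i → f i * c) ≡ ∑ f * c
  ∑-*ʳ f c = trans (∑-cong (λ i → *-comm (f i) c)) (trans (∑-* c f) (*-comm c (∑ f)))

  ∑-0 : ∀ n → ∑ {n} (λ _ → 0) ≡ 0
  ∑-0 zero    = refl
  ∑-0 (suc n) = ∑-0 n

  ∑-swap : ∀ {m n} (h : Fin m → Fin n → ℕ) →
    ∑ (λ i → ∑ (λ j → h i j)) ≡ ∑ (λ j → ∑ (λ i → h i j))
  ∑-swap {zero}  {n} h = sym (∑-0 n)
  ∑-swap {suc m} {n} h = trans (cong (∑ (h zero) +_) (∑-swap (h ∘ suc)))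
    (sym (∑-+ (h zero) (λ j → ∑ (λ i → h (suc i) j))))

  ∑-δ : ∀ {n} (j : Fin n) (f : Fin n → ℕ) → ∑ (λ i → ι (i == j) * f i) ≡ f j
  ∑-δ {suc n} zero f = trans (cong₂ _+_ (+-identityʳ (f zero)) (∑-0 n)) (+-identityʳ (f zero))
  ∑-δ {suc n} (suc j) f =
    trans (∑-cong (λ i → cong (λ b → ι b * f (suc i)) (suc-== i j))) (∑-δ j (f ∘ suc))
    where
    suc-== : ∀ {n} (i j : Fin n) → (suc i == suc j) ≡ (i == j)
    suc-== i j with i ≟ j
    ... | yes _ = refl
    ... | no _  = refl

  #-single : ∀ {n} (j : Fin n) → # (_== j) ≡ 1
  #-single j = trans (∑-cong (λ i → sym (*-identityʳ (ι (i == j))))) (∑-δ j (λ _ → 1))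

  ≤∑ : ∀ {n} (f : Fin n → ℕ) i → f i ≤ ∑ f
  ≤∑ f zero    = m≤m+n _ _
  ≤∑ f (suc i) = ≤-trans (≤∑ (f ∘ suc) i) (m≤n+m _ _)

  #-mono : ∀ {n} {P Q : Fin n → Bool} → (∀ i → P i ≡ true → Q i ≡ true) → # P ≤ # Q
  #-mono h = ∑-mono (λ i → ι-mono (h i))

  #-cong : ∀ {n} {P Q : Fin n → Bool} → (∀ i → P i ≡ Q i) → # P ≡ # Q
  #-cong h = ∑-cong (λ i → cong ι (h i))

  #-∨ : ∀ {n} (P Q : Fin n → Bool) → # (λ i → P i ∨ Q i) ≤ # P + # Q
  #-∨ P Q = ≤-trans (∑-mono (λ i → lem (P i) (Q i))) (≤-reflexive (∑-+ (ι ∘ P) (ι ∘ Q)))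
    where
    lem : ∀ a b → ι (a ∨ b) ≤ ι a + ι b
    lem true  b = s≤s z≤n
    lem false b = ≤-refl

  #-split : ∀ {n} (P Q : Fin n → Bool) →
    # P ≡ # (λ i → P i ∧ Q i) + # (λ i → P i ∧ not (Q i))
  #-split P Q = trans (∑-cong (λ i → lem (P i) (Q i)))
    (∑-+ (λ i → ι (P i ∧ Q i)) (λ i → ι (P i ∧ not (Q i))))
    where
    lem : ∀ a b → ι a ≡ ι (a ∧ b) + ι (a ∧ not b)
    lem true  true  = refl
    lem true  false = refl
    lem false b     = refl

  #-false : ∀ n → # {n} (λ _ → false) ≡ 0
  #-false = ∑-0

  #≤n : ∀ {n} (P : Fin n → Bool) → # P ≤ n
  #≤n {zero}  P = z≤n
  #≤n {suc n} P = +-mono-≤ (ι≤1 (P zero)) (#≤n (P ∘ suc))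

  #-insert : ∀ {n} {P P′ : Fin n → Bool} v → P v ≡ false → P′ v ≡ true →
    (∀ u → u ≢ v → P′ u ≡ P u) → # P′ ≡ suc (# P)
  #-insert {P = P} {P′} v Pv P′v same =
    trans (∑-cong pointwise) (trans (∑-+ (λ u → ι (u == v)) (ι ∘ P)) (cong (_+ # P) (#-single v)))
    where
    pointwise : ∀ u → ι (P′ u) ≡ ι (u == v) + ι (P u)
    pointwise u with u ≟ v
    ... | yes refl rewrite Pv | P′v = refl
    ... | no u≢v   = cong ι (same u u≢v)

  #≡0⇒false : ∀ {n} {P : Fin n → Bool} → # P ≡ 0 → ∀ i → P i ≡ false
  #≡0⇒false {P = P} e i with P i in eq
  ... | false = refl
  ... | true  = ⊥-elim (1+n≰n (≤-trans (≤-reflexive (cong ι (sym eq))) (≤-trans (≤∑ (ι ∘ P) i) (≤-reflexive e))))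

  find : ∀ {n} (P : Fin n → Bool) → (∃[ i ] P i ≡ true) ⊎ (∀ i → P i ≡ false)
  find {zero}  P = inj₂ (λ ())
  find {suc n} P with P zero in eq
  ... | true  = inj₁ (zero , eq)
  ... | false with find (P ∘ suc)
  ...   | inj₁ (i , h) = inj₁ (suc i , h)
  ...   | inj₂ h       = inj₂ λ { zero → eq ; (suc i) → h i }

  all-false⇒#≡0 : ∀ {n} {P : Fin n → Bool} → (∀ i → P i ≡ false) → # P ≡ 0
  all-false⇒#≡0 {n} h = trans (#-cong h) (#-false n)

  #>0⇒∃ : ∀ {n} (P : Fin n → Bool) → 0 < # P → ∃[ i ] P i ≡ true
  #>0⇒∃ P pos with find P
  ... | inj₁ r = r
  ... | inj₂ h = ⊥-elim (n≮0 (≤-trans pos (≤-reflexive (all-false⇒#≡0 h))))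

  -- If every `f i` with `i` in `S` exceeded `c`, the sum would be at least `(c + 1) * # S`. This
  -- first moment argument replaces random choices in the construction of minors.
  ∃-≤average : ∀ {n} (S : Fin n → Bool) (f : Fin n → ℕ) c → 0 < # S →
    ∑ (λ i → ι (S i) * f i) ≤ c * # S → ∃[ i ] (S i ≡ true × f i ≤ c)
  ∃-≤average S f c pos h with find (λ i → S i ∧ (f i ≤ᵇ c))
  ... | inj₁ (i , e) with ∧-elim {S i} e
  ...   | Si , e′ = i , Si , ≤ᵇ⇒≤ (f i) c (≡true⇒T e′)
  ∃-≤average S f c pos h | inj₂ none = ⊥-elim (<⇒≱ strict h)
    where
    large : ∀ i → S i ≡ true → suc c ≤ f i
    large i Si = ≰⇒> (λ p → true≢false (∧-intro Si (T⇒≡true (≤⇒≤ᵇ p))) (none i))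
    lower : suc c * # S ≤ ∑ (λ i → ι (S i) * f i)
    lower = begin
      suc c * # S                   ≡⟨ *-comm (suc c) (# S) ⟩
      # S * suc c                   ≡⟨ ∑-*ʳ (ι ∘ S) (suc c) ⟨
      ∑ (λ i → ι (S i) * suc c)     ≤⟨ ∑-mono (λ i → ι-*-≤ (S i) (large i)) ⟩
      ∑ (λ i → ι (S i) * f i)       ∎
      where open ≤-Reasoning
    strict : c * # S < ∑ (λ i → ι (S i) * f i)
    strict = ≤-trans (+-monoˡ-≤ (c * # S) pos) lower

  sum-allFin : ∀ n (f : Fin n → ℕ) → sum (map f (allFin n)) ≡ ∑ f
  sum-allFin n f = trans (cong sum (map-tabulate id f)) (sum-tabulate f)
    where
    sum-tabulate : ∀ {n} (f : Fin n → ℕ) → sum (tabulate f) ≡ ∑ f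
    sum-tabulate {zero}  f = refl
    sum-tabulate {suc n} f = cong (f zero +_) (sum-tabulate (f ∘ suc))

  #-initial : ∀ n r → r ≤ n → # {n} (λ v → toℕ v <ᵇ r) ≡ r
  #-initial n       zero    _         = #-false n
  #-initial (suc n) (suc r) (s≤s r≤n) = cong suc (#-initial n r r≤n)

-- Clique models and their transport along minors

module Minors where

  open FiniteSums
  open import Defs using (Walk; here; step; HasCliqueMinor)
  open import Data.Bool using (Bool; true; T)
  open import Data.Fin using (Fin)
  open import Data.Maybe using (Maybe; just; nothing; _>>=_)
  open import Data.Nat using (ℕ)
  open import Data.Product using (∃-syntax; _×_; _,_)
  open import Relation.Nullary using (¬_)
  open import Relation.Binary.PropositionalEquality using (_≡_; refl; subst)

  Rel : ℕ → Set
  Rel n = Fin n → Fin n → Bool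

  walk-map : ∀ {n} {a b : Rel n} {P Q : Fin n → Set} → (∀ {x y} → T (a x y) → T (b x y)) →
    (∀ {x} → P x → Q x) → ∀ {u v} → Walk a P u v → Walk b Q u v
  walk-map f g here         = here
  walk-map f g (step e p w) = step (f e) (g p) (walk-map f g w)

  _++ʷ_ : ∀ {n} {a : Rel n} {P : Fin n → Set} {u v w} → Walk a P u v → Walk a P v w → Walk a P u w
  here       ++ʷ z = z
  step e p y ++ʷ z = step e p (y ++ʷ z)

  -- `Walk` imposes `P` on every vertex but the first, where the reversed walk ends; hence the
  -- separate argument `P u`.
  walk-reverse : ∀ {n} {a : Rel n} {P : Fin n → Set} → (∀ x y → a x y ≡ a y x) →
    ∀ {u v} → P u → Walk a P u v → Walk a P v u
  walk-reverse a-sym pu here = here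
  walk-reverse a-sym pu (step {u} {w} e pw y) =
    walk-reverse a-sym pw y ++ʷ step (subst T (a-sym u w) e) pu here

  -- `HasCliqueMinor` with branch sets confined to `P`. The confinement is what lets models be
  -- composed with a `MinorModel`, whose fibres are nonempty and connected only over `S`.
  record CliqueModel {n} (a : Rel n) (P : Fin n → Bool) (t : ℕ) : Set where
    field
      label     : Fin n → Maybe (Fin t)
      inside    : ∀ {v i} → label v ≡ just i → P v ≡ true
      nonempty  : ∀ i → ∃[ v ] label v ≡ just i
      connected : ∀ i u v → label u ≡ just i → label v ≡ just i → Walk a (λ w → label w ≡ just i) u v
      adjacent  : ∀ i j → ¬ i ≡ j → ∃[ u ] ∃[ v ] (label u ≡ just i × label v ≡ just j × T (a u v))

  cliqueModel⇒hasCliqueMinor : ∀ {n} {a : Rel n} {P t} → CliqueModel a P t → HasCliqueMinor a t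
  cliqueModel⇒hasCliqueMinor K = label , nonempty , connected , adjacent
    where open CliqueModel K

  hasCliqueMinor-mono : ∀ {n} {a b : Rel n} {t} → (∀ {x y} → T (a x y) → T (b x y)) →
    HasCliqueMinor a t → HasCliqueMinor b t
  hasCliqueMinor-mono h (f , ne , conn , adj) =
    f , ne , (λ i u v p q → walk-map h (λ e → e) (conn i u v p q)) ,
    λ i j i≢j → let (u , v , p , q , e) = adj i j i≢j in u , v , p , q , h e

  cliqueModel-weaken : ∀ {n} {a : Rel n} {P Q : Fin n → Bool} {t} →
    (∀ v → P v ≡ true → Q v ≡ true) → CliqueModel a P t → CliqueModel a Q t
  cliqueModel-weaken h K = record
    { label = label ; inside = λ e → h _ (inside e)
    ; nonempty = nonempty ; connected = connected ; adjacent = adjacent }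
    where open CliqueModel K

  -- The graph (S , M) is a minor of (P , a): the branch set of x ∈ S is the fibre of part over x.
  record MinorModel {n} (a : Rel n) (P : Fin n → Bool) (M : Rel n) (S : Fin n → Bool) : Set where
    field
      part      : Fin n → Maybe (Fin n)
      inside    : ∀ {v x} → part v ≡ just x → P v ≡ true
      nonempty  : ∀ x → S x ≡ true → ∃[ v ] part v ≡ just x
      connected : ∀ x u v → S x ≡ true → part u ≡ just x → part v ≡ just x →
                  Walk a (λ w → part w ≡ just x) u v
      edge      : ∀ x y → M x y ≡ true → ∃[ u ] ∃[ v ] (part u ≡ just x × part v ≡ just y × T (a u v))

  just-injective : ∀ {A : Set} {x y : A} → just x ≡ just y → x ≡ y
  just-injective refl = refl

  -- Labels are pulled back along `part`. A walk in `M` is lifted by crossing each fibre with a walk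
  -- inside it and each edge of `M` with the edge of `a` that realises it.
  minor-trans : ∀ {n} {a M : Rel n} {P S : Fin n → Bool} {t} →
    MinorModel a P M S → CliqueModel M S t → CliqueModel a P t
  minor-trans {n} {a} {M} {P} {S} {t} φ K = record
    { label     = lab
    ; inside    = λ {v} e → let (x , px , _) = split v e in φ.inside px
    ; nonempty  = λ i → let (x , lx) = K.nonempty i ; (v , pv) = φ.nonempty x (K.inside lx) in
                        v , join pv lx
    ; connected = λ i u v eu ev →
        let (x , px , lx) = split u eu ; (y , py , ly) = split v ev in
        lift i lx px py (K.connected i x y lx ly)
    ; adjacent  = λ i j i≢j →
        let (x , y , lx , ly , e) = K.adjacent i j i≢j
            (u , v , pu , pv , e′) = φ.edge x y (T⇒≡true e) in
        u , v , join pu lx , join pv ly , e′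
    }
    where
    module φ = MinorModel φ
    module K = CliqueModel K
    lab : Fin n → Maybe (Fin t)
    lab v = φ.part v >>= K.label
    join : ∀ {v x i} → φ.part v ≡ just x → K.label x ≡ just i → lab v ≡ just i
    join p l rewrite p = l
    split : ∀ v {i} → lab v ≡ just i → ∃[ x ] (φ.part v ≡ just x × K.label x ≡ just i)
    split v e with φ.part v
    ... | just x = x , refl , e
    split v () | nothing
    within : ∀ i {x u v} → K.label x ≡ just i → φ.part u ≡ just x → φ.part v ≡ just x →
             Walk a (λ w → lab w ≡ just i) u v
    within i {x} {u} {v} lx pu pv =
      walk-map (λ e → e) (λ p → join p lx) (φ.connected x u v (K.inside lx) pu pv)
    lift : ∀ i {x y u v} → K.label x ≡ just i → φ.part u ≡ just x → φ.part v ≡ just y →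
           Walk M (λ z → K.label z ≡ just i) x y → Walk a (λ w → lab w ≡ just i) u v
    lift i lx pu pv here = within i lx pu pv
    lift i lx pu pv (step {w = z} e lz y) =
      let (u′ , v′ , pu′ , pv′ , e′) = φ.edge _ _ (T⇒≡true e) in
      within i lx pu pu′ ++ʷ step e′ (join pv′ lz) (lift i lz pv′ pv y)

-- Derandomised choice of small dominating sets

module GreedyDomination where

  open FiniteSums
  open Minors
  open import Data.Bool using (Bool; true; false; _∧_; not)
  open import Data.Empty using (⊥-elim)
  open import Data.Fin using (Fin; zero; suc)
  open import Data.List using (List; []; _∷_; length)
  open import Data.List.Membership.Propositional using (_∈_)
  open import Data.List.Relation.Unary.All using (All; []; _∷_)
  open import Data.List.Relation.Unary.Any using () renaming (here to first; there to later)
  open import Data.Nat using (ℕ; zero; suc; _+_; _*_; _^_; _≤_; _<_; NonZero; >-nonZero)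
  open import Data.Nat.Properties hiding (_≟_)
  open import Data.Nat.Tactic.RingSolver using (solve-∀)
  open import Data.Product using (∃-syntax; _×_; _,_; proj₁)
  open import Function using (_∘_)
  open import Relation.Binary.PropositionalEquality using (_≡_; refl; trans; cong; cong₂)

  -- Exchanging the two sums turns a bound for each `u` into a bound for the average over `b` in
  -- `S`. The pair `c`, `d` encodes the fraction `d / c` without division.
  double-count : ∀ {n n′} (S : Fin n → Bool) (P : Fin n′ → Bool) (Q : Fin n′ → Fin n → Bool) c d →
    (∀ u → P u ≡ true → c * # (λ b → S b ∧ Q u b) ≤ d * # S) →
    ∑ (λ b → ι (S b) * (c * # (λ u → P u ∧ Q u b))) ≤ d * # P * # S
  double-count S P Q c d h = begin
    ∑ (λ b → ι (S b) * (c * # (λ u → P u ∧ Q u b)))      ≡⟨ ∑-cong expand ⟩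
    ∑ (λ b → ∑ (λ u → ι (P u) * (c * ι (S b ∧ Q u b))))  ≡⟨ ∑-swap (λ b u → ι (P u) * (c * ι (S b ∧ Q u b))) ⟩
    ∑ (λ u → ∑ (λ b → ι (P u) * (c * ι (S b ∧ Q u b))))  ≡⟨ ∑-cong collect ⟩
    ∑ (λ u → ι (P u) * (c * # (λ b → S b ∧ Q u b)))      ≤⟨ ∑-mono (λ u → ι-*-≤ (P u) (h u)) ⟩
    ∑ (λ u → ι (P u) * (d * # S))                        ≡⟨ ∑-*ʳ (ι ∘ P) (d * # S) ⟩
    # P * (d * # S)                                      ≡⟨ rearrange (# P) d (# S) ⟩
    d * # P * # S                                        ∎
    where
    open ≤-Reasoning
    rearrange : ∀ p d s → p * (d * s) ≡ d * p * s
    rearrange = solve-∀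
    pull : ∀ s p q c → ι s * (c * ι (p ∧ q)) ≡ ι p * (c * ι (s ∧ q))
    pull s p q c rewrite ι-∧ p q | ι-∧ s q = swap (ι s) (ι p) (ι q) c
      where
      swap : ∀ s p q c → s * (c * (p * q)) ≡ p * (c * (s * q))
      swap = solve-∀
    expand : ∀ b → ι (S b) * (c * # (λ u → P u ∧ Q u b)) ≡ ∑ (λ u → ι (P u) * (c * ι (S b ∧ Q u b)))
    expand b = begin-equality
      ι (S b) * (c * # (λ u → P u ∧ Q u b))       ≡⟨ cong (ι (S b) *_) (∑-* c (λ u → ι (P u ∧ Q u b))) ⟨
      ι (S b) * ∑ (λ u → c * ι (P u ∧ Q u b))     ≡⟨ ∑-* (ι (S b)) (λ u → c * ι (P u ∧ Q u b)) ⟨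
      ∑ (λ u → ι (S b) * (c * ι (P u ∧ Q u b)))   ≡⟨ ∑-cong (λ u → pull (S b) (P u) (Q u b) c) ⟩
      ∑ (λ u → ι (P u) * (c * ι (S b ∧ Q u b)))   ∎
    collect : ∀ u → ∑ (λ b → ι (P u) * (c * ι (S b ∧ Q u b))) ≡ ι (P u) * (c * # (λ b → S b ∧ Q u b))
    collect u = trans (∑-* (ι (P u)) (λ b → c * ι (S b ∧ Q u b)))
                      (cong (ι (P u) *_) (∑-* c (λ b → ι (S b ∧ Q u b))))

  ^-distribʳ-* : ∀ n a b → (a * b) ^ n ≡ a ^ n * b ^ n
  ^-distribʳ-* zero    a b = refl
  ^-distribʳ-* (suc n) a b rewrite ^-distribʳ-* n a b = interchange a b (a ^ n) (b ^ n)
    where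
    interchange : ∀ a b x y → a * b * (x * y) ≡ a * x * (b * y)
    interchange = solve-∀

  -- Rests on 2 · 7⁶ ≤ 8⁶: six steps that each keep at most 7/8 of the undominated vertices halve
  -- their number. This is the origin of the length `6 * (2 + m)` of the dominating sets.
  powers-of-7-and-8 : ∀ m → 2 ^ m * 7 ^ (6 * m) ≤ 8 ^ (6 * m)
  powers-of-7-and-8 m = begin
    2 ^ m * 7 ^ (6 * m)     ≡⟨ cong (2 ^ m *_) (^-*-assoc 7 6 m) ⟨
    2 ^ m * (7 ^ 6) ^ m     ≡⟨ ^-distribʳ-* m 2 (7 ^ 6) ⟨
    (2 * 7 ^ 6) ^ m         ≤⟨ ^-monoˡ-≤ m (≤ᵇ⇒≤ (2 * 7 ^ 6) (8 ^ 6) _) ⟩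
    (8 ^ 6) ^ m             ≡⟨ ^-*-assoc 8 6 m ⟩
    8 ^ (6 * m)             ∎
    where open ≤-Reasoning

  missed : ∀ {n} → Rel n → (Fin n → Bool) → List (Fin n) → Fin n → Bool
  missed M S []       u = S u
  missed M S (b ∷ bs) u = missed M S bs u ∧ not (M u b)

  -- In the application `A x` contains every vertex of `S` without a neighbour in the branch set
  -- `x`; as soon as `bs` leaves `A x`, a branch set containing `bs` is adjacent to `x`.
  trapped : ∀ {n j} → (Fin j → Fin n → Bool) → List (Fin n) → Fin j → Bool
  trapped A []       x = true
  trapped A (b ∷ bs) x = trapped A bs x ∧ A x b

  missed⊆S : ∀ {n} (M : Rel n) S bs u → missed M S bs u ≡ true → S u ≡ true
  missed⊆S M S []       u e = e
  missed⊆S M S (b ∷ bs) u e = missed⊆S M S bs u (proj₁ (∧-elim e))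

  dominated : ∀ {n} (M : Rel n) S bs u → S u ≡ true → missed M S bs u ≡ false →
    ∃[ b ] (b ∈ bs × M u b ≡ true)
  dominated M S [] u Su e = ⊥-elim (true≢false Su e)
  dominated M S (b ∷ bs) u Su e with M u b in eq
  ... | true  = b , first refl , eq
  ... | false with missed M S bs u in eq′
  ...   | false = let (b′ , b′∈ , h) = dominated M S bs u Su eq′ in b′ , later b′∈ , h
  dominated M S (b ∷ bs) u Su () | false | true

  escapes : ∀ {n j} (A : Fin j → Fin n → Bool) bs x → trapped A bs x ≡ false →
    ∃[ b ] (b ∈ bs × A x b ≡ false)
  escapes A (b ∷ bs) x e with A x b in eq
  ... | false = b , first refl , eq
  ... | true with trapped A bs x in eq′
  ...   | false = let (b′ , b′∈ , h) = escapes A bs x eq′ in b′ , later b′∈ , h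
  escapes A (b ∷ bs) x () | true | true

  -- A derandomised choice of a small set bs ⊆ S′ which dominates almost all of S and is
  -- contained in none of the sets A x: every further element multiplies the two terms of
  -- the potential α · #missed + β · #trapped by at most 7/8 and 2⁻ᵐ on average.
  module Greedy {n j : ℕ} (M : Rel n) (S S′ : Fin n → Bool) (A : Fin j → Fin n → Bool) (m t : ℕ)
    (dominating : ∀ u → S u ≡ true → # S′ ≤ 8 * # (λ b → S′ b ∧ M u b))
    (small : ∀ x → 2 ^ m * # (λ b → S′ b ∧ A x b) ≤ # S′)
    (nonempty : 0 < # S′) (j≤t : j ≤ t) where

    extend : ∀ α β bs → ∃[ b ] (S′ b ≡ true ×
      8 * α * # (missed M S (b ∷ bs)) + 7 * 2 ^ m * β * # (trapped A (b ∷ bs))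
        ≤ 7 * (α * # (missed M S bs) + β * # (trapped A bs)))
    extend α β bs = ∃-≤average S′ _ _ nonempty (begin
      ∑ (λ b → ι (S′ b) * (f b + g b))                    ≡⟨ ∑-cong (λ b → *-distribˡ-+ (ι (S′ b)) (f b) (g b)) ⟩
      ∑ (λ b → ι (S′ b) * f b + ι (S′ b) * g b)           ≡⟨ ∑-+ (λ b → ι (S′ b) * f b) (λ b → ι (S′ b) * g b) ⟩
      ∑ (λ b → ι (S′ b) * f b) + ∑ (λ b → ι (S′ b) * g b) ≤⟨ +-mono-≤
          (double-count S′ (missed M S bs) (λ u b → not (M u b)) (8 * α) (7 * α) undominated)
          (double-count S′ (trapped A bs) A (7 * 2 ^ m * β) (7 * β) contained) ⟩
      7 * α * # (missed M S bs) * # S′ + 7 * β * # (trapped A bs) * # S′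
        ≡⟨ collect α β (# (missed M S bs)) (# (trapped A bs)) (# S′) ⟩
      7 * (α * # (missed M S bs) + β * # (trapped A bs)) * # S′ ∎)
      where
      open ≤-Reasoning
      f g : Fin n → ℕ
      f b = 8 * α * # (missed M S (b ∷ bs))
      g b = 7 * 2 ^ m * β * # (trapped A (b ∷ bs))
      collect : ∀ α β x y s → 7 * α * x * s + 7 * β * y * s ≡ 7 * (α * x + β * y) * s
      collect = solve-∀
      undominated : ∀ u → missed M S bs u ≡ true → 8 * α * # (λ b → S′ b ∧ not (M u b)) ≤ 7 * α * # S′
      undominated u e = arith α (# S′) _ _ (dominating u (missed⊆S M S bs u e)) (#-split S′ (M u))
        where
        arith : ∀ α s x y → s ≤ 8 * x → s ≡ x + y → 8 * α * y ≤ 7 * α * s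
        arith α _ x y h refl = linear 0 (*-monoʳ-≤ α h) (identity α x y)
          where
          identity : ∀ α x y → 8 * α * y + α * (8 * x) + 0 ≡ 7 * α * (x + y) + α * (x + y)
          identity = solve-∀
      contained : ∀ x → trapped A bs x ≡ true → 7 * 2 ^ m * β * # (λ b → S′ b ∧ A x b) ≤ 7 * β * # S′
      contained x _ = ≤-trans (≤-reflexive (rearrange (2 ^ m) β _)) (*-monoʳ-≤ (7 * β) (small x))
        where
        rearrange : ∀ p β y → 7 * p * β * y ≡ 7 * β * (p * y)
        rearrange = solve-∀

    -- The potential after `i` steps with denominators cleared: `e`, `r` and `c` stand for the
    -- powers of 8, `7 * 2 ^ m` and 7. The weights `t` and `# S` give both terms the same initial
    -- bound `# S * t`.
    Choice : ℕ → ℕ → ℕ → ℕ → Set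
    Choice i e r c = ∃[ bs ] (length bs ≡ i × All (λ b → S′ b ≡ true) bs ×
      t * e * # (missed M S bs) + # S * r * # (trapped A bs) ≤ c * (2 * # S * t))

    choose-one : ∀ i e r c → Choice i e r c → Choice (suc i) (8 * e) (7 * 2 ^ m * r) (7 * c)
    choose-one i e r c (bs , len , inS′ , bound) =
      let (b , b∈S′ , bound′) = extend (t * e) (# S * r) bs in
      b ∷ bs , cong suc len , b∈S′ ∷ inS′ , (begin
      t * (8 * e) * x b + # S * (7 * 2 ^ m * r) * y b            ≡⟨ cong₂ _+_ (shift t e (x b)) (shift′ (# S) (2 ^ m) r (y b)) ⟩
      8 * (t * e) * x b + 7 * 2 ^ m * (# S * r) * y b            ≤⟨ bound′ ⟩
      7 * (t * e * # (missed M S bs) + # S * r * # (trapped A bs))     ≤⟨ *-monoʳ-≤ 7 bound ⟩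
      7 * (c * (2 * # S * t))                                    ≡⟨ *-assoc 7 c (2 * # S * t) ⟨
      7 * c * (2 * # S * t)                                      ∎)
      where
      open ≤-Reasoning
      x y : Fin n → ℕ
      x b = # (missed M S (b ∷ bs))
      y b = # (trapped A (b ∷ bs))
      shift : ∀ t e x → t * (8 * e) * x ≡ 8 * (t * e) * x
      shift = solve-∀
      shift′ : ∀ s p r y → s * (7 * p * r) * y ≡ 7 * p * (s * r) * y
      shift′ = solve-∀

    choose : ∀ i → Choice i (8 ^ i) ((7 * 2 ^ m) ^ i) (7 ^ i)
    choose zero = [] , refl , [] , (begin
      t * 1 * # S + # S * 1 * # {j} (λ _ → true)  ≤⟨ +-monoʳ-≤ (t * 1 * # S) (*-monoʳ-≤ (# S * 1) (≤-trans (#≤n {j} (λ _ → true)) j≤t)) ⟩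
      t * 1 * # S + # S * 1 * t                   ≡⟨ identity t (# S) ⟩
      1 * (2 * # S * t)                           ∎)
      where
      open ≤-Reasoning
      identity : ∀ t s → t * 1 * s + s * 1 * t ≡ 1 * (2 * s * t)
      identity = solve-∀
    choose (suc i) = choose-one i (8 ^ i) ((7 * 2 ^ m) ^ i) (7 ^ i) (choose i)

    module _ (ℓ : ℕ) (0<t : 0 < t) (0<S : 0 < # S)
      (powers : 2 ^ (2 + m) * 7 ^ ℓ ≤ 8 ^ ℓ) (few : 2 * t < 2 ^ (m * ℓ)) where

      -- Each of the two terms is at most the whole potential. For the first, `powers` yields the
      -- fraction 2⁻ᵐ⁻¹, its extra factor 2 paying for the 2 in `2 * # S * t`; for the second, `few`
      -- forces an integer below 1, hence 0.
      conclude : ∃[ bs ] (length bs ≡ ℓ × All (λ b → S′ b ≡ true) bs ×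
        2 ^ suc m * # (missed M S bs) ≤ # S × (∀ x → trapped A bs x ≡ false))
      conclude with choose ℓ
      ... | bs , len , inS′ , bound = bs , len , inS′ , few-missed , #≡0⇒false none-trapped
        where
        open ≤-Reasoning
        instance
          t-nz : NonZero t
          t-nz = >-nonZero 0<t
          S-nz : NonZero (# S)
          S-nz = >-nonZero 0<S
          7^ℓ-nz : NonZero (7 ^ ℓ)
          7^ℓ-nz = m^n≢0 7 ℓ
        few-missed : 2 ^ suc m * # (missed M S bs) ≤ # S
        few-missed = *-cancelˡ-≤ (2 * 7 ^ ℓ * t) {{m*n≢0 (2 * 7 ^ ℓ) t {{m*n≢0 2 (7 ^ ℓ)}}}} (begin
          2 * 7 ^ ℓ * t * (2 ^ suc m * x)     ≡⟨ identity (7 ^ ℓ) t (2 ^ m) x ⟩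
          t * (2 ^ (2 + m) * 7 ^ ℓ) * x       ≤⟨ *-monoˡ-≤ x (*-monoʳ-≤ t powers) ⟩
          t * 8 ^ ℓ * x                       ≤⟨ m≤m+n _ _ ⟩
          t * 8 ^ ℓ * x + _                   ≤⟨ bound ⟩
          7 ^ ℓ * (2 * # S * t)               ≡⟨ identity′ (7 ^ ℓ) (# S) t ⟩
          2 * 7 ^ ℓ * t * # S                 ∎)
          where
          x = # (missed M S bs)
          identity : ∀ s t p x → 2 * s * t * (2 * p * x) ≡ t * (2 * (2 * p) * s) * x
          identity = solve-∀
          identity′ : ∀ s u t → s * (2 * u * t) ≡ 2 * s * t * u
          identity′ = solve-∀
        trapped-bound : 2 ^ (m * ℓ) * # (trapped A bs) ≤ 2 * t
        trapped-bound = *-cancelˡ-≤ (# S * 7 ^ ℓ) {{m*n≢0 (# S) (7 ^ ℓ)}} (begin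
          # S * 7 ^ ℓ * (2 ^ (m * ℓ) * y)     ≡⟨ cong (λ z → # S * 7 ^ ℓ * (z * y)) (^-*-assoc 2 m ℓ) ⟨
          # S * 7 ^ ℓ * ((2 ^ m) ^ ℓ * y)     ≡⟨ identity (# S) (7 ^ ℓ) ((2 ^ m) ^ ℓ) y ⟩
          # S * (7 ^ ℓ * (2 ^ m) ^ ℓ) * y     ≡⟨ cong (λ z → # S * z * y) (^-distribʳ-* ℓ 7 (2 ^ m)) ⟨
          # S * (7 * 2 ^ m) ^ ℓ * y           ≤⟨ m≤n+m _ _ ⟩
          _ + # S * (7 * 2 ^ m) ^ ℓ * y       ≤⟨ bound ⟩
          7 ^ ℓ * (2 * # S * t)               ≡⟨ identity′ (7 ^ ℓ) (# S) t ⟩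
          # S * 7 ^ ℓ * (2 * t)               ∎)
          where
          y = # (trapped A bs)
          identity : ∀ u s p y → u * s * (p * y) ≡ u * (s * p) * y
          identity = solve-∀
          identity′ : ∀ s u t → s * (2 * u * t) ≡ u * s * (2 * t)
          identity′ = solve-∀
        none-trapped : # (trapped A bs) ≡ 0
        none-trapped with # (trapped A bs) | trapped-bound
        ... | zero  | _ = refl
        ... | suc y | h = ⊥-elim (<⇒≱ few (≤-trans (m≤m*n (2 ^ (m * ℓ)) (suc y)) h))

-- Clique minors in dense graphs that stay linked after small deletions

module DenseMinors where

  open FiniteSums
  open Minors
  open GreedyDomination
  open import Defs using (Walk; here; step)
  open import Data.Bool using (Bool; true; false; _∧_; _∨_; not; T; if_then_else_)
  open import Data.Bool.Properties using (∧-identityʳ)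
  open import Data.Empty using (⊥-elim)
  open import Data.Fin using (Fin; zero; suc)
  open import Data.List using (List; []; _∷_; length)
  open import Data.List.Membership.Propositional using (_∈_)
  open import Data.List.Relation.Unary.All using (All; []; _∷_)
  open import Data.List.Relation.Unary.Any using () renaming (here to first; there to later)
  open import Data.Maybe using (Maybe; just; nothing; is-just)
  import Data.Maybe as Maybe
  open import Data.Nat using (ℕ; zero; suc; _+_; _*_; _^_; _≤_; _<_; z≤n; s≤s)
  open import Data.Nat.Properties hiding (_≟_)
  open import Data.Nat.Tactic.RingSolver using (solve-∀)
  open import Data.Product using (∃-syntax; _×_; _,_; proj₁; proj₂)
  open import Data.Sum as Sum using (_⊎_; inj₁; inj₂; [_,_]′)
  open import Function using (_∘_)
  open import Relation.Nullary using (¬_)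
  open import Relation.Binary.PropositionalEquality using (_≡_; refl; sym; trans; cong; subst)

  Near : ∀ {n} → Rel n → Fin n → Fin n → Set
  Near M x y = x ≡ y ⊎ M x y ≡ true

  Linked : ∀ {n} → Rel n → (Fin n → Bool) → Fin n → Fin n → Set
  Linked M S x y = ∃[ p ] ∃[ q ] (S p ≡ true × S q ≡ true × Near M x p × Near M p q × Near M q y)

  record Hub {n} (M : Rel n) (S : Fin n → Bool) (b₀ : Fin n) (bs : List (Fin n)) : Set where
    field
      set     : Fin n → Bool
      inside  : ∀ v → set v ≡ true → S v ≡ true
      centre  : set b₀ ≡ true
      covers  : ∀ {b} → b ∈ bs → set b ≡ true
      size    : # set ≤ 1 + 3 * length bs
      reach   : ∀ v → set v ≡ true → Walk M (λ w → set w ≡ true) b₀ v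

  near-walk : ∀ {n} {M : Rel n} {P : Fin n → Set} {x y} → Near M x y → P y → Walk M P x y
  near-walk (inj₁ refl) py = here
  near-walk (inj₂ e)    py = step (≡true⇒T e) py here

  -- Each new element is tied to `b₀` through at most two intermediate vertices, whence the factor 3
  -- in `size`. `Goal` is the way out when a link is missing: the caller then obtains its conclusion
  -- from the missing link, and the hub is abandoned.
  hub : ∀ {n} {Goal : Set} (M : Rel n) S b₀ → S b₀ ≡ true →
    (∀ x y → S x ≡ true → S y ≡ true → Linked M S x y ⊎ Goal) →
    ∀ bs → All (λ b → S b ≡ true) bs → Hub M S b₀ bs ⊎ Goal
  hub M S b₀ Sb₀ link [] [] = inj₁ record
    { set = _== b₀ ; inside = λ v e → subst (λ z → S z ≡ true) (sym (==⇒≡ e)) Sb₀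
    ; centre = ==-refl b₀ ; covers = λ () ; size = ≤-reflexive (#-single b₀)
    ; reach = λ v e → subst (Walk M _ b₀) (sym (==⇒≡ e)) here }
  hub {n} M S b₀ Sb₀ link (b ∷ bs) (Sb ∷ Sbs) with hub M S b₀ Sb₀ link bs Sbs
  ... | inj₂ g = inj₂ g
  ... | inj₁ H with link b₀ b Sb₀ Sb
  ...   | inj₂ g = inj₂ g
  ...   | inj₁ (p , q , Sp , Sq , near₁ , near₂ , near₃) = inj₁ record
    { set = set′ ; inside = inside′ ; centre = old H.centre
    ; covers = λ { (first refl) → new-b ; (later z) → old (H.covers z) }
    ; size = size′ ; reach = reach′ }
    where
    module H = Hub H
    added set′ : Fin n → Bool
    added v = (v == p) ∨ ((v == q) ∨ (v == b))
    set′ v = H.set v ∨ added v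
    old : ∀ {v} → H.set v ≡ true → set′ v ≡ true
    old = ∨-introˡ
    new-p : set′ p ≡ true
    new-p = ∨-introʳ {H.set p} (∨-introˡ (==-refl p))
    new-q : set′ q ≡ true
    new-q = ∨-introʳ {H.set q} (∨-introʳ {q == p} (∨-introˡ (==-refl q)))
    new-b : set′ b ≡ true
    new-b = ∨-introʳ {H.set b} (∨-introʳ {b == p} (∨-introʳ {b == q} (==-refl b)))
    cases : ∀ {v} → set′ v ≡ true → H.set v ≡ true ⊎ v ≡ p ⊎ v ≡ q ⊎ v ≡ b
    cases {v} e with ∨-elim {H.set v} e
    ... | inj₁ h = inj₁ h
    ... | inj₂ h with ∨-elim {v == p} h
    ...   | inj₁ h′ = inj₂ (inj₁ (==⇒≡ h′))
    ...   | inj₂ h′ with ∨-elim {v == q} h′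
    ...     | inj₁ h″ = inj₂ (inj₂ (inj₁ (==⇒≡ h″)))
    ...     | inj₂ h″ = inj₂ (inj₂ (inj₂ (==⇒≡ h″)))
    inside′ : ∀ v → set′ v ≡ true → S v ≡ true
    inside′ v e with cases {v} e
    ... | inj₁ h                   = H.inside v h
    ... | inj₂ (inj₁ refl)         = Sp
    ... | inj₂ (inj₂ (inj₁ refl))  = Sq
    ... | inj₂ (inj₂ (inj₂ refl))  = Sb
    to-p : Walk M (λ w → set′ w ≡ true) b₀ p
    to-p = near-walk near₁ new-p
    to-q : Walk M (λ w → set′ w ≡ true) b₀ q
    to-q = to-p ++ʷ near-walk near₂ new-q
    reach′ : ∀ v → set′ v ≡ true → Walk M (λ w → set′ w ≡ true) b₀ v
    reach′ v e with cases {v} e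
    ... | inj₁ h                   = walk-map (λ z → z) old (H.reach v h)
    ... | inj₂ (inj₁ refl)         = to-p
    ... | inj₂ (inj₂ (inj₁ refl))  = to-q
    ... | inj₂ (inj₂ (inj₂ refl))  = to-q ++ʷ near-walk near₃ new-b
    size′ : # set′ ≤ 1 + 3 * suc (length bs)
    size′ = begin
      # set′                                         ≤⟨ #-∨ H.set added ⟩
      # H.set + # added                              ≤⟨ +-mono-≤ H.size (≤-trans (#-∨ (_== p) (λ v → (v == q) ∨ (v == b))) (+-monoʳ-≤ (# (_== p)) (#-∨ (_== q) (_== b)))) ⟩
      1 + 3 * length bs + (# (_== p) + (# (_== q) + # (_== b)))
        ≡⟨ cong (1 + 3 * length bs +_) (trans (cong (_+ (# (_== q) + # (_== b))) (#-single p)) (cong suc (trans (cong (_+ # (_== b)) (#-single q)) (cong suc (#-single b))))) ⟩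
      1 + 3 * length bs + 3                          ≡⟨ identity (length bs) ⟩
      1 + 3 * suc (length bs)                        ∎
      where
      open ≤-Reasoning
      identity : ∀ l → 1 + 3 * l + 3 ≡ 1 + 3 * suc l
      identity = solve-∀

  -- Alon, Krivelevich and Sudakov's construction of a clique minor in a dense graph: the
  -- branch sets are chosen one after another, each of them dominating all but a 2⁻ᵐ⁻¹
  -- fraction of S and escaping from the exceptional sets of all its predecessors.
  module DenseMinor {n : ℕ} (M : Rel n) (M-sym : ∀ x y → M x y ≡ M y x) (S : Fin n → Bool)
    (m t ℓ : ℕ) (Goal : Set) (0<t : 0 < t) (0<ℓ : 0 < ℓ)
    (powers : 2 ^ (2 + m) * 7 ^ ℓ ≤ 8 ^ ℓ) (few : 2 * t < 2 ^ (m * ℓ))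
    (room : 48 * (ℓ * t) ≤ # S)
    (dense : ∀ u → S u ≡ true → 3 * # S ≤ 16 * # (λ v → S v ∧ M u v))
    (link : ∀ W → 16 * # W ≤ # S → ∀ x y → S x ∧ not (W x) ≡ true → S y ∧ not (W y) ≡ true →
            Linked M (λ v → S v ∧ not (W v)) x y ⊎ Goal) where

    record Partial (j : ℕ) : Set where
      field
        model   : CliqueModel M S j
        missing : Fin j → Fin n → Bool
      open CliqueModel model public
      used : Fin n → Bool
      used v = is-just (label v)
      field
        used-bound    : # used ≤ 3 * (ℓ * j)
        missing-small : ∀ i → 2 ^ suc m * # (missing i) ≤ # S
        touches       : ∀ i u → S u ≡ true → missing i u ≡ false → ∃[ v ] (label v ≡ just i × M u v ≡ true)

    0<S : 0 < # S
    0<S = ≤-trans (*-mono-≤ {1} {48} (s≤s z≤n) (*-mono-≤ 0<ℓ 0<t)) room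

    start : Partial 0
    start = record
      { model = record { label = λ _ → nothing ; inside = λ () ; nonempty = λ () ; connected = λ () ; adjacent = λ () }
      ; missing = λ () ; used-bound = ≤-trans (≤-reflexive (#-false n)) z≤n
      ; missing-small = λ () ; touches = λ () }

    module Next {j : ℕ} (j<t : j < t) (π : Partial j) where
      open Partial π
      S′ : Fin n → Bool
      S′ v = S v ∧ not (used v)

      used-small : 16 * # used ≤ # S
      used-small = ≤-trans (*-monoʳ-≤ 16 used-bound) (≤-trans
        (≤-trans (≤-reflexive (identity ℓ j)) (*-monoʳ-≤ 48 (*-monoʳ-≤ ℓ (<⇒≤ j<t)))) room)
        where
        identity : ∀ ℓ j → 16 * (3 * (ℓ * j)) ≡ 48 * (ℓ * j)
        identity = solve-∀

      drop-used : ∀ (P : Fin n → Bool) → # (λ v → S v ∧ P v) ≤ # (λ v → S′ v ∧ P v) + # used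
      drop-used P = ≤-trans (∑-mono (λ v → lem (S v) (P v) (used v))) (≤-reflexive (∑-+ (λ v → ι (S′ v ∧ P v)) (ι ∘ used)))
        where
        lem : ∀ s p u → ι (s ∧ p) ≤ ι ((s ∧ not u) ∧ p) + ι u
        lem true  p true  = ≤-trans (ι≤1 p) (s≤s z≤n)
        lem true  p false = m≤m+n _ _
        lem false p u     = z≤n

      S≤S′ : # S ≤ # S′ + # used
      S≤S′ = ≤-trans (≤-reflexive (#-cong (λ v → sym (∧-identityʳ (S v))))) (≤-trans (drop-used (λ _ → true))
               (+-monoˡ-≤ (# used) (≤-reflexive (#-cong (λ v → ∧-identityʳ (S′ v))))))

      S′≤S : # S′ ≤ # S
      S′≤S = #-mono {P = S′} {S} (λ v e → proj₁ (∧-elim e))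

      -- Of the 3/16 of `S` adjacent to `u`, used vertices account for at most 1/16, and 1/8
      -- remains.
      dominating : ∀ u → S u ≡ true → # S′ ≤ 8 * # (λ b → S′ b ∧ M u b)
      dominating u Su = arith (# S′) (# S) (# (λ v → S v ∧ M u v)) (# (λ b → S′ b ∧ M u b)) (# used) S′≤S (dense u Su) (drop-used (M u)) used-small
        where
        arith : ∀ s′ s d d′ u → s′ ≤ s → 3 * s ≤ 16 * d → d ≤ d′ + u → 16 * u ≤ s → s′ ≤ 8 * d′
        arith s′ s d d′ u h₁ h₂ h₃ h₄ = *-cancelˡ-≤ 2 (linear 0
          (+-mono-≤ (+-mono-≤ (*-monoʳ-≤ 2 h₁) h₂) (+-mono-≤ (*-monoʳ-≤ 16 h₃) h₄)) (identity s′ s d d′ u))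
          where
          identity : ∀ s′ s d d′ u → 2 * s′ + (2 * s + 16 * d + (16 * (d′ + u) + s)) + 0
                     ≡ 2 * (8 * d′) + (2 * s′ + 3 * s + (16 * d + 16 * u))
          identity = solve-∀

      small : ∀ x → 2 ^ m * # (λ b → S′ b ∧ missing x b) ≤ # S′
      -- The spare factor 2 in `missing-small` compensates for the passage from `S` to `S′`, which
      -- has at least half as many elements.
      small x = *-cancelˡ-≤ 2 (≤-trans
        (≤-trans (≤-reflexive (sym (*-assoc 2 (2 ^ m) _)))
          (≤-trans (*-monoʳ-≤ (2 ^ suc m) (#-mono {P = λ b → S′ b ∧ missing x b} {missing x} (λ b e → proj₂ (∧-elim {S′ b} e)))) (missing-small x)))
        (half (# S) (# S′) (# used) S≤S′ used-small))
        where
        half : ∀ s s′ u → s ≤ s′ + u → 16 * u ≤ s → s ≤ 2 * s′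
        half s s′ u h₁ h₂ = *-cancelˡ-≤ 8 (linear (7 * s) (+-mono-≤ (*-monoʳ-≤ 16 h₁) h₂) (identity s s′ u))
          where
          identity : ∀ s s′ u → 8 * s + (16 * (s′ + u) + s) + 7 * s ≡ 8 * (2 * s′) + (16 * s + 16 * u)
          identity = solve-∀

      0<S′ : 0 < # S′
      0<S′ = arith (# S) (# S′) (# used) 0<S S≤S′ used-small
        where
        arith : ∀ s s′ u → 0 < s → s ≤ s′ + u → 16 * u ≤ s → 0 < s′
        arith s (suc s′) u _ _ _ = s≤s z≤n
        arith s zero u pos h₁ h₂ = ⊥-elim (<⇒≱ (*-monoʳ-< 15 pos) (linear 0 (+-mono-≤ (*-monoʳ-≤ 16 h₁) h₂) (identity s u)))
          where
          identity : ∀ s u → 15 * s + (16 * u + s) + 0 ≡ 15 * 0 + (16 * s + 16 * u)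
          identity = solve-∀

      open Greedy M S S′ missing m t dominating small 0<S′ (<⇒≤ j<t)

      module Add (b₀ : Fin n) (bs : List (Fin n)) (len : length (b₀ ∷ bs) ≡ ℓ)
        (few-missed : 2 ^ suc m * # (missed M S (b₀ ∷ bs)) ≤ # S)
        (free : ∀ x → trapped missing (b₀ ∷ bs) x ≡ false) (H : Hub M S′ b₀ bs) where
        module H = Hub H

        label′ : Fin n → Maybe (Fin (suc j))
        label′ v = if H.set v then just zero else Maybe.map suc (label v)

        new : ∀ {v} → H.set v ≡ true → label′ v ≡ just zero
        new e rewrite e = refl

        fresh : ∀ {v i} → label v ≡ just i → H.set v ≡ false
        fresh {v} e = ¬true⇒false (λ h → true≢false (cong is-just e)
          (not-elim (proj₂ (∧-elim {S v} (H.inside v h)))))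

        old : ∀ {v i} → label v ≡ just i → label′ v ≡ just (suc i)
        old {v} e rewrite fresh e | e = refl

        zero⁻¹ : ∀ {v} → label′ v ≡ just zero → H.set v ≡ true
        zero⁻¹ {v} e with H.set v
        ... | true = refl
        ... | false with label v
        zero⁻¹ () | false | just _
        zero⁻¹ () | false | nothing

        suc⁻¹ : ∀ {v i} → label′ v ≡ just (suc i) → label v ≡ just i
        suc⁻¹ {v} e with H.set v
        suc⁻¹ () | true
        ... | false with label v
        suc⁻¹ refl | false | just _ = refl
        suc⁻¹ () | false | nothing

        in-hub : ∀ {b} → b ∈ b₀ ∷ bs → label′ b ≡ just zero
        in-hub (first refl) = new H.centre
        in-hub (later z)    = new (H.covers z)

        hub-in-S : ∀ {v} → H.set v ≡ true → S v ≡ true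
        hub-in-S {v} h = proj₁ (∧-elim (H.inside v h))

        meets : ∀ i → ∃[ u ] ∃[ v ] (label′ u ≡ just zero × label′ v ≡ just (suc i) × M u v ≡ true)
        meets i =
          let (b , b∈ , h) = escapes missing (b₀ ∷ bs) i (free i)
              (v , lv , e) = touches i b (hub-in-S (zero⁻¹ (in-hub b∈))) h in
          b , v , in-hub b∈ , old lv , e

        connected′ : ∀ i u v → label′ u ≡ just i → label′ v ≡ just i → Walk M (λ w → label′ w ≡ just i) u v
        connected′ zero u v eu ev = walk-map (λ z → z) new
          (walk-reverse M-sym H.centre (H.reach u (zero⁻¹ eu)) ++ʷ H.reach v (zero⁻¹ ev))
        connected′ (suc i) u v eu ev = walk-map (λ z → z) old (connected i u v (suc⁻¹ eu) (suc⁻¹ ev))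

        adjacent′ : ∀ i j → ¬ i ≡ j → ∃[ u ] ∃[ v ] (label′ u ≡ just i × label′ v ≡ just j × T (M u v))
        adjacent′ zero zero i≢j = ⊥-elim (i≢j refl)
        adjacent′ zero (suc i) _ = let (u , v , eu , ev , e) = meets i in u , v , eu , ev , ≡true⇒T e
        adjacent′ (suc i) zero _ = let (u , v , eu , ev , e) = meets i in
          v , u , ev , eu , ≡true⇒T (trans (M-sym v u) e)
        adjacent′ (suc i) (suc i′) i≢i′ =
          let (u , v , eu , ev , e) = adjacent i i′ (λ z → i≢i′ (cong suc z)) in u , v , old eu , old ev , e

        inside′ : ∀ {v i} → label′ v ≡ just i → S v ≡ true
        inside′ {v} {zero}  e = hub-in-S (zero⁻¹ {v} e)
        inside′ {v} {suc i} e = inside (suc⁻¹ {v} e)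

        nonempty′ : ∀ i → ∃[ v ] label′ v ≡ just i
        nonempty′ zero    = b₀ , new H.centre
        nonempty′ (suc i) = let (v , e) = nonempty i in v , old e

        missing′ : Fin (suc j) → Fin n → Bool
        missing′ zero    = missed M S (b₀ ∷ bs)
        missing′ (suc i) = missing i

        missing-small′ : ∀ i → 2 ^ suc m * # (missing′ i) ≤ # S
        missing-small′ zero    = few-missed
        missing-small′ (suc i) = missing-small i

        touches′ : ∀ i u → S u ≡ true → missing′ i u ≡ false → ∃[ v ] (label′ v ≡ just i × M u v ≡ true)
        touches′ zero u Su e = let (b , b∈ , h) = dominated M S (b₀ ∷ bs) u Su e in b , in-hub b∈ , h
        touches′ (suc i) u Su e = let (v , lv , h) = touches i u Su e in v , old lv , h

        used-bound′ : # (λ v → is-just (label′ v)) ≤ 3 * (ℓ * suc j)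
        used-bound′ = begin
          # (λ v → is-just (label′ v))       ≤⟨ #-mono covered ⟩
          # (λ v → H.set v ∨ used v)         ≤⟨ #-∨ H.set used ⟩
          # H.set + # used                   ≤⟨ +-mono-≤ (≤-trans H.size (s≤s (m≤n+m (3 * length bs) 2))) used-bound ⟩
          3 + 3 * length bs + 3 * (ℓ * j)    ≡⟨ cong (_+ 3 * (ℓ * j)) (trans (identity (length bs)) (cong (3 *_) len)) ⟩
          3 * ℓ + 3 * (ℓ * j)                ≡⟨ identity′ ℓ j ⟩
          3 * (ℓ * suc j)                    ∎
          where
          open ≤-Reasoning
          identity : ∀ l → 3 + 3 * l ≡ 3 * suc l
          identity = solve-∀
          identity′ : ∀ ℓ j → 3 * ℓ + 3 * (ℓ * j) ≡ 3 * (ℓ * suc j)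
          identity′ = solve-∀
          covered : ∀ v → is-just (label′ v) ≡ true → H.set v ∨ used v ≡ true
          covered v e with H.set v
          ... | true = refl
          ... | false with label v
          ...   | just _ = refl
          covered v () | false | nothing

        next : Partial (suc j)
        next = record
          { model = record { label = label′ ; inside = λ {v} → inside′ {v} ; nonempty = nonempty′
                           ; connected = connected′ ; adjacent = adjacent′ }
          ; missing = missing′ ; used-bound = used-bound′
          ; missing-small = missing-small′ ; touches = touches′ }

      build : ∀ bs → length bs ≡ ℓ → All (λ b → S′ b ≡ true) bs →
        2 ^ suc m * # (missed M S bs) ≤ # S → (∀ x → trapped missing bs x ≡ false) → Partial (suc j) ⊎ Goal
      build [] len _ _ _ = ⊥-elim (<⇒≱ 0<ℓ (≤-reflexive (sym len)))
      build (b₀ ∷ bs) len (Sb₀ ∷ Sbs) few-missed free =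
        Sum.map₁ (Add.next b₀ bs len few-missed free) (hub M S′ b₀ Sb₀ (link used used-small) bs Sbs)

      step-partial : Partial (suc j) ⊎ Goal
      step-partial =
        let (bs , len , inS′ , few-missed , free) = conclude ℓ 0<t 0<S powers few in
        build bs len inS′ few-missed free

    partials : ∀ j → j ≤ t → Partial j ⊎ Goal
    partials zero    _   = inj₁ start
    partials (suc j) j<t = [ Next.step-partial j<t , inj₂ ]′ (partials j (<⇒≤ j<t))

    dense-minor : CliqueModel M S t ⊎ Goal
    dense-minor = Sum.map₁ Partial.model (partials t ≤-refl)

-- Graphs whose minimum degree is about half their order

module HalfDense where

  open FiniteSums
  open Minors
  open DenseMinors
  open import Data.Bool using (Bool; true; false; _∧_; _∨_; not)
  open import Data.Empty using (⊥; ⊥-elim)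
  open import Data.Fin using (Fin)
  open import Data.Nat using (ℕ; _+_; _*_; _^_; _≤_; _<_; z≤n; s≤s; >-nonZero; _≤ᵇ_)
  open import Data.Nat.Properties hiding (_≟_)
  open import Data.Nat.Tactic.RingSolver using (solve-∀)
  open import Data.Product using (_,_; proj₁)
  open import Data.Sum as Sum using (_⊎_; inj₁; inj₂; [_,_]′)
  open import Function using (_∘_; id)
  open import Relation.Binary.PropositionalEquality using (_≡_; refl; sym; trans; cong; cong₂)

  near : ∀ {n} → Rel n → Fin n → Fin n → Bool
  near M x y = (x == y) ∨ M x y

  near⇒Near : ∀ {n} (M : Rel n) {x y} → near M x y ≡ true → Near M x y
  near⇒Near M {x} {y} e with ∨-elim {x == y} e
  ... | inj₁ h = inj₁ (==⇒≡ h)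
  ... | inj₂ h = inj₂ h

  near-sym : ∀ {n} {M : Rel n} → (∀ x y → M x y ≡ M y x) → ∀ x y → near M x y ≡ near M y x
  near-sym M-sym x y = cong₂ _∨_ (==-sym x y) (M-sym x y)

  -- An exhaustive search, so that failure comes as a usable statement about all `p` and `q`, the
  -- hypothesis `apart` of `Disconnected`.
  linked? : ∀ {n} (M : Rel n) S x y → Linked M S x y ⊎
    (∀ p q → S p ≡ true → S q ≡ true → near M x p ≡ true → near M p q ≡ true → near M q y ≡ true → ⊥)
  linked? M S x y with find (λ p → (S p ∧ near M x p) ∧ not (# (λ q → (S q ∧ near M q y) ∧ near M p q) ≤ᵇ 0))
  ... | inj₁ (p , e) with ∧-elim {S p ∧ near M x p} e
  ...   | e₁ , e₂ with ∧-elim {S p} e₁ | #>0⇒∃ (λ q → (S q ∧ near M q y) ∧ near M p q) (≰⇒> (λ h → true≢false (T⇒≡true (≤⇒≤ᵇ h)) (not-elim e₂)))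
  ...     | Sp , xp | q , e₃ with ∧-elim {S q ∧ near M q y} e₃
  ...       | e₄ , pq with ∧-elim {S q} e₄
  ...         | Sq , qy = inj₁ (p , q , Sp , Sq , near⇒Near M xp , near⇒Near M pq , near⇒Near M qy)
  linked? M S x y | inj₂ none = inj₂ (λ p q Sp Sq xp pq qy → true≢false
    (∧-intro (∧-intro Sp xp) (not-intro (¬true⇒false (λ h → <⇒≱ (≤-trans
      (≤-reflexive (sym (cong ι (∧-intro (∧-intro Sq qy) pq)))) (≤∑ (λ q → ι ((S q ∧ near M q y) ∧ near M p q)) q))
      (≤ᵇ⇒≤ _ _ (≡true⇒T h)))))) (none p))
    where
    not-intro : ∀ {b} → b ≡ false → not b ≡ true
    not-intro refl = refl

  module _ {n : ℕ} (M : Rel n) (M-sym : ∀ x y → M x y ≡ M y x) (m t ℓ : ℕ)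
    (0<t : 0 < t) (0<ℓ : 0 < ℓ) (powers : 2 ^ (2 + m) * 7 ^ ℓ ≤ 8 ^ ℓ) (few : 2 * t < 2 ^ (m * ℓ)) where

    -- If the dense graph on N falls apart after the removal of W, then the closed
    -- neighbourhood X of x is so dense that any two of its vertices have many common neighbours.
    module Disconnected (N W : Fin n → Bool) (x y : Fin n) (Nx : N x ≡ true) (Ny : N y ≡ true)
      (dense : ∀ u → N u ≡ true → # N ≤ 2 * # (λ v → N v ∧ M u v) + 1)
      (room : 192 * (ℓ * t) ≤ # N) (W-small : 16 * # W ≤ # N)
      (apart : ∀ p q → N p ∧ not (W p) ≡ true → N q ∧ not (W q) ≡ true →
               near M x p ≡ true → near M p q ≡ true → near M q y ≡ true → ⊥) where

      X Y Rest : Fin n → Bool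
      X v = (N v ∧ not (W v)) ∧ near M x v
      Y v = (N v ∧ not (W v)) ∧ near M y v
      Rest v = N v ∧ not (X v ∨ Y v)

      separated : ∀ p q → X p ≡ true → Y q ≡ true → near M p q ≡ true → ⊥
      separated p q Xp Yq pq =
        let (Np , xp) = ∧-elim {N p ∧ not (W p)} Xp
            (Nq , yq) = ∧-elim {N q ∧ not (W q)} Yq in
        apart p q Np Nq xp pq (trans (near-sym M-sym q y) yq)

      X⊆N : ∀ v → X v ≡ true → N v ≡ true
      X⊆N v Xv = proj₁ (∧-elim {N v} (proj₁ (∧-elim {N v ∧ not (W v)} Xv)))

      neighbourhood : ∀ z → # (λ v → N v ∧ M z v) ≤ # (λ v → (N v ∧ not (W v)) ∧ near M z v) + # W
      neighbourhood z = ≤-trans (∑-mono (λ v → lem (N v) (W v) (z == v) (M z v)))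
        (≤-reflexive (∑-+ (λ v → ι ((N v ∧ not (W v)) ∧ near M z v)) (ι ∘ W)))
        where
        lem : ∀ a w e m → ι (a ∧ m) ≤ ι ((a ∧ not w) ∧ (e ∨ m)) + ι w
        lem false w     e     m     = z≤n
        lem true  w     e     false = z≤n
        lem true  true  e     true  = s≤s z≤n
        lem true  false true  true  = s≤s z≤n
        lem true  false false true  = s≤s z≤n

      partition : # X + # Y + # Rest ≤ # N
      partition = ≤-trans (≤-reflexive (sym (trans (∑-+ (λ v → ι (X v) + ι (Y v)) (ι ∘ Rest)) (cong (_+ # Rest) (∑-+ (ι ∘ X) (ι ∘ Y))))))
        (∑-mono (λ v → lem (N v) (W v) (near M x v) (near M y v)
          -- `near` is reflexive, so a common vertex of `X` and `Y` could serve as both `p` and `q`.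
          (λ Xv Yv → separated v v Xv Yv (∨-introˡ (==-refl v)))))
        where
        lem : ∀ a w e f → ((a ∧ not w) ∧ e ≡ true → (a ∧ not w) ∧ f ≡ true → ⊥) →
          ι ((a ∧ not w) ∧ e) + ι ((a ∧ not w) ∧ f) + ι (a ∧ not (((a ∧ not w) ∧ e) ∨ ((a ∧ not w) ∧ f))) ≤ ι a
        lem false w     e     f     _ = z≤n
        lem true  true  e     f     _ = s≤s z≤n
        lem true  false true  true  h = ⊥-elim (h refl refl)
        lem true  false true  false _ = s≤s z≤n
        lem true  false false true  _ = s≤s z≤n
        lem true  false false false _ = s≤s z≤n

      degree-in-X : ∀ a → X a ≡ true → # (λ v → N v ∧ M a v) ≤ # (λ v → X v ∧ M a v) + # Rest
      degree-in-X a Xa = ≤-trans (∑-mono (λ v → lem (N v) (M a v) (X v) (Y v)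
          (λ Yv av → separated a v Xa Yv (∨-introʳ {a == v} av))))
        (≤-reflexive (∑-+ (λ v → ι (X v ∧ M a v)) (ι ∘ Rest)))
        where
        lem : ∀ a m x y → (y ≡ true → m ≡ true → ⊥) → ι (a ∧ m) ≤ ι (x ∧ m) + ι (a ∧ not (x ∨ y))
        lem false m     x     y     _ = z≤n
        lem true  false x     y     _ = z≤n
        lem true  true  true  y     _ = s≤s z≤n
        lem true  true  false true  h = ⊥-elim (h refl refl)
        lem true  true  false false _ = s≤s z≤n

      13≤N : 13 ≤ # N
      13≤N = ≤-trans (≤ᵇ⇒≤ 13 192 _) (≤-trans (m≤m*n 192 (ℓ * t) {{>-nonZero (*-mono-≤ 0<ℓ 0<t)}}) room)

      -- `X` and `Y` are disjoint and each fills at least about 7/16 of `N`, so `Rest` is small. A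
      -- vertex of `X` has no neighbour in `Y`, hence all its neighbours, about half of `N` in
      -- number, lie in `X` or in the small set `Rest`.
      very-dense : ∀ a → X a ≡ true → 17 * # X + 16 ≤ 32 * # (λ v → X v ∧ M a v)
      very-dense a Xa = arith (# N) (# X) (# Y) (# Rest) (# W) (# (λ v → N v ∧ M x v)) (# (λ v → N v ∧ M y v))
        (# (λ v → N v ∧ M a v)) (# (λ v → X v ∧ M a v))
        (dense x Nx) (neighbourhood x) (dense y Ny) (neighbourhood y) partition
        (dense a (X⊆N a Xa)) (degree-in-X a Xa) W-small 13≤N
        where
        arith : ∀ n a a′ r w dx dy da e → n ≤ 2 * dx + 1 → dx ≤ a + w → n ≤ 2 * dy + 1 → dy ≤ a′ + w →
          a + a′ + r ≤ n → n ≤ 2 * da + 1 → da ≤ e + r → 16 * w ≤ n → 13 ≤ n → 17 * a + 16 ≤ 32 * e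
        arith n a a′ r w dx dy da e h₁ h₂ h₃ h₄ h₅ h₆ h₇ h₈ h₉ = *-cancelˡ-≤ 2 (linear (6 + 2 * w)
          (+-mono-≤ (*-monoʳ-≤ 64 h₇) (+-mono-≤ (*-monoʳ-≤ 64 h₅) (+-mono-≤ (*-monoʳ-≤ 32 h₆)
          (+-mono-≤ (*-monoʳ-≤ 15 h₁) (+-mono-≤ (*-monoʳ-≤ 30 h₂) (+-mono-≤ (*-monoʳ-≤ 32 h₃)
          (+-mono-≤ (*-monoʳ-≤ 64 h₄) (+-mono-≤ (*-monoʳ-≤ 6 h₈) (*-monoʳ-≤ 9 h₉)))))))))
          (identity n a a′ r w dx dy da e))
          where
          identity : ∀ n a a′ r w dx dy da e →
            2 * (17 * a + 16) + (64 * (e + r) + (64 * n + (32 * (2 * da + 1) + (15 * (2 * dx + 1) + (30 * (a + w) +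
              (32 * (2 * dy + 1) + (64 * (a′ + w) + (6 * n + 9 * n)))))))) + (6 + 2 * w)
            ≡ 2 * (32 * e) + (64 * da + (64 * (a + a′ + r) + (32 * n + (15 * n + (30 * dx +
              (32 * n + (64 * dy + (6 * (16 * w) + 9 * 13))))))))
          identity = solve-∀

      large : # N ≤ 4 * # X
      large = arith (# N) (# X) (# W) (# (λ v → N v ∧ M x v)) (dense x Nx) (neighbourhood x) W-small 13≤N
        where
        arith : ∀ n a w dx → n ≤ 2 * dx + 1 → dx ≤ a + w → 16 * w ≤ n → 13 ≤ n → n ≤ 4 * a
        arith n a w dx h₁ h₂ h₃ h₄ = *-cancelˡ-≤ 4 (linear 31
          (+-mono-≤ (*-monoʳ-≤ 16 h₂) (+-mono-≤ (*-monoʳ-≤ 8 h₁) (+-mono-≤ h₃ (*-monoʳ-≤ 3 h₄))))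
          (identity n a w dx))
          where
          identity : ∀ n a w dx → 4 * n + (16 * (a + w) + (8 * (2 * dx + 1) + (n + 3 * n))) + 31
            ≡ 4 * (4 * a) + (16 * dx + (8 * n + (16 * w + 3 * 13)))
          identity = solve-∀

      -- Two neighbourhoods with at least 17/32 of `X`, plus one half each from the additive 16,
      -- overlap in at least 1/16 of `X` plus one vertex: more than `W′` can remove. Here linking
      -- never fails, so the alternative is `⊥`.
      common-neighbour : ∀ W′ → 16 * # W′ ≤ # X → ∀ u v → X u ∧ not (W′ u) ≡ true → X v ∧ not (W′ v) ≡ true →
        Linked M (λ z → X z ∧ not (W′ z)) u v ⊎ ⊥
      common-neighbour W′ W′-small u v Xu Xv =
        let (p , e) = #>0⇒∃ common positive
            (e₁ , e₂) = ∧-elim {X p ∧ not (W′ p)} e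
            (up , vp) = ∧-elim {M u p} e₂ in
        inj₁ (p , p , e₁ , e₁ , inj₂ up , inj₁ refl , inj₂ (trans (M-sym p v) vp))
        where
        common : Fin n → Bool
        common z = (X z ∧ not (W′ z)) ∧ (M u z ∧ M v z)
        count : # (λ z → X z ∧ M u z) + # (λ z → X z ∧ M v z) ≤ # X + # common + # W′
        count = ≤-trans (≤-reflexive (sym (∑-+ (λ z → ι (X z ∧ M u z)) (λ z → ι (X z ∧ M v z)))))
          (≤-trans (∑-mono (λ z → lem (X z) (W′ z) (M u z) (M v z)))
          (≤-reflexive (trans (∑-+ (λ z → ι (X z) + ι (common z)) (ι ∘ W′)) (cong (_+ # W′) (∑-+ (ι ∘ X) (ι ∘ common))))))
          where
          lem : ∀ x w a b → ι (x ∧ a) + ι (x ∧ b) ≤ ι x + ι ((x ∧ not w) ∧ (a ∧ b)) + ι w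
          lem false w     a     b     = z≤n
          lem true  w     false b     = ≤-trans (ι≤1 b) (s≤s z≤n)
          lem true  w     true  false = s≤s z≤n
          lem true  true  true  true  = ≤-refl
          lem true  false true  true  = ≤-refl
        positive : 0 < # common
        positive = arith (# X) (# (λ z → X z ∧ M u z)) (# (λ z → X z ∧ M v z)) (# common) (# W′)
          (very-dense u (proj₁ (∧-elim {X u} Xu))) (very-dense v (proj₁ (∧-elim {X v} Xv))) count W′-small
          where
          arith : ∀ a e f c w → 17 * a + 16 ≤ 32 * e → 17 * a + 16 ≤ 32 * f → e + f ≤ a + c + w → 16 * w ≤ a → 1 ≤ c
          arith a e f c w h₁ h₂ h₃ h₄ = *-cancelˡ-≤ 32 (linear 0
            (+-mono-≤ h₁ (+-mono-≤ h₂ (+-mono-≤ (*-monoʳ-≤ 32 h₃) (*-monoʳ-≤ 2 h₄)))) (identity a e f c w))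
            where
            identity : ∀ a e f c w → 32 * 1 + (32 * e + (32 * f + (32 * (a + c + w) + 2 * a))) + 0
              ≡ 32 * c + (17 * a + 16 + (17 * a + 16 + (32 * (e + f) + 2 * (16 * w))))
            identity = solve-∀

      minor : CliqueModel M N t
      minor = cliqueModel-weaken X⊆N ([ id , ⊥-elim ]′
        (DenseMinor.dense-minor M M-sym X m t ℓ ⊥ 0<t 0<ℓ powers few room-X dense-X common-neighbour))
        where
        room-X : 48 * (ℓ * t) ≤ # X
        room-X = *-cancelˡ-≤ 4 (≤-trans (≤-reflexive (identity (ℓ * t))) (≤-trans room large))
          where
          identity : ∀ z → 4 * (48 * z) ≡ 192 * z
          identity = solve-∀
        dense-X : ∀ u → X u ≡ true → 3 * # X ≤ 16 * # (λ v → X v ∧ M u v)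
        dense-X u Xu = arith (# X) (# (λ v → X v ∧ M u v)) (very-dense u Xu)
          where
          arith : ∀ a e → 17 * a + 16 ≤ 32 * e → 3 * a ≤ 16 * e
          arith a e h = *-cancelˡ-≤ 2 (linear (11 * a + 16) h (identity a e))
            where
            identity : ∀ a e → 2 * (3 * a) + 32 * e + (11 * a + 16) ≡ 2 * (16 * e) + (17 * a + 16)
            identity = solve-∀

    -- `Goal` is instantiated with the minor itself: either the construction on `N` never misses a
    -- link, or the first missing link exhibits the denser set `X`, on which it succeeds.
    half-dense-minor : ∀ N → (∀ u → N u ≡ true → # N ≤ 2 * # (λ v → N v ∧ M u v) + 1) →
      192 * (ℓ * t) ≤ # N → CliqueModel M N t
    half-dense-minor N dense room = [ id , id ]′
      (DenseMinor.dense-minor M M-sym N m t ℓ (CliqueModel M N t) 0<t 0<ℓ powers few room-N dense-N link)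
      where
      room-N : 48 * (ℓ * t) ≤ # N
      room-N = ≤-trans (*-monoˡ-≤ (ℓ * t) (≤ᵇ⇒≤ 48 192 _)) room
      dense-N : ∀ u → N u ≡ true → 3 * # N ≤ 16 * # (λ v → N v ∧ M u v)
      dense-N u Nu = arith (# N) (# (λ v → N v ∧ M u v)) (dense u Nu)
          (≤-trans (≤ᵇ⇒≤ 2 192 _) (≤-trans (m≤m*n 192 (ℓ * t) {{>-nonZero (*-mono-≤ 0<ℓ 0<t)}}) room))
        where
        arith : ∀ a e → a ≤ 2 * e + 1 → 2 ≤ a → 3 * a ≤ 16 * e
        arith a e h h′ = linear 2 (+-mono-≤ (*-monoʳ-≤ 8 h) (*-monoʳ-≤ 5 h′)) (identity a e)
          where
          identity : ∀ a e → 3 * a + (8 * (2 * e + 1) + 5 * a) + 2 ≡ 16 * e + (8 * a + 5 * 2)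
          identity = solve-∀
      link : ∀ W → 16 * # W ≤ # N → ∀ x y → N x ∧ not (W x) ≡ true → N y ∧ not (W y) ≡ true →
        Linked M (λ v → N v ∧ not (W v)) x y ⊎ CliqueModel M N t
      link W W-small x y Nx Ny = Sum.map₂
        (λ apart → Disconnected.minor N W x y (proj₁ (∧-elim {N x} Nx)) (proj₁ (∧-elim {N y} Ny)) dense room W-small apart)
        (linked? M (λ v → N v ∧ not (W v)) x y)

-- Contraction and clique minors from average degree

module EdgeDensity where

  open FiniteSums
  open Minors
  open GreedyDomination using (powers-of-7-and-8)
  open HalfDense
  open import Defs using (Walk; here; step)
  open import Data.Bool using (Bool; true; false; _∧_; _∨_; not; T; if_then_else_)
  open import Data.Bool.Properties using (∧-zeroʳ; ∧-identityʳ)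
  open import Data.Empty using (⊥-elim)
  open import Data.Fin using (Fin)
  open import Data.Fin.Properties using (_≟_)
  open import Data.Maybe using (Maybe; just; nothing)
  open import Data.Nat using (ℕ; zero; suc; _+_; _*_; _∸_; _^_; _≤_; _<_; z≤n; s≤s; >-nonZero; _≤ᵇ_)
  open import Data.Nat.Properties hiding (_≟_)
  open import Data.Nat.Tactic.RingSolver using (solve-∀)
  open import Data.Product using (∃-syntax; _×_; _,_; proj₁; proj₂)
  open import Data.Sum using (_⊎_; inj₁; inj₂; [_,_]′)
  open import Relation.Nullary using (yes; no)
  open import Relation.Binary.PropositionalEquality using (_≡_; _≢_; refl; sym; trans; cong; cong₂; subst; module ≡-Reasoning)

  arcs : ∀ {n} → Rel n → ℕ
  arcs M = ∑ (λ x → # (M x))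

  remove : ∀ {n} → Fin n → (Fin n → Bool) → Fin n → Bool
  remove u S x = S x ∧ not (x == u)

  #-remove : ∀ {n} (S : Fin n → Bool) u → S u ≡ true → # S ≡ suc (# (remove u S))
  #-remove S u Su = #-insert u removed Su (λ x x≢u → sym (kept x x≢u))
    where
    removed : remove u S u ≡ false
    removed rewrite ==-refl u = ¬true⇒false (λ e → true≢false (proj₂ (∧-elim {S u} e)) refl)
    kept : ∀ x → x ≢ u → remove u S x ≡ S x
    kept x x≢u rewrite ≢⇒== x≢u = ∧-identityʳ (S x)

  record Simple {n} (M : Rel n) (S : Fin n → Bool) : Set where
    field
      symmetric   : ∀ x y → M x y ≡ M y x
      irreflexive : ∀ x → M x x ≡ false
      supported   : ∀ x y → M x y ≡ true → S x ≡ true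

  -- `u` is merged into `v` and left behind as an isolated vertex outside the support, so the vertex
  -- type does not change under contraction.
  contract : ∀ {n} → Rel n → Fin n → Fin n → Rel n
  contract M u v x y = (not (x == u) ∧ not (y == u)) ∧ (not (x == y) ∧ (M x y ∨ (((x == v) ∧ M u y) ∨ ((y == v) ∧ M u x))))

  module Contraction {n : ℕ} (M : Rel n) (S : Fin n → Bool) (simple : Simple M S)
    (u v : Fin n) (uv : M v u ≡ true) where
    open Simple simple

    u≢v : u ≢ v
    u≢v refl = true≢false uv (irreflexive u)

    Su : S u ≡ true
    Su = supported u v (trans (symmetric u v) uv)

    Sv : S v ≡ true
    Sv = supported v u uv

    data Edge (x y : Fin n) : Set where
      kept  : M x y ≡ true → Edge x y
      left  : x ≡ v → M u y ≡ true → Edge x y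
      right : y ≡ v → M u x ≡ true → Edge x y

    edge-view : ∀ x y → contract M u v x y ≡ true → x ≢ u × y ≢ u × x ≢ y × Edge x y
    edge-view x y e with ∧-elim {not (x == u) ∧ not (y == u)} e
    ... | e₁ , e₂ with ∧-elim {not (x == u)} e₁ | ∧-elim {not (x == y)} e₂
    ... | x≢u , y≢u | x≢y , e₃ = differ x≢u , differ y≢u , differ x≢y , which
      where
      differ : ∀ {a b} → not (a == b) ≡ true → a ≢ b
      differ {a} h refl = true≢false (==-refl a) (not-elim h)
      which : Edge x y
      which with ∨-elim {M x y} e₃
      ... | inj₁ h = kept h
      ... | inj₂ h with ∨-elim {(x == v) ∧ M u y} h
      ...   | inj₁ h′ = left (==⇒≡ (proj₁ (∧-elim {x == v} h′))) (proj₂ (∧-elim {x == v} h′))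
      ...   | inj₂ h′ = right (==⇒≡ (proj₁ (∧-elim {y == v} h′))) (proj₂ (∧-elim {y == v} h′))

    simple′ : Simple (contract M u v) (remove u S)
    simple′ = record { symmetric = symm ; irreflexive = irr ; supported = supp }
      where
      swap : ∀ a b e m p q → (a ∧ b) ∧ (e ∧ (m ∨ (p ∨ q))) ≡ (b ∧ a) ∧ (e ∧ (m ∨ (q ∨ p)))
      swap false false e m p q = refl
      swap false true  e m p q = refl
      swap true  false e m p q = refl
      swap true true false m p q = refl
      swap true true true true p q = refl
      swap true true true false true true = refl
      swap true true true false true false = refl
      swap true true true false false true = refl
      swap true true true false false false = refl
      symm : ∀ x y → contract M u v x y ≡ contract M u v y x
      symm x y rewrite ==-sym x y | symmetric x y =
        swap (not (x == u)) (not (y == u)) (not (y == x)) (M y x) ((x == v) ∧ M u y) ((y == v) ∧ M u x)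
      irr : ∀ x → contract M u v x x ≡ false
      irr x = ¬true⇒false (λ e → proj₁ (proj₂ (proj₂ (edge-view x x e))) refl)
      supp : ∀ x y → contract M u v x y ≡ true → remove u S x ≡ true
      supp x y e with edge-view x y e
      ... | x≢u , _ , _ , kept h       = ∧-intro (supported x y h) (cong not (≢⇒== x≢u))
      ... | x≢u , _ , _ , left refl h  = ∧-intro Sv (cong not (≢⇒== x≢u))
      ... | x≢u , _ , _ , right refl h = ∧-intro (supported x u (trans (symmetric x u) h)) (cong not (≢⇒== x≢u))

    part : Fin n → Maybe (Fin n)
    part w = if S w then (if w == u then just v else just w) else nothing

    part-u : part u ≡ just v
    part-u rewrite Su | ==-refl u = refl

    part-other : ∀ {w} → S w ≡ true → w ≢ u → part w ≡ just w
    part-other Sw w≢u rewrite Sw | ≢⇒== w≢u = refl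

    part-view : ∀ w {x} → part w ≡ just x → S w ≡ true × (w ≡ x ⊎ (w ≡ u × x ≡ v))
    part-view w e with S w
    part-view w () | false
    ... | true with w ≟ u
    ...   | yes w≡u = refl , inj₂ (w≡u , sym (just-injective e))
    ...   | no _    = refl , inj₁ (just-injective e)

    minor : MinorModel M S (contract M u v) (remove u S)
    minor = record { part = part ; inside = λ {w} e → proj₁ (part-view w e) ; nonempty = ne ; connected = conn ; edge = edg }
      where
      ne : ∀ x → remove u S x ≡ true → ∃[ w ] part w ≡ just x
      ne x e with ∧-elim {S x} e
      ... | Sx , x≢u = x , part-other Sx (λ { refl → true≢false (==-refl u) (not-elim x≢u) })
      conn : ∀ x a b → remove u S x ≡ true → part a ≡ just x → part b ≡ just x →
        Walk M (λ w → part w ≡ just x) a b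
      conn x a b _ pa pb with part-view a pa | part-view b pb
      ... | _ , inj₁ refl | _ , inj₁ refl = here
      ... | _ , inj₁ refl | _ , inj₂ (refl , refl) = step (≡true⇒T uv) pb here
      ... | _ , inj₂ (refl , refl) | _ , inj₁ refl = step (≡true⇒T (trans (symmetric u v) uv)) pb here
      ... | _ , inj₂ (refl , refl) | _ , inj₂ (refl , _) = here
      edg : ∀ x y → contract M u v x y ≡ true → ∃[ a ] ∃[ b ] (part a ≡ just x × part b ≡ just y × T (M a b))
      edg x y e with edge-view x y e
      ... | x≢u , y≢u , _ , kept h =
        x , y , part-other (supported x y h) x≢u , part-other (supported y x (trans (symmetric y x) h)) y≢u , ≡true⇒T h
      ... | x≢u , y≢u , _ , left refl h =
        u , y , part-u , part-other (supported y u (trans (symmetric y u) h)) y≢u , ≡true⇒T h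
      ... | x≢u , y≢u , _ , right refl h =
        x , u , part-other (supported x u (trans (symmetric x u) h)) x≢u , part-u , ≡true⇒T (trans (symmetric x u) h)

    common : ℕ
    common = # (λ w → M v w ∧ M u w)

    private
      gained : Fin n → ℕ
      gained y = ι (M u y ∧ (not (M v y) ∧ not (y == v)))

      pointwise : ∀ x y → ι (M x y) + (ι (x == v) * gained y + ι (y == v) * gained x)
        ≤ ι (contract M u v x y) + (ι (x == u) * ι (M u y) + ι (y == u) * ι (M u x))
      pointwise x y with x ≟ u
      ... | yes refl with u ≟ v
      ...   | yes u≡v = ⊥-elim (u≢v u≡v)
      ...   | no _ rewrite irreflexive u | *-zeroʳ (ι (y == v)) | *-zeroʳ (ι (y == u)) | +-identityʳ (ι (M u y)) | +-identityʳ (ι (M u y)) = ≤-refl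
      pointwise x y | no x≢u with y ≟ u
      ... | yes refl with u ≟ v
      ...   | yes u≡v = ⊥-elim (u≢v u≡v)
      ...   | no _ rewrite irreflexive u | *-zeroʳ (ι (x == v)) | symmetric x u | +-identityʳ (ι (M u x)) = ≤-refl
      pointwise x y | no x≢u | no y≢u with x ≟ y
      ... | yes refl rewrite irreflexive x with x ≟ v
      ...   | yes refl rewrite irreflexive v | ∧-zeroʳ (M u v) = z≤n
      ...   | no _ = z≤n
      pointwise x y | no x≢u | no y≢u | no x≢y with x ≟ v | y ≟ v
      ... | yes refl | yes refl = ⊥-elim (x≢y refl)
      ... | yes refl | no _ = lem (M v y) (M u y)
        where
        lem : ∀ a b → ι a + (ι (b ∧ (not a ∧ true)) + 0 + 0) ≤ ι (a ∨ (b ∨ false)) + 0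
        lem true  true  = ≤-refl
        lem true  false = ≤-refl
        lem false true  = ≤-refl
        lem false false = z≤n
      ... | no _ | yes refl rewrite symmetric x v = lem (M v x) (M u x)
        where
        lem : ∀ a b → ι a + (ι (b ∧ (not a ∧ true)) + 0) ≤ ι (a ∨ b) + 0
        lem true  true  = ≤-refl
        lem true  false = ≤-refl
        lem false true  = ≤-refl
        lem false false = z≤n
      ... | no _ | no _ = lem (M x y)
        where
        lem : ∀ a → ι a + 0 ≤ ι (a ∨ false) + 0
        lem true  = ≤-refl
        lem false = z≤n

      ∑∑-+δδ : ∀ (f : Fin n → Fin n → ℕ) z (g : Fin n → ℕ) →
        ∑ (λ x → ∑ (λ y → f x y + (ι (x == z) * g y + ι (y == z) * g x))) ≡ ∑ (λ x → ∑ (f x)) + (∑ g + ∑ g)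
      ∑∑-+δδ f z g = begin
        ∑ (λ x → ∑ (λ y → f x y + (ι (x == z) * g y + ι (y == z) * g x)))
          ≡⟨ ∑-cong (λ x → trans (∑-+ (f x) (λ y → ι (x == z) * g y + ι (y == z) * g x))
               (cong (∑ (f x) +_) (trans (∑-+ (λ y → ι (x == z) * g y) (λ y → ι (y == z) * g x))
                 (cong₂ _+_ (∑-* (ι (x == z)) g) (∑-δ z (λ _ → g x)))))) ⟩
        ∑ (λ x → ∑ (f x) + (ι (x == z) * ∑ g + g x))
          ≡⟨ trans (∑-+ (λ x → ∑ (f x)) (λ x → ι (x == z) * ∑ g + g x))
               (cong (∑ (λ x → ∑ (f x)) +_) (trans (∑-+ (λ x → ι (x == z) * ∑ g) g) (cong (_+ ∑ g) (∑-δ z (λ _ → ∑ g))))) ⟩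
        ∑ (λ x → ∑ (f x)) + (∑ g + ∑ g) ∎
        where open ≡-Reasoning

    -- The loss consists of the edge `uv` and of one edge for each common neighbour, counted in both
    -- directions. The count is made entry by entry: arcs at `u` disappear, and `v` gains those that
    -- lead neither to itself nor to one of its neighbours.
    arcs-contract : arcs M ≤ arcs (contract M u v) + (2 * common + 2)
    arcs-contract = arith (arcs M) (arcs (contract M u v)) (∑ gained) (# (M u)) common total degree-u
      where
      total : arcs M + (∑ gained + ∑ gained) ≤ arcs (contract M u v) + (# (M u) + # (M u))
      total = ≤-trans (≤-reflexive (sym (∑∑-+δδ (λ x y → ι (M x y)) v gained)))
        (≤-trans (∑-mono (λ x → ∑-mono (pointwise x)))
          (≤-reflexive (∑∑-+δδ (λ x y → ι (contract M u v x y)) u (λ y → ι (M u y)))))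
      degree-u : # (M u) ≤ ∑ gained + (common + 1)
      degree-u = ≤-trans (∑-mono (λ y → lem (M u y) (M v y) (y == v)))
        (≤-reflexive (trans (∑-+ gained (λ y → ι (M v y ∧ M u y) + ι (y == v)))
          (cong (∑ gained +_) (trans (∑-+ (λ y → ι (M v y ∧ M u y)) (λ y → ι (y == v))) (cong (common +_) (#-single v))))))
        where
        lem : ∀ a b e → ι a ≤ ι (a ∧ (not b ∧ not e)) + (ι (b ∧ a) + ι e)
        lem false b     e     = z≤n
        lem true  true  e     = s≤s z≤n
        lem true  false true  = s≤s z≤n
        lem true  false false = s≤s z≤n
      arith : ∀ e e′ g d c → e + (g + g) ≤ e′ + (d + d) → d ≤ g + (c + 1) → e ≤ e′ + (2 * c + 2)
      arith e e′ g d c h₁ h₂ = linear 0 (+-mono-≤ h₁ (*-monoʳ-≤ 2 h₂)) (identity e e′ g d c)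
        where
        identity : ∀ e e′ g d c → e + (e′ + (d + d) + 2 * (g + (c + 1))) + 0 ≡ e′ + (2 * c + 2) + (e + (g + g) + 2 * d)
        identity = solve-∀

  isolated-minor : ∀ {n} {M : Rel n} {S} → Simple M S → ∀ v → (∀ w → M v w ≡ false) →
    Simple M (remove v S)
  isolated-minor {M = M} {S} simple v isolated = record { symmetric = symmetric ; irreflexive = irreflexive ; supported = supp }
    where
    open Simple simple
    supp : ∀ x y → M x y ≡ true → remove v S x ≡ true
    supp x y e = ∧-intro (supported x y e) (cong not (≢⇒== {i = x} {v} (λ { refl → true≢false e (isolated y) })))

  -- Kostochka and Thomason's theorem. As long as a vertex v of at most average degree is
  -- isolated or has a neighbour with few common neighbours, delete or contract without
  -- lowering the edge density; otherwise the neighbourhood of v is dense.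
  module Density (m t d : ℕ) (0<t : 0 < t) (few : 2 * t < 2 ^ (m * (6 * (2 + m))))
    (room : 192 * (6 * (2 + m) * t) ≤ d) where

    private
      ℓ : ℕ
      ℓ = 6 * (2 + m)

      0<ℓ : 0 < ℓ
      0<ℓ = s≤s z≤n

      0<d : 0 < d
      0<d = ≤-trans (*-mono-≤ {1} {192} (s≤s z≤n) (*-mono-≤ 0<ℓ 0<t)) room

    module _ {n : ℕ} (M : Rel n) (S : Fin n → Bool) (simple : Simple M S) (s : ℕ)
      (size : # S ≡ suc s) (many : 2 * d * # S ≤ arcs M)
      (recurse : ∀ (M′ : Rel n) (S′ : Fin n → Bool) → Simple M′ S′ → # S′ ≡ s → 2 * d * # S′ ≤ arcs M′ → CliqueModel M′ S′ t) where
      open Simple simple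

      low-degree : ∃[ v ] (S v ≡ true × # (M v) * # S ≤ arcs M)
      low-degree = ∃-≤average S (λ v → # (M v) * # S) (arcs M) (subst (0 <_) (sym size) (s≤s z≤n)) (begin
        ∑ (λ v → ι (S v) * (# (M v) * # S))   ≤⟨ ∑-mono (λ v → ≤-trans (*-monoˡ-≤ (# (M v) * # S) (ι≤1 (S v))) (≤-reflexive (+-identityʳ _))) ⟩
        ∑ (λ v → # (M v) * # S)               ≡⟨ ∑-*ʳ (λ v → # (M v)) (# S) ⟩
        arcs M * # S                          ∎)
        where open ≤-Reasoning

      -- The slack in the density hypothesis. Since one vertex fewer lowers the requirement by
      -- `2 * d`, a contraction may destroy up to `excess + 2 * d` arcs.
      excess : ℕ
      excess = arcs M ∸ 2 * d * # S

      arcs≡ : arcs M ≡ 2 * d * # S + excess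
      arcs≡ = sym (m+[n∸m]≡n many)

      delete : ∀ v → S v ≡ true → (∀ w → M v w ≡ false) → CliqueModel M S t
      delete v Sv isolated = cliqueModel-weaken (λ x e → proj₁ (∧-elim {S x} e))
        (recurse M (remove v S) (isolated-minor simple v isolated)
          (suc-injective (trans (sym (#-remove S v Sv)) size))
          (≤-trans (*-monoʳ-≤ (2 * d) (≤-trans (n≤1+n _) (≤-reflexive (sym (#-remove S v Sv))))) many))

      contract-edge : ∀ v u → M v u ≡ true → 2 * # (λ w → M v w ∧ M u w) + 2 ≤ excess + 2 * d → CliqueModel M S t
      contract-edge v u vu cheap = minor-trans C.minor
        (recurse (contract M u v) (remove u S) C.simple′ (suc-injective (trans (sym size′) size))
          (arith d (# S) (# (remove u S)) excess (arcs M) (arcs (contract M u v)) _ arcs≡ size′ C.arcs-contract cheap))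
        where
        module C = Contraction M S simple u v vu
        size′ : # S ≡ suc (# (remove u S))
        size′ = #-remove S u C.Su
        arith : ∀ d s s′ x e e′ c → e ≡ 2 * d * s + x → s ≡ suc s′ → e ≤ e′ + c → c ≤ x + 2 * d → 2 * d * s′ ≤ e′
        arith d _ s′ x _ e′ c refl refl h₁ h₂ = linear 0 (+-mono-≤ h₁ h₂) (identity d s′ x e′ c)
          where
          identity : ∀ d s′ x e′ c → 2 * d * s′ + (e′ + c + (x + 2 * d)) + 0 ≡ e′ + (2 * d * suc s′ + x + c)
          identity = solve-∀

      -- No contraction at `v` is affordable, so each neighbour of `v` shares with it about
      -- `d + excess / 2` neighbours or more, whereas `v` has degree at most `2 * d + excess`. The
      -- neighbourhood of `v` thus has minimum degree half its order, up to the additive 1.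
      dense-neighbourhood : ∀ v → # (M v) * # S ≤ arcs M → ∀ w → M v w ≡ true →
        (∀ u → M v u ≡ true → excess + 2 * d < 2 * # (λ w → M v w ∧ M u w) + 2) → CliqueModel M S t
      dense-neighbourhood v low w₀ vw₀ dense = cliqueModel-weaken (λ x vx → supported x v (trans (symmetric x v) vx))
        (half-dense-minor M symmetric m t ℓ 0<t 0<ℓ (powers-of-7-and-8 (2 + m)) few (M v) dense′ (≤-trans room large))
        where
        degree≤ : # (M v) ≤ 2 * d + excess
        degree≤ = *-cancelʳ-≤ (# (M v)) (2 * d + excess) (suc s) (subst (λ z → # (M v) * z ≤ (2 * d + excess) * z) size (begin
          # (M v) * # S               ≤⟨ low ⟩
          arcs M                      ≡⟨ arcs≡ ⟩
          2 * d * # S + excess        ≤⟨ +-monoʳ-≤ (2 * d * # S) (m≤m*n excess (# S) {{>-nonZero (subst (0 <_) (sym size) (s≤s z≤n))}}) ⟩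
          2 * d * # S + excess * # S  ≡⟨ *-distribʳ-+ (# S) (2 * d) excess ⟨
          (2 * d + excess) * # S      ∎))
          where open ≤-Reasoning
        dense′ : ∀ u → M v u ≡ true → # (M v) ≤ 2 * # (λ w → M v w ∧ M u w) + 1
        dense′ u vu = arith (# (M v)) d excess (# (λ w → M v w ∧ M u w)) degree≤ (dense u vu)
          where
          arith : ∀ n d x c → n ≤ 2 * d + x → suc (x + 2 * d) ≤ 2 * c + 2 → n ≤ 2 * c + 1
          arith n d x c h₁ h₂ = linear 0 (+-mono-≤ h₁ h₂) (identity n d x c)
            where
            identity : ∀ n d x c → n + (2 * d + x + (2 * c + 2)) + 0 ≡ 2 * c + 1 + (n + suc (x + 2 * d))
            identity = solve-∀
        large : d ≤ # (M v)
        large = m<1+n⇒m≤n (*-cancelˡ-< 2 d (suc (# (M v))) (begin-strict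
          2 * d                                     ≤⟨ m≤n+m (2 * d) excess ⟩
          excess + 2 * d                            <⟨ dense w₀ vw₀ ⟩
          2 * # (λ w → M v w ∧ M w₀ w) + 2          ≤⟨ +-monoˡ-≤ 2 (*-monoʳ-≤ 2 (#-mono {P = λ w → M v w ∧ M w₀ w} {M v} (λ w e → proj₁ (∧-elim e)))) ⟩
          2 * # (M v) + 2                           ≡⟨ +-comm (2 * # (M v)) 2 ⟩
          2 + 2 * # (M v)                           ≡⟨ *-suc 2 (# (M v)) ⟨
          2 * suc (# (M v))                         ∎))
          where open ≤-Reasoning

      reduce : CliqueModel M S t
      reduce = let (v , Sv , low) = low-degree in
        [ (λ { (w , vw) → [ (λ { (u , e) → contract-edge v u (proj₁ (∧-elim {M v u} e)) (≤ᵇ⇒≤ _ _ (≡true⇒T (proj₂ (∧-elim {M v u} e)))) })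
                          , (λ none → dense-neighbourhood v low w vw (λ u vu → ≰⇒> (λ h → true≢false (∧-intro vu (T⇒≡true (≤⇒≤ᵇ h))) (none u))))
                          ]′ (find (λ u → M v u ∧ (2 * # (λ w → M v w ∧ M u w) + 2 ≤ᵇ excess + 2 * d))) })
        , delete v Sv ]′ (find (M v))

    density-minor : ∀ {n} s (M : Rel n) S → Simple M S → # S ≡ suc s → 2 * d * # S ≤ arcs M → CliqueModel M S t
    density-minor {n} zero M S simple size many = ⊥-elim (<⇒≱ positive (≤-reflexive arcs≡0))
      where
      open Simple simple
      positive : 0 < arcs M
      positive = ≤-trans (*-mono-≤ {1} {2 * d} (*-mono-≤ {1} {2} (s≤s z≤n) 0<d) (subst (1 ≤_) (sym size) ≤-refl)) many
      only : ∀ x y → S x ≡ true → S y ≡ true → x ≡ y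
      only x y Sx Sy with x ≟ y
      ... | yes e = e
      ... | no x≢y = ⊥-elim (true≢false (∧-intro Sy (cong not (≢⇒== (λ e → x≢y (sym e)))))
        (#≡0⇒false {P = remove x S} (suc-injective (trans (sym (#-remove S x Sx)) size)) y))
      no-edge : ∀ x y → M x y ≡ false
      no-edge x y = ¬true⇒false (λ e → true≢false e (subst (λ z → M x z ≡ false)
        (only x y (supported x y e) (supported y x (trans (symmetric y x) e))) (irreflexive x)))
      arcs≡0 : arcs M ≡ 0
      arcs≡0 = trans (∑-cong (λ x → all-false⇒#≡0 (no-edge x))) (∑-0 n)
    density-minor (suc s) M S simple size many =
      reduce M S simple (suc s) size many (density-minor s)

-- Cutting a rooted forest into connected parts of controlled size

module Forests where

  open FiniteSums
  open Minors
  open import Defs using (Walk; here; step)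
  open import Data.Bool using (Bool; true; false; _∧_; _∨_; T; if_then_else_)
  open import Data.Fin using (Fin)
  open import Data.Fin.Properties using (_≟_)
  open import Data.List using (List; []; _∷_)
  open import Data.Nat using (ℕ; _+_; _*_; _≤_; _<_; z≤n)
  open import Data.Nat.Properties hiding (_≟_)
  open import Data.Nat.Tactic.RingSolver using (solve-∀)
  open import Data.Product using (_×_; _,_; proj₂)
  open import Data.Sum using (_⊎_; inj₁; inj₂)
  open import Data.Unit using (⊤)
  open import Function using (id)
  open import Relation.Nullary using (yes; no)
  open import Relation.Binary.PropositionalEquality using (_≡_; _≢_; refl; sym; trans; cong; subst; module ≡-Reasoning)

  -- A rooted forest is a list of arcs (child , parent), the most recent one first.
  Arcs : ℕ → Set
  Arcs n = List (Fin n × Fin n)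

  spanned : ∀ {n} → (Fin n → Bool) → Arcs n → Fin n → Bool
  spanned roots []            v = roots v
  spanned roots ((c , _) ∷ L) v = (v == c) ∨ spanned roots L v

  children : ∀ {n} → Arcs n → Fin n → ℕ
  children []            v = 0
  children ((_ , p) ∷ L) v = ι (p == v) + children L v

  Forest : ∀ {n} → Rel n → (Fin n → Bool) → Arcs n → Set
  Forest a roots []            = ⊤
  Forest a roots ((c , p) ∷ L) =
    spanned roots L c ≡ false × spanned roots L p ≡ true × T (a p c) × Forest a roots L

  forest-map : ∀ {n} {a b : Rel n} {roots} → (∀ {x y} → T (a x y) → T (b x y)) →
    ∀ L → Forest a roots L → Forest b roots L
  forest-map h []      _                   = _
  forest-map h (_ ∷ L) (c∉ , p∈ , pc , vl) = c∉ , p∈ , h pc , forest-map h L vl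

  module Decomposition {n : ℕ} (a : Rel n) (roots : Fin n → Bool) (R : Fin n → Bool) (s C : ℕ) where

    size : (Fin n → Fin n) → Fin n → ℕ
    size rep x = # (λ v → R v ∧ (rep v == x))

    -- The vertices spanned by L are still representing their own, growing parts.
    record Stage (L : Arcs n) : Set where
      field
        rep        : Fin n → Fin n
        fixed      : ∀ v → spanned roots L v ≡ true → rep v ≡ v
        rep-in     : ∀ v → R v ≡ true → R (rep v) ≡ true
        idempotent : ∀ v → R v ≡ true → rep (rep v) ≡ rep v
        reach      : ∀ v → R v ≡ true → Walk a (λ w → R w ≡ true × rep w ≡ rep v) (rep v) v
        -- Room for `s` vertices is reserved for every child arc of `p` that is still in `L`; a
        -- merged child brings fewer than `s`, so the bound persists.
        growing    : ∀ p → spanned roots L p ≡ true → size rep p + s * children L p ≤ 1 + s * C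
        finished   : ∀ x → spanned roots L x ≡ false → size rep x ≤ 1 + s * C × (s ≤ size rep x ⊎ size rep x ≡ 0)

    initial : ∀ L → (∀ v → R v ≡ spanned roots L v) → (∀ v → children L v ≤ C) → Stage L
    initial L spans bounded = record
      { rep = id ; fixed = λ _ _ → refl ; rep-in = λ _ e → e ; idempotent = λ _ _ → refl ; reach = λ _ _ → here
      ; growing = λ p _ → +-mono-≤ (≤-trans (#-mono {P = λ v → R v ∧ (v == p)} {_== p} (λ v e → proj₂ (∧-elim {R v} e))) (≤-reflexive (#-single p)))
                                   (*-monoʳ-≤ s (bounded p))
      ; finished = λ x e → let empty = all-false⇒#≡0 (nobody x e) in ≤-trans (≤-reflexive empty) z≤n , inj₂ empty }
      where
      nobody : ∀ x → spanned roots L x ≡ false → ∀ v → R v ∧ (v == x) ≡ false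
      nobody x e v = ¬true⇒false (λ h → let (Rv , v≡x) = ∧-elim {R v} h in
        true≢false (trans (sym (spans v)) Rv) (subst (λ z → spanned roots L z ≡ false) (sym (==⇒≡ v≡x)) e))

    module Step (c p : Fin n) (L : Arcs n) (c∉L : spanned roots L c ≡ false) (p∈L : spanned roots L p ≡ true)
      (pc : T (a p c)) (c∈R : R c ≡ true) (p∈R : R p ≡ true) (σ : Stage ((c , p) ∷ L)) where
      open Stage σ

      c≢p : c ≢ p
      c≢p refl = true≢false p∈L c∉L

      rep-c : rep c ≡ c
      rep-c = fixed c (∨-introˡ (==-refl c))

      before : ∀ {x} → x ≢ c → spanned roots L x ≡ false → spanned roots ((c , p) ∷ L) x ≡ false
      before x≢c e rewrite ≢⇒== x≢c = e

      size-c : size rep c ≤ 1 + s * C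
      size-c = ≤-trans (m≤m+n (size rep c) _) (growing c (∨-introˡ (==-refl c)))

      cut : s ≤ size rep c → Stage L
      cut large = record
        { rep = rep ; fixed = λ v e → fixed v (∨-introʳ {v == c} e) ; rep-in = rep-in ; idempotent = idempotent ; reach = reach
        ; growing = λ q e → ≤-trans (+-monoʳ-≤ (size rep q) (*-monoʳ-≤ s (m≤n+m (children L q) (ι (p == q)))))
                                    (growing q (∨-introʳ {q == c} e))
        ; finished = done }
        where
        done : ∀ x → spanned roots L x ≡ false → size rep x ≤ 1 + s * C × (s ≤ size rep x ⊎ size rep x ≡ 0)
        done x e with x ≟ c
        ... | yes refl = size-c , inj₁ large
        ... | no x≢c   = finished x (before x≢c e)

      rep′ : Fin n → Fin n
      rep′ v = if rep v == c then p else rep v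

      rep′-c : ∀ {v} → rep v ≡ c → rep′ v ≡ p
      rep′-c e rewrite e | ==-refl c = refl

      rep′-other : ∀ {v} → rep v ≢ c → rep′ v ≡ rep v
      rep′-other h rewrite ≢⇒== h = refl

      size′-c : size rep′ c ≡ 0
      size′-c = all-false⇒#≡0 (λ v → ¬true⇒false (λ e → absurd v (==⇒≡ (proj₂ (∧-elim {R v} e)))))
        where
        absurd : ∀ v → rep′ v ≢ c
        absurd v e with rep v ≟ c
        ... | yes h = c≢p (sym e)
        ... | no h  = h e

      size′-p : size rep′ p ≤ size rep p + size rep c
      size′-p = ≤-trans (∑-mono pointwise) (≤-reflexive (∑-+ (λ v → ι (R v ∧ (rep v == p))) (λ v → ι (R v ∧ (rep v == c)))))
        where
        pointwise : ∀ v → ι (R v ∧ (rep′ v == p)) ≤ ι (R v ∧ (rep v == p)) + ι (R v ∧ (rep v == c))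
        pointwise v with rep v ≟ c
        ... | no h  = m≤m+n _ _
        ... | yes h rewrite ==-refl p = m≤n+m _ _

      size′-other : ∀ x → x ≢ c → x ≢ p → size rep′ x ≡ size rep x
      size′-other x x≢c x≢p = #-cong pointwise
        where
        pointwise : ∀ v → R v ∧ (rep′ v == x) ≡ R v ∧ (rep v == x)
        pointwise v with rep v ≟ c
        ... | no h  = refl
        ... | yes h rewrite h | ≢⇒== (λ e → x≢p (sym e)) | ≢⇒== (λ e → x≢c (sym e)) = refl

      merge : size rep c < s → Stage L
      merge small = record
        { rep = rep′ ; fixed = fixed′ ; rep-in = rep-in′ ; idempotent = idem′ ; reach = reach′
        ; growing = growing′ ; finished = finished′ }
        where
        ≢c : ∀ {x} → spanned roots L x ≡ true → x ≢ c
        ≢c e refl = true≢false e c∉L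
        fixed′ : ∀ v → spanned roots L v ≡ true → rep′ v ≡ v
        fixed′ v e = trans (rep′-other (λ h → ≢c e (trans (sym rv) h))) rv
          where
          rv : rep v ≡ v
          rv = fixed v (∨-introʳ {v == c} e)
        rep-in′ : ∀ v → R v ≡ true → R (rep′ v) ≡ true
        rep-in′ v Rv with rep v ≟ c
        ... | yes _ = p∈R
        ... | no _  = rep-in v Rv
        idem′ : ∀ v → R v ≡ true → rep′ (rep′ v) ≡ rep′ v
        idem′ v Rv with rep v ≟ c
        ... | yes _ = fixed′ p p∈L
        ... | no h  = trans (rep′-other (λ e → h (trans (sym (idempotent v Rv)) e))) (idempotent v Rv)
        reach′ : ∀ v → R v ≡ true → Walk a (λ w → R w ≡ true × rep′ w ≡ rep′ v) (rep′ v) v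
        reach′ v Rv with rep v ≟ c
        ... | yes h = step pc (c∈R , rep′-c rep-c)
                        (walk-map id (λ { (Rw , e) → Rw , rep′-c (trans e h) }) (subst (λ z → Walk a (λ w → R w ≡ true × rep w ≡ rep v) z v) h (reach v Rv)))
        ... | no h  = walk-map id (λ { (Rw , e) → Rw , trans (rep′-other (λ e′ → h (trans (sym e) e′))) e }) (reach v Rv)
        growing′ : ∀ q → spanned roots L q ≡ true → size rep′ q + s * children L q ≤ 1 + s * C
        growing′ q e with p ≟ q
        ... | yes refl = arith _ _ _ (children L p) s (1 + s * C) size′-p (<⇒≤ small)
                (subst (λ z → size rep p + s * (z + children L p) ≤ 1 + s * C) (cong ι (==-refl p)) (growing p (∨-introʳ {p == c} e)))
          where
          arith : ∀ x′ x y k s b → x′ ≤ x + y → y ≤ s → x + s * (1 + k) ≤ b → x′ + s * k ≤ b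
          arith x′ x y k s b h₁ h₂ h₃ = linear 0 (+-mono-≤ h₁ (+-mono-≤ h₂ h₃)) (identity x′ x y k s b)
            where
            identity : ∀ x′ x y k s b → x′ + s * k + (x + y + (s + b)) + 0 ≡ b + (x′ + (y + (x + s * (1 + k))))
            identity = solve-∀
        ... | no p≢q   = subst (λ z → z + s * children L q ≤ 1 + s * C) (sym (size′-other q (≢c e) (λ h → p≢q (sym h))))
                (≤-trans (+-monoʳ-≤ (size rep q) (*-monoʳ-≤ s (m≤n+m (children L q) (ι (p == q))))) (growing q (∨-introʳ {q == c} e)))
        finished′ : ∀ x → spanned roots L x ≡ false → size rep′ x ≤ 1 + s * C × (s ≤ size rep′ x ⊎ size rep′ x ≡ 0)
        finished′ x e with x ≟ c
        ... | yes refl = ≤-trans (≤-reflexive size′-c) z≤n , inj₂ size′-c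
        ... | no x≢c rewrite size′-other x x≢c (λ { refl → true≢false p∈L e }) = finished x (before x≢c e)

      next : Stage L
      next with s ≤? size rep c
      ... | yes h = cut h
      ... | no h  = merge (≰⇒> h)

    -- The most recent arc comes first, so a child is met after all its own children and its part is
    -- complete: it is cut off if it has `s` vertices and merged into the part of its parent
    -- otherwise. At the end only the part of a root can be nonempty and have fewer than `s`
    -- vertices.
    decompose : ∀ L → Forest a roots L → (∀ v → spanned roots L v ≡ true → R v ≡ true) → Stage L → Stage []
    decompose []            _                    _   σ = σ
    decompose ((c , p) ∷ L) (c∉L , p∈L , pc , F) sub σ =
      decompose L F (λ v e → sub v (∨-introʳ {v == c} e))
        (Step.next c p L c∉L p∈L pc (sub c (∨-introˡ (==-refl c))) (sub p (∨-introʳ {p == c} p∈L)) σ)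

  fibre-sum : ∀ {n} (R : Fin n → Bool) (rep : Fin n → Fin n) (g : Fin n → ℕ) →
    ∑ (λ x → g x * # (λ v → R v ∧ (rep v == x))) ≡ ∑ (λ v → ι (R v) * g (rep v))
  fibre-sum {n} R rep g = begin
    ∑ (λ x → g x * # (λ v → R v ∧ (rep v == x)))           ≡⟨ ∑-cong (λ x → sym (∑-* (g x) (λ v → ι (R v ∧ (rep v == x))))) ⟩
    ∑ (λ x → ∑ (λ v → g x * ι (R v ∧ (rep v == x))))       ≡⟨ ∑-swap (λ x v → g x * ι (R v ∧ (rep v == x))) ⟩
    ∑ (λ v → ∑ (λ x → g x * ι (R v ∧ (rep v == x))))       ≡⟨ ∑-cong inner ⟩
    ∑ (λ v → ι (R v) * g (rep v))                          ∎
    where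
    open ≡-Reasoning
    rearrange : ∀ g r e → g * (r * e) ≡ r * (e * g)
    rearrange = solve-∀
    inner : ∀ v → ∑ (λ x → g x * ι (R v ∧ (rep v == x))) ≡ ι (R v) * g (rep v)
    inner v = trans (∑-cong (λ x → trans (cong (g x *_) (trans (ι-∧ (R v) (rep v == x)) (cong (λ b → ι (R v) * ι b) (==-sym (rep v) x))))
                                          (rearrange (g x) (ι (R v)) (ι (x == rep v)))))
      (trans (∑-* (ι (R v)) (λ x → ι (x == rep v) * g x)) (cong (ι (R v) *_) (∑-δ (rep v) g)))

-- Rational arithmetic and the estimates of the two potentials

module Rationals where

  open import Defs using (ℕ→ℚ)
  open import Data.Empty using (⊥; ⊥-elim)
  import Data.Integer as ℤ
  import Data.Integer.Properties as ℤ
  open import Data.Nat as ℕ using (ℕ; zero; suc; z≤n; s≤s)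
  import Data.Nat.Properties as ℕ
  open import Data.Nat.Tactic.RingSolver using () renaming (solve-∀ to ℕ-solve-∀)
  open import Data.Product using (∃-syntax; _,_)
  open import Data.Rational using (ℚ; 0ℚ; 1ℚ; ½; _+_; _*_; _-_; -_; _/_; _≤_; _<_; *≤*; mkℚ; nonNegative; positive)
  open import Data.Rational.Properties
  import Data.Rational.Unnormalised as ℚᵘ
  import Data.Rational.Unnormalised.Properties as ℚᵘ
  open import Data.Sum using (inj₁; inj₂)
  open import Relation.Nullary.Decidable using (dec⇒maybe)
  open import Relation.Binary.PropositionalEquality using (_≡_; refl; sym; trans; cong; cong₂; subst; subst₂)
  open import Tactic.RingSolver.Core.AlmostCommutativeRing using (AlmostCommutativeRing; fromCommutativeRing)
  open import Tactic.RingSolver using (solve-∀)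
  open import Level using (0ℓ)

  ℚ-ring : AlmostCommutativeRing 0ℓ 0ℓ
  ℚ-ring = fromCommutativeRing +-*-commutativeRing (λ x → dec⇒maybe (0ℚ ≟ x))

  linearℚ : ∀ {X Y A B} d → 0ℚ ≤ d → X ≤ Y → A + Y + d ≡ B + X → A ≤ B
  linearℚ {X} {Y} {A} {B} d 0≤d X≤Y eq = subst₂ _≤_ (cancel A Y) (cancel B Y) (+-monoˡ-≤ (- Y) (begin
    A + Y        ≡⟨ +-identityʳ (A + Y) ⟨
    A + Y + 0ℚ   ≤⟨ +-monoʳ-≤ (A + Y) 0≤d ⟩
    A + Y + d    ≡⟨ eq ⟩
    B + X        ≤⟨ +-monoʳ-≤ B X≤Y ⟩
    B + Y        ∎))
    where
    open ≤-Reasoning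
    cancel : ∀ a y → a + y + - y ≡ a
    cancel = solve-∀ ℚ-ring

  <⇒≱ : ∀ {x y} → x < y → y ≤ x → ⊥
  <⇒≱ x<y y≤x = <-irrefl refl (<-≤-trans x<y y≤x)

  *-monoˡ : ∀ {z x y} → 0ℚ ≤ z → x ≤ y → z * x ≤ z * y
  *-monoˡ {z} 0≤z x≤y = *-monoˡ-≤-nonNeg z {{nonNegative 0≤z}} x≤y

  *-monoʳ : ∀ {z x y} → 0ℚ ≤ z → x ≤ y → x * z ≤ y * z
  *-monoʳ {z} 0≤z x≤y = *-monoʳ-≤-nonNeg z {{nonNegative 0≤z}} x≤y

  0≤* : ∀ {x y} → 0ℚ ≤ x → 0ℚ ≤ y → 0ℚ ≤ x * y
  0≤* {x} {y} 0≤x 0≤y = subst (_≤ x * y) (*-zeroʳ x) (*-monoˡ 0≤x 0≤y)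

  0≤+ : ∀ {x y} → 0ℚ ≤ x → 0ℚ ≤ y → 0ℚ ≤ x + y
  0≤+ {x} {y} 0≤x 0≤y = subst (_≤ x + y) (+-identityʳ 0ℚ) (+-mono-≤ 0≤x 0≤y)

  *-mono : ∀ {x y u v} → 0ℚ ≤ x → 0ℚ ≤ v → x ≤ y → u ≤ v → x * u ≤ y * v
  *-mono 0≤x 0≤v x≤y u≤v = ≤-trans (*-monoˡ 0≤x u≤v) (*-monoʳ 0≤v x≤y)

  0≤1 : 0ℚ ≤ 1ℚ
  0≤1 = *≤* (ℤ.+≤+ z≤n)

  0≤½ : 0ℚ ≤ ½
  0≤½ = *≤* (ℤ.+≤+ z≤n)

  ½≤1 : ½ ≤ 1ℚ
  ½≤1 = *≤* (ℤ.+≤+ (s≤s z≤n))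

  0≤1- : ∀ {x} → x ≤ 1ℚ → 0ℚ ≤ 1ℚ - x
  0≤1- {x} x≤1 = linearℚ 0ℚ ≤-refl x≤1 (identity x)
    where
    identity : ∀ x → 0ℚ + 1ℚ + 0ℚ ≡ 1ℚ - x + x
    identity = solve-∀ ℚ-ring

  ℕ→ℚ-+ : ∀ m n → ℕ→ℚ (m ℕ.+ n) ≡ ℕ→ℚ m + ℕ→ℚ n
  ℕ→ℚ-+ m n = toℚᵘ-injective (ℚᵘ.≃-trans (toℚᵘ-fromℚᵘ (ℚᵘ.mkℚᵘ (ℤ.+ (m ℕ.+ n)) 0)) (ℚᵘ.≃-trans core (ℚᵘ.≃-sym
    (ℚᵘ.≃-trans (toℚᵘ-homo-+ (ℕ→ℚ m) (ℕ→ℚ n)) (ℚᵘ.+-cong (toℚᵘ-fromℚᵘ (ℚᵘ.mkℚᵘ (ℤ.+ m) 0)) (toℚᵘ-fromℚᵘ (ℚᵘ.mkℚᵘ (ℤ.+ n) 0)))))))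
    where
    core : ℚᵘ.mkℚᵘ (ℤ.+ (m ℕ.+ n)) 0 ℚᵘ.≃ ℚᵘ.mkℚᵘ (ℤ.+ m) 0 ℚᵘ.+ ℚᵘ.mkℚᵘ (ℤ.+ n) 0
    core = ℚᵘ.*≡* (cong (ℤ._* ℤ.1ℤ) (trans (ℤ.pos-+ m n) (cong₂ ℤ._+_ (sym (ℤ.*-identityʳ (ℤ.+ m))) (sym (ℤ.*-identityʳ (ℤ.+ n))))))

  ℕ→ℚ-suc : ∀ n → ℕ→ℚ (suc n) ≡ 1ℚ + ℕ→ℚ n
  ℕ→ℚ-suc = ℕ→ℚ-+ 1

  ℕ→ℚ-* : ∀ m n → ℕ→ℚ (m ℕ.* n) ≡ ℕ→ℚ m * ℕ→ℚ n
  ℕ→ℚ-* zero    n = sym (*-zeroˡ (ℕ→ℚ n))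
  ℕ→ℚ-* (suc m) n rewrite ℕ→ℚ-+ n (m ℕ.* n) | ℕ→ℚ-* m n | ℕ→ℚ-suc m = identity (ℕ→ℚ m) (ℕ→ℚ n)
    where
    identity : ∀ m n → n + m * n ≡ (1ℚ + m) * n
    identity = solve-∀ ℚ-ring

  0≤ℕ→ℚ : ∀ n → 0ℚ ≤ ℕ→ℚ n
  0≤ℕ→ℚ zero    = ≤-refl
  0≤ℕ→ℚ (suc n) = subst (0ℚ ≤_) (sym (ℕ→ℚ-suc n)) (0≤+ 0≤1 (0≤ℕ→ℚ n))

  ℕ→ℚ-mono : ∀ {m n} → m ℕ.≤ n → ℕ→ℚ m ≤ ℕ→ℚ n
  ℕ→ℚ-mono {m} {n} m≤n = subst₂ _≤_ (+-identityʳ (ℕ→ℚ m)) (trans (sym (ℕ→ℚ-+ m (n ℕ.∸ m))) (cong ℕ→ℚ (ℕ.m+[n∸m]≡n m≤n)))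
    (+-monoʳ-≤ (ℕ→ℚ m) (0≤ℕ→ℚ (n ℕ.∸ m)))

  unit : ℕ → ℚ
  unit k = ℤ.+ 1 / suc k

  unit-inverse : ∀ k → unit k * ℕ→ℚ (suc k) ≡ 1ℚ
  unit-inverse k = toℚᵘ-injective (ℚᵘ.≃-trans (toℚᵘ-homo-* (unit k) (ℕ→ℚ (suc k)))
    (ℚᵘ.≃-trans (ℚᵘ.*-cong (toℚᵘ-fromℚᵘ (ℚᵘ.mkℚᵘ (ℤ.+ 1) k)) (toℚᵘ-fromℚᵘ (ℚᵘ.mkℚᵘ (ℤ.+ suc k) 0))) core))
    where
    core : ℚᵘ.mkℚᵘ (ℤ.+ 1) k ℚᵘ.* ℚᵘ.mkℚᵘ (ℤ.+ suc k) 0 ℚᵘ.≃ ℚᵘ.1ℚᵘ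
    core = ℚᵘ.*≡* (cong ℤ.+_ (cong suc (trans (ℕ.*-identityʳ (k ℕ.+ 0)) (cong (ℕ._+ 0) (sym (ℕ.*-identityʳ k))))))

  0≤unit : ∀ k → 0ℚ ≤ unit k
  0≤unit k = nonNegative⁻¹ (unit k) {{normalize-nonNeg 1 (suc k)}}

  0<unit : ∀ k → 0ℚ < unit k
  0<unit k = positive⁻¹ (unit k) {{normalize-pos 1 (suc k)}}

  archimedean : ∀ x → 0ℚ < x → ∃[ N ] 1ℚ ≤ ℕ→ℚ (suc N) * x
  archimedean x@(mkℚ (ℤ.+ zero) d c) 0<x = ⊥-elim (<⇒≱ 0<x (*≤* (ℤ.+≤+ z≤n)))
  archimedean x@(mkℚ (ℤ.-[1+ _ ]) d c) 0<x = ⊥-elim (<⇒≱ 0<x (*≤* ℤ.-≤+))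
  -- A positive numerator is at least 1, so multiplying by the denominator `suc d` suffices.
  archimedean x@(mkℚ (ℤ.+ suc a) d c) 0<x = d , (begin
    1ℚ                              ≡⟨ trans (sym (unit-inverse d)) (*-comm (unit d) (ℕ→ℚ (suc d))) ⟩
    ℕ→ℚ (suc d) * unit d            ≤⟨ *-monoˡ (0≤ℕ→ℚ (suc d)) unit≤x ⟩
    ℕ→ℚ (suc d) * x                 ∎)
    where
    open ≤-Reasoning
    unit≤x : unit d ≤ x
    unit≤x = toℚᵘ-cancel-≤ (ℚᵘ.≤-respˡ-≃ (ℚᵘ.≃-sym (toℚᵘ-fromℚᵘ (ℚᵘ.mkℚᵘ (ℤ.+ 1) d)))
      (ℚᵘ.*≤* (ℤ.*-monoʳ-≤-nonNeg (ℤ.+ suc d) (ℤ.+≤+ (s≤s (z≤n {a}))))))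

  infixr 8 _**_
  _**_ : ℚ → ℕ → ℚ
  x ** zero  = 1ℚ
  x ** suc n = x * x ** n

  0≤** : ∀ {x} n → 0ℚ ≤ x → 0ℚ ≤ x ** n
  0≤** zero    0≤x = 0≤1
  0≤** (suc n) 0≤x = 0≤* 0≤x (0≤** n 0≤x)

  **-+ : ∀ x m n → x ** (m ℕ.+ n) ≡ x ** m * x ** n
  **-+ x zero    n = sym (*-identityˡ (x ** n))
  **-+ x (suc m) n = trans (cong (x *_) (**-+ x m n)) (sym (*-assoc x (x ** m) (x ** n)))

  **-distrib : ∀ x y n → (x * y) ** n ≡ x ** n * y ** n
  **-distrib x y zero    = refl
  **-distrib x y (suc n) = trans (cong (x * y *_) (**-distrib x y n)) (identity x y (x ** n) (y ** n))
    where
    identity : ∀ x y u v → x * y * (u * v) ≡ x * u * (y * v)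
    identity = solve-∀ ℚ-ring

  1** : ∀ n → 1ℚ ** n ≡ 1ℚ
  1** zero    = refl
  1** (suc n) = trans (*-identityˡ (1ℚ ** n)) (1** n)

  **-** : ∀ x m n → (x ** m) ** n ≡ x ** (m ℕ.* n)
  **-** x zero    n = 1** n
  **-** x (suc m) n = trans (**-distrib x (x ** m) n) (trans (cong (x ** n *_) (**-** x m n)) (sym (**-+ x n (m ℕ.* n))))

  **-mono : ∀ {x y} n → 0ℚ ≤ x → x ≤ y → x ** n ≤ y ** n
  **-mono zero    0≤x x≤y = ≤-refl
  **-mono (suc n) 0≤x x≤y = *-mono 0≤x (0≤** n (≤-trans 0≤x x≤y)) x≤y (**-mono n 0≤x x≤y)

  1≤** : ∀ {x} n → 1ℚ ≤ x → 1ℚ ≤ x ** n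
  1≤** {x} n 1≤x = subst (_≤ x ** n) (1** n) (**-mono n 0≤1 1≤x)

  **≤1 : ∀ {x} n → 0ℚ ≤ x → x ≤ 1ℚ → x ** n ≤ 1ℚ
  **≤1 {x} n 0≤x x≤1 = subst (x ** n ≤_) (1** n) (**-mono n 0≤x x≤1)

  **-grow : ∀ {x m n} → 1ℚ ≤ x → m ℕ.≤ n → x ** m ≤ x ** n
  **-grow {x} {m} {n} 1≤x m≤n = subst₂ _≤_ (*-identityʳ (x ** m))
    (trans (sym (**-+ x m (n ℕ.∸ m))) (cong (x **_) (ℕ.m+[n∸m]≡n m≤n)))
    (*-monoˡ (0≤** m (≤-trans 0≤1 1≤x)) (1≤** (n ℕ.∸ m) 1≤x))

  **-shrink : ∀ {x m n} → 0ℚ ≤ x → x ≤ 1ℚ → m ℕ.≤ n → x ** n ≤ x ** m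
  **-shrink {x} {m} {n} 0≤x x≤1 m≤n = subst₂ _≤_
    (trans (sym (**-+ x m (n ℕ.∸ m))) (cong (x **_) (ℕ.m+[n∸m]≡n m≤n))) (*-identityʳ (x ** m))
    (*-monoˡ (0≤** m 0≤x) (**≤1 (n ℕ.∸ m) 0≤x x≤1))

  bernoulli : ∀ x n → 0ℚ ≤ 1ℚ + x → 1ℚ + ℕ→ℚ n * x ≤ (1ℚ + x) ** n
  bernoulli x zero    0≤ = ≤-reflexive (trans (cong (1ℚ +_) (*-zeroˡ x)) (+-identityʳ 1ℚ))
  bernoulli x (suc n) 0≤ = ≤-trans
    (linearℚ (ℕ→ℚ n * (x * x)) (0≤* (0≤ℕ→ℚ n) (square≥0 x)) ≤-refl
      (trans (cong (λ z → 1ℚ + z * x + (1ℚ + x) * (1ℚ + ℕ→ℚ n * x) + ℕ→ℚ n * (x * x)) (ℕ→ℚ-suc n)) (identity (ℕ→ℚ n) x)))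
    (*-monoˡ 0≤ (bernoulli x n 0≤))
    where
    identity : ∀ n x → 1ℚ + (1ℚ + n) * x + (1ℚ + x) * (1ℚ + n * x) + n * (x * x)
      ≡ (1ℚ + x) * (1ℚ + n * x) + (1ℚ + x) * (1ℚ + n * x)
    identity = solve-∀ ℚ-ring
    square≥0 : ∀ x → 0ℚ ≤ x * x
    square≥0 x with ≤-total 0ℚ x
    ... | inj₁ h = 0≤* h h
    ... | inj₂ h = subst (0ℚ ≤_) (neg-square x) (0≤* (neg-antimono-≤ h) (neg-antimono-≤ h))
      where
      neg-square : ∀ x → - x * - x ≡ x * x
      neg-square = solve-∀ ℚ-ring

  0<* : ∀ {x y} → 0ℚ < x → 0ℚ < y → 0ℚ < x * y
  0<* {x} {y} 0<x 0<y = positive⁻¹ (x * y) {{pos*pos⇒pos x {{positive 0<x}} y {{positive 0<y}}}}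

  0<** : ∀ {x} n → 0ℚ < x → 0ℚ < x ** n
  0<** zero    0<x = 0<unit 0
  0<** (suc n) 0<x = 0<* 0<x (0<** n 0<x)

  ℕ→ℚ-*-≤1 : ∀ {m n x} → 0ℚ ≤ x → m ℕ.≤ n → ℕ→ℚ n * x ≡ 1ℚ → ℕ→ℚ m * x ≤ 1ℚ
  ℕ→ℚ-*-≤1 0≤x m≤n e = ≤-trans (*-monoʳ 0≤x (ℕ→ℚ-mono m≤n)) (≤-reflexive e)

  -- The potential (1 - τ)^Y (1 + pτ)^Q is large when few of the Q queries succeeded. Its
  -- β-th power is estimated, so that only Bernoulli's inequality is needed.
  module FewSuccesses (β L f₀ : ℕ) (τ p η : ℚ) (0≤τ : 0ℚ ≤ τ) (0≤p : 0ℚ ≤ p) (0<η : 0ℚ < η)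
    (τ-eq : ℕ→ℚ (2 ℕ.* (suc β ℕ.* (2 ℕ.+ β))) * τ ≡ 1ℚ)
    (drift : ℕ→ℚ (2 ℕ.+ β) ≤ ℕ→ℚ β * (ℕ→ℚ L * p))
    (big : 1ℚ ≤ η ** β * (ℕ→ℚ f₀ * (½ * τ))) where

    private
      z w b : ℚ
      z = 1ℚ - τ
      w = 1ℚ + p * τ
      b = ℕ→ℚ β

      [1+β]τ≤1 : ℕ→ℚ (suc β) * τ ≤ 1ℚ
      [1+β]τ≤1 = ℕ→ℚ-*-≤1 0≤τ (ℕ.≤-trans (ℕ.m≤m*n (suc β) (2 ℕ.+ β)) (ℕ.m≤n*m (suc β ℕ.* (2 ℕ.+ β)) 2)) τ-eq

      τ≤1 : τ ≤ 1ℚ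
      τ≤1 = subst (_≤ 1ℚ) (*-identityˡ τ) (≤-trans (*-monoʳ 0≤τ (ℕ→ℚ-mono {1} {suc β} (s≤s z≤n))) [1+β]τ≤1)

      0≤z : 0ℚ ≤ z
      0≤z = 0≤1- τ≤1

      z≤1 : z ≤ 1ℚ
      z≤1 = linearℚ 0ℚ ≤-refl 0≤τ (identity τ)
        where
        identity : ∀ τ → 1ℚ - τ + τ + 0ℚ ≡ 1ℚ + 0ℚ
        identity = solve-∀ ℚ-ring

      1≤1+ : ∀ {x} → 0ℚ ≤ x → 1ℚ ≤ 1ℚ + x
      1≤1+ {x} 0≤x = subst (_≤ 1ℚ + x) (+-identityʳ 1ℚ) (+-monoʳ-≤ 1ℚ 0≤x)

      1≤w : 1ℚ ≤ w
      1≤w = 1≤1+ (0≤* 0≤p 0≤τ)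

      z-power : 1ℚ - (1ℚ + b) * τ ≤ z ** suc β
      z-power = subst (_≤ z ** suc β) (trans (cong (λ n → 1ℚ + n * - τ) (ℕ→ℚ-suc β)) (identity b τ)) (bernoulli (- τ) (suc β) 0≤z)
        where
        identity : ∀ b τ → 1ℚ + (1ℚ + b) * - τ ≡ 1ℚ - (1ℚ + b) * τ
        identity = solve-∀ ℚ-ring

      w-power : 1ℚ + (1ℚ + 1ℚ + b) * τ ≤ (w ** L) ** β
      w-power = begin
        1ℚ + (1ℚ + 1ℚ + b) * τ               ≡⟨ cong (λ n → 1ℚ + n * τ) (sym (ℕ→ℚ-+ 2 β)) ⟩
        1ℚ + ℕ→ℚ (2 ℕ.+ β) * τ               ≤⟨ +-monoʳ-≤ 1ℚ (*-monoʳ 0≤τ drift) ⟩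
        1ℚ + b * (ℕ→ℚ L * p) * τ             ≡⟨ identity b (ℕ→ℚ L) p τ ⟩
        1ℚ + b * (ℕ→ℚ L * (p * τ))           ≤⟨ bernoulli (ℕ→ℚ L * (p * τ)) β (≤-trans 0≤1 (1≤1+ Lpτ≥0)) ⟩
        (1ℚ + ℕ→ℚ L * (p * τ)) ** β          ≤⟨ **-mono β (≤-trans 0≤1 (1≤1+ Lpτ≥0)) (bernoulli (p * τ) L (≤-trans 0≤1 1≤w)) ⟩
        (w ** L) ** β                        ∎
        where
        open ≤-Reasoning
        Lpτ≥0 : 0ℚ ≤ ℕ→ℚ L * (p * τ)
        Lpτ≥0 = 0≤* (0≤ℕ→ℚ L) (0≤* 0≤p 0≤τ)
        identity : ∀ b l p τ → 1ℚ + b * (l * p) * τ ≡ 1ℚ + b * (l * (p * τ))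
        identity = solve-∀ ℚ-ring

      -- The gain for one vertex with `L` queries. The product of the linear bounds is 1 + τ - (β +
      -- 1)(β + 2)τ², and τ = 1 / (2(β + 1)(β + 2)) is the value at which the quadratic loss is
      -- exactly τ / 2.
      ratio : 1ℚ + ½ * τ ≤ z ** suc β * (w ** L) ** β
      ratio = begin
        1ℚ + ½ * τ                                           ≡⟨ cong (λ n → 1ℚ + n * τ) half ⟩
        1ℚ + (1ℚ - (1ℚ + b) * (1ℚ + 1ℚ + b) * τ) * τ         ≡⟨ identity b τ ⟩
        (1ℚ - (1ℚ + b) * τ) * (1ℚ + (1ℚ + 1ℚ + b) * τ)       ≤⟨ *-mono nonneg (0≤** β (0≤** L (≤-trans 0≤1 1≤w))) z-power w-power ⟩
        z ** suc β * (w ** L) ** β                           ∎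
        where
        open ≤-Reasoning
        nonneg : 0ℚ ≤ 1ℚ - (1ℚ + b) * τ
        nonneg = 0≤1- (subst (λ n → n * τ ≤ 1ℚ) (ℕ→ℚ-suc β) [1+β]τ≤1)
        identity : ∀ b τ → 1ℚ + (1ℚ - (1ℚ + b) * (1ℚ + 1ℚ + b) * τ) * τ ≡ (1ℚ - (1ℚ + b) * τ) * (1ℚ + (1ℚ + 1ℚ + b) * τ)
        identity = solve-∀ ℚ-ring
        half : ½ ≡ 1ℚ - (1ℚ + b) * (1ℚ + 1ℚ + b) * τ
        half = trans (cong (λ x → 1ℚ - ½ * x) (trans (sym τ-eq) (cong (_* τ) (trans (ℕ→ℚ-* 2 (suc β ℕ.* (2 ℕ.+ β)))
            (cong (ℕ→ℚ 2 *_) (trans (ℕ→ℚ-* (suc β) (2 ℕ.+ β)) (cong₂ _*_ (ℕ→ℚ-suc β) (ℕ→ℚ-+ 2 β))))))))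
          (cong (λ x → 1ℚ - x) (trans (regroup ½ (ℕ→ℚ 2) ((1ℚ + b) * (1ℚ + 1ℚ + b)) τ) (*-identityˡ ((1ℚ + b) * (1ℚ + 1ℚ + b) * τ))))
          where
          regroup : ∀ h t x τ → h * (t * x * τ) ≡ h * t * (x * τ)
          regroup = solve-∀ ℚ-ring

    -- The power β clears the fraction in `Y ≤ (1 + 1/β) * f`. By `ratio` the result is at least η^β
    -- (1 + τ/2)^f, which exceeds 1 once `f₀ ≤ f`; a number at most 1 could not have such a power.
    few-successes : ∀ Y Q f → f₀ ℕ.≤ f → L ℕ.* f ℕ.≤ Q → β ℕ.* Y ℕ.≤ suc β ℕ.* f →
      1ℚ ≤ η * (z ** Y * w ** Q)
    few-successes Y Q f f₀≤f Lf≤Q βY≤ with ≤-total 1ℚ (η * (z ** Y * w ** Q))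
    ... | inj₁ h = h
    ... | inj₂ h = ⊥-elim (<⇒≱ above-one (**≤1 β (0≤* (<⇒≤ 0<η) (0≤* (0≤** Y 0≤z) (0≤** Q (≤-trans 0≤1 1≤w)))) h))
      where
      open ≤-Reasoning
      regroup : (z ** suc β * (w ** L) ** β) ** f ≡ z ** (suc β ℕ.* f) * w ** (L ℕ.* f ℕ.* β)
      regroup = trans (**-distrib (z ** suc β) ((w ** L) ** β) f) (cong₂ _*_ (**-** z (suc β) f)
        (trans (cong (_** f) (**-** w L β)) (trans (**-** w (L ℕ.* β) f) (cong (w **_) (swap L β f)))))
        where
        swap : ∀ l b f → l ℕ.* b ℕ.* f ≡ l ℕ.* f ℕ.* b
        swap l b f = trans (ℕ.*-assoc l b f) (trans (cong (l ℕ.*_) (ℕ.*-comm b f)) (sym (ℕ.*-assoc l f b)))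
      above-one : 1ℚ < (η * (z ** Y * w ** Q)) ** β
      above-one = begin-strict
        1ℚ                                                  ≡⟨ +-identityˡ 1ℚ ⟨
        0ℚ + 1ℚ                                             <⟨ +-monoˡ-< 1ℚ (0<** β 0<η) ⟩
        η ** β + 1ℚ                                         ≤⟨ +-monoʳ-≤ (η ** β) big ⟩
        η ** β + η ** β * (ℕ→ℚ f₀ * (½ * τ))                ≡⟨ identity (η ** β) (ℕ→ℚ f₀ * (½ * τ)) ⟩
        η ** β * (1ℚ + ℕ→ℚ f₀ * (½ * τ))                    ≤⟨ *-monoˡ 0≤ηβ (+-monoʳ-≤ 1ℚ (*-monoʳ 0≤½τ (ℕ→ℚ-mono f₀≤f))) ⟩
        η ** β * (1ℚ + ℕ→ℚ f * (½ * τ))                     ≤⟨ *-monoˡ 0≤ηβ (bernoulli (½ * τ) f (≤-trans 0≤1 (1≤1+ 0≤½τ))) ⟩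
        η ** β * (1ℚ + ½ * τ) ** f                          ≤⟨ *-monoˡ 0≤ηβ (**-mono f (≤-trans 0≤1 (1≤1+ 0≤½τ)) ratio) ⟩
        η ** β * (z ** suc β * (w ** L) ** β) ** f          ≡⟨ cong (η ** β *_) regroup ⟩
        η ** β * (z ** (suc β ℕ.* f) * w ** (L ℕ.* f ℕ.* β))
          ≤⟨ *-monoˡ 0≤ηβ (*-mono (0≤** (suc β ℕ.* f) 0≤z) (0≤** (Q ℕ.* β) (≤-trans 0≤1 1≤w))
               (**-shrink 0≤z z≤1 (subst (ℕ._≤ suc β ℕ.* f) (ℕ.*-comm β Y) βY≤)) (**-grow 1≤w (ℕ.*-monoˡ-≤ β Lf≤Q))) ⟩
        η ** β * (z ** (Y ℕ.* β) * w ** (Q ℕ.* β))          ≡⟨ cong (η ** β *_) (cong₂ _*_ (sym (**-** z Y β)) (sym (**-** w Q β))) ⟩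
        η ** β * ((z ** Y) ** β * (w ** Q) ** β)            ≡⟨ cong (η ** β *_) (sym (**-distrib (z ** Y) (w ** Q) β)) ⟩
        η ** β * (z ** Y * w ** Q) ** β                     ≡⟨ sym (**-distrib η (z ** Y * w ** Q) β) ⟩
        (η * (z ** Y * w ** Q)) ** β                        ∎
        where
        0≤ηβ : 0ℚ ≤ η ** β
        0≤ηβ = <⇒≤ (0<** β 0<η)
        0≤½τ : 0ℚ ≤ ½ * τ
        0≤½τ = 0≤* 0≤½ 0≤τ
        identity : ∀ e x → e + e * x ≡ e * (1ℚ + x)
        identity = solve-∀ ℚ-ring

  -- With z = ½ a success halves the potential, while every block of `T` queries at least doubles
  -- it. If at most half as many successes as blocks occurred, a factor 2^(H - Y) is left, and
  -- `H - Y` is at least `g`.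
  fewer-than-half : ∀ (T g : ℕ) (p η : ℚ) → 0ℚ ≤ p → 0ℚ ≤ η → ℕ→ℚ 2 ≤ ℕ→ℚ T * p → 1ℚ ≤ ℕ→ℚ g * η →
    ∀ Y Q H → T ℕ.* H ℕ.≤ Q → 2 ℕ.* Y ℕ.≤ H → 2 ℕ.* g ℕ.≤ H →
    1ℚ ≤ η * (½ ** Y * (1ℚ + p * ½) ** Q)
  fewer-than-half T g p η 0≤p 0≤η drift big Y Q H TH≤Q 2Y≤H 2g≤H = begin
    1ℚ                                              ≤⟨ big ⟩
    ℕ→ℚ g * η                                       ≡⟨ *-comm (ℕ→ℚ g) η ⟩
    η * ℕ→ℚ g                                       ≤⟨ *-monoˡ 0≤η (ℕ→ℚ-mono g≤e) ⟩
    η * ℕ→ℚ e                                       ≤⟨ *-monoˡ 0≤η (linearℚ 1ℚ 0≤1 (bernoulli 1ℚ e (0≤+ 0≤1 0≤1)) (identity (ℕ→ℚ e) two-e)) ⟩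
    η * (1ℚ + 1ℚ) ** e                              ≡⟨ cong (η *_) (sym cancel) ⟩
    η * (½ ** Y * (1ℚ + 1ℚ) ** H)                   ≤⟨ *-monoˡ 0≤η (*-monoˡ (0≤** Y 0≤½) (≤-trans (**-mono H (0≤+ 0≤1 0≤1) double) (≤-reflexive (**-** w T H)))) ⟩
    η * (½ ** Y * w ** (T ℕ.* H))                   ≤⟨ *-monoˡ 0≤η (*-monoˡ (0≤** Y 0≤½) (**-grow 1≤w TH≤Q)) ⟩
    η * (½ ** Y * w ** Q)                           ∎
    where
    open ≤-Reasoning
    w : ℚ
    w = 1ℚ + p * ½
    e : ℕ
    e = H ℕ.∸ Y
    two-e : ℚ
    two-e = (1ℚ + 1ℚ) ** e
    identity : ∀ x y → x + y + 1ℚ ≡ y + (1ℚ + x * 1ℚ)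
    identity = solve-∀ ℚ-ring
    1≤w : 1ℚ ≤ w
    1≤w = subst (_≤ w) (+-identityʳ 1ℚ) (+-monoʳ-≤ 1ℚ (0≤* 0≤p 0≤½))
    Y≤H : Y ℕ.≤ H
    Y≤H = ℕ.≤-trans (ℕ.m≤n*m Y 2) 2Y≤H
    g≤e : g ℕ.≤ e
    g≤e = ℕ.*-cancelˡ-≤ 2 (ℕ.+-cancelʳ-≤ (2 ℕ.* Y) (2 ℕ.* g) (2 ℕ.* e) (ℕ.≤-trans (ℕ.+-mono-≤ 2g≤H 2Y≤H)
      (ℕ.≤-reflexive (trans (cong (λ h → h ℕ.+ h) (sym (ℕ.m∸n+n≡m Y≤H))) (twice e Y)))))
      where
      twice : ∀ e y → e ℕ.+ y ℕ.+ (e ℕ.+ y) ≡ 2 ℕ.* e ℕ.+ 2 ℕ.* y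
      twice = ℕ-solve-∀
    double : 1ℚ + 1ℚ ≤ w ** T
    double = ≤-trans (linearℚ 0ℚ ≤-refl (*-monoʳ 0≤½ drift) (identity′ (ℕ→ℚ T) p ½)) (bernoulli (p * ½) T (≤-trans 0≤1 1≤w))
      where
      identity′ : ∀ t p h → 1ℚ + 1ℚ + t * p * h + 0ℚ ≡ 1ℚ + t * (p * h) + 1ℚ
      identity′ = solve-∀ ℚ-ring
    cancel : ½ ** Y * (1ℚ + 1ℚ) ** H ≡ (1ℚ + 1ℚ) ** e
    cancel = trans (cong (λ h → ½ ** Y * (1ℚ + 1ℚ) ** h) (sym (ℕ.m+[n∸m]≡n Y≤H)))
      (trans (cong (½ ** Y *_) (**-+ (1ℚ + 1ℚ) Y e)) (trans (sym (*-assoc (½ ** Y) _ _))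
      (trans (cong (_* (1ℚ + 1ℚ) ** e) (trans (sym (**-distrib ½ (1ℚ + 1ℚ) Y)) (1** Y))) (*-identityˡ _))))

-- Random subgraphs as trees of edge queries

module RandomEdges where

  open FiniteSums using (T⇒≡true; ∨-introˡ; ∨-introʳ; ∨-elim; ∧-intro; ∧-elim)
  open Minors using (Rel)
  open Rationals
  open import Defs using (Graph; edges; keptAdj; allBits; weight; sumℚ; ProbAtLeast)
  open import Data.Bool using (Bool; true; false; _∧_; _∨_; not; if_then_else_)
  open import Data.Bool.Properties using (∨-comm)
  open import Data.Fin using (Fin; zero; suc) renaming (_≟_ to _≟ᶠ_)
  open import Data.List using (List; []; _∷_; map; concatMap; length) renaming (lookup to lookupᴸ)
  open import Data.Nat using (zero; suc)
  open import Data.Product using (_×_; _,_; proj₁; proj₂)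
  open import Data.Rational using (ℚ; 0ℚ; 1ℚ; _+_; _*_; _-_; -_; _≤_)
  open import Data.Rational.Properties
  open import Data.Sum using (_⊎_; inj₁; inj₂)
  open import Data.Vec using (Vec; []; _∷_; lookup; _[_]≔_; replicate) renaming (map to mapⱽ)
  open import Function using (_∘_)
  open import Relation.Nullary using (yes; no)
  open import Relation.Nullary.Decidable using (⌊_⌋)
  open import Relation.Binary.PropositionalEquality using (_≡_; refl; sym; trans; cong; cong₂; subst; module ≡-Reasoning)
  open import Tactic.RingSolver using (solve-∀)

  -- The conditional probabilities of an edge to be present, given the answers so far, are
  -- p (fresh), p₂ (failed), p₁ (spare), 0 (absent) and 1 (present).
  data Status : Set where
    fresh failed spare absent present : Status

  isPresent : Status → Bool
  isPresent present = true
  isPresent _       = false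

  known : ∀ {m} → Vec Status m → Vec Bool m
  known = mapⱽ isPresent

  -- One-sided on purpose: only edges known to be present are recorded. Clique minors survive the
  -- addition of edges, so a negative answer matters only through the probability it leaves.
  respects : ∀ {m} → Vec Status m → Vec Bool m → Bool
  respects []      []      = true
  respects (x ∷ q) (b ∷ s) = (not (isPresent x) ∨ b) ∧ respects q s

  hits : ∀ {n} → Fin n × Fin n → Fin n → Fin n → Bool
  hits (x , y) u v = (⌊ x ≟ᶠ u ⌋ ∧ ⌊ y ≟ᶠ v ⌋) ∨ (⌊ x ≟ᶠ v ⌋ ∧ ⌊ y ≟ᶠ u ⌋)

  kept-mono : ∀ {n m} (es : List (Fin n × Fin n)) (q : Vec Status m) s → respects q s ≡ true →
    ∀ u v → keptAdj es (known q) u v ≡ true → keptAdj es s u v ≡ true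
  kept-mono (e ∷ es) (x ∷ q) (b ∷ s) r u v k with ∧-elim {not (isPresent x) ∨ b} r
  ... | r₁ , r₂ with ∨-elim {isPresent x ∧ hits e u v} k
  ...   | inj₂ k₂ = ∨-introʳ {b ∧ hits e u v} (kept-mono es q s r₂ u v k₂)
  ...   | inj₁ k₁ with ∧-elim {isPresent x} k₁
  ...     | px , h rewrite px = ∨-introˡ {b ∧ hits e u v} (∧-intro r₁ h)

  kept-sym : ∀ {n m} (es : List (Fin n × Fin n)) (s : Vec Bool m) u v → keptAdj es s u v ≡ keptAdj es s v u
  kept-sym []             s       u v = refl
  kept-sym (_ ∷ _)        []      u v = refl
  kept-sym ((x , y) ∷ es) (b ∷ s) u v = cong₂ _∨_ (cong (b ∧_) (∨-comm (⌊ x ≟ᶠ u ⌋ ∧ ⌊ y ≟ᶠ v ⌋) _)) (kept-sym es s u v)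

  ⌊≟⌋-refl : ∀ {n} (x : Fin n) → ⌊ x ≟ᶠ x ⌋ ≡ true
  ⌊≟⌋-refl x with x ≟ᶠ x
  ... | yes _  = refl
  ... | no x≢x with () ← x≢x refl

  kept-present : ∀ {n} (es : List (Fin n × Fin n)) (q : Vec Status (length es)) i {u v} → lookupᴸ es i ≡ (u , v) →
    keptAdj es (known (q [ i ]≔ present)) u v ≡ true
  kept-present ((x , y) ∷ es) (_ ∷ q) zero refl rewrite ⌊≟⌋-refl x | ⌊≟⌋-refl y = refl
  kept-present (e ∷ es) (x ∷ q) (suc i) {u} {v} h = ∨-introʳ {isPresent x ∧ hits e u v} (kept-present es q i h)

  kept-lookup : ∀ {n} (es : List (Fin n × Fin n)) (q : Vec Status (length es)) i {u v} → lookupᴸ es i ≡ (u , v) →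
    lookup q i ≡ present → keptAdj es (known q) u v ≡ true
  kept-lookup ((x , y) ∷ es) (_ ∷ q) zero refl refl rewrite ⌊≟⌋-refl x | ⌊≟⌋-refl y = refl
  kept-lookup (e ∷ es) (x ∷ q) (suc i) {u} {v} h h′ = ∨-introʳ {isPresent x ∧ hits e u v} (kept-lookup es q i h h′)

  kept-update : ∀ {n m} (es : List (Fin n × Fin n)) (q : Vec Status m) i y → isPresent (lookup q i) ≡ false →
    ∀ u v → keptAdj es (known q) u v ≡ true → keptAdj es (known (q [ i ]≔ y)) u v ≡ true
  kept-update (e ∷ es) (x ∷ q) zero y h u v k with isPresent x
  kept-update (e ∷ es) (x ∷ q) zero y refl u v k | false = ∨-introʳ {isPresent y ∧ hits e u v} k
  kept-update (e ∷ es) (x ∷ q) (suc i) y h u v k with ∨-elim {isPresent x ∧ hits e u v} k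
  ... | inj₁ k₁ = ∨-introˡ k₁
  ... | inj₂ k₂ = ∨-introʳ {isPresent x ∧ hits e u v} (kept-update es q i y h u v k₂)

  module Percolation (p p₁ p₂ : ℚ) (0≤p₁ : 0ℚ ≤ p₁) (p₁≤1 : p₁ ≤ 1ℚ) (0≤p₂ : 0ℚ ≤ p₂) (p₂≤1 : p₂ ≤ 1ℚ)
    (p-split : p ≡ p₁ + (1ℚ - p₁) * p₂) where

    value : Status → ℚ
    value fresh   = p
    value failed  = p₂
    value spare   = p₁
    value absent  = 0ℚ
    value present = 1ℚ

    0≤value : ∀ x → 0ℚ ≤ value x
    0≤value fresh   = subst (0ℚ ≤_) (sym p-split) (0≤+ 0≤p₁ (0≤* (0≤1- p₁≤1) 0≤p₂))
    0≤value failed  = 0≤p₂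
    0≤value spare   = 0≤p₁
    0≤value absent  = ≤-refl
    0≤value present = 0≤1

    0≤1-value : ∀ x → 0ℚ ≤ 1ℚ - value x
    0≤1-value fresh = subst (λ p → 0ℚ ≤ 1ℚ - p) (sym p-split) (subst (0ℚ ≤_) (identity p₁ p₂) (0≤* (0≤1- p₁≤1) (0≤1- p₂≤1)))
      where
      identity : ∀ p₁ p₂ → (1ℚ - p₁) * (1ℚ - p₂) ≡ 1ℚ - (p₁ + (1ℚ - p₁) * p₂)
      identity = solve-∀ ℚ-ring
    0≤1-value failed  = 0≤1- p₂≤1
    0≤1-value spare   = 0≤1- p₁≤1
    0≤1-value absent  = 0≤1
    0≤1-value present = ≤-refl

    Pr : ∀ {m} → Vec Status m → (Vec Bool m → Bool) → ℚ
    Pr []      g = if g [] then 1ℚ else 0ℚ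
    Pr (x ∷ q) g = value x * Pr q (g ∘ (true ∷_)) + (1ℚ - value x) * Pr q (g ∘ (false ∷_))

    Pr-mono : ∀ {m} (q : Vec Status m) {g h} → (∀ s → g s ≡ true → h s ≡ true) → Pr q g ≤ Pr q h
    Pr-mono [] {g} {h} sub with g [] in eq
    ... | true rewrite sub [] eq = ≤-refl
    ... | false with h []
    ...   | true  = 0≤1
    ...   | false = ≤-refl
    Pr-mono (x ∷ q) sub = +-mono-≤
      (*-monoˡ (0≤value x) (Pr-mono q (sub ∘ (true ∷_)))) (*-monoˡ (0≤1-value x) (Pr-mono q (sub ∘ (false ∷_))))

    Pr-empty : ∀ {m} (q : Vec Status m) → Pr q (λ _ → false) ≡ 0ℚ
    Pr-empty []      = refl
    Pr-empty (x ∷ q) = trans (cong (λ z → value x * z + (1ℚ - value x) * z) (Pr-empty q)) (identity (value x))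
      where
      identity : ∀ a → a * 0ℚ + (1ℚ - a) * 0ℚ ≡ 0ℚ
      identity = solve-∀ ℚ-ring

    Pr-respects : ∀ {m} (q : Vec Status m) → Pr q (respects q) ≡ 1ℚ
    Pr-respects [] = refl
    Pr-respects (x ∷ q) = lem x
      where
      average : ∀ a → a * 1ℚ + (1ℚ - a) * 1ℚ ≡ 1ℚ
      average = solve-∀ ℚ-ring
      free : ∀ a → a * Pr q (respects q) + (1ℚ - a) * Pr q (respects q) ≡ 1ℚ
      free a = trans (cong (λ z → a * z + (1ℚ - a) * z) (Pr-respects q)) (average a)
      lem : ∀ x → Pr (x ∷ q) (respects (x ∷ q)) ≡ 1ℚ
      lem fresh   = free p
      lem failed  = free p₂
      lem spare   = free p₁
      lem absent  = free 0ℚ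
      lem present = trans (cong₂ (λ z y → 1ℚ * z + (1ℚ - 1ℚ) * y) (Pr-respects q) (Pr-empty q)) refl

    -- A query of chance `a` splits `value x` as `a + (1 - a) * value y`. Since 1 - p = (1 - p₁)(1 -
    -- p₂) is symmetric, a fresh edge may be asked with the chance of either round, and a failure
    -- leaves the chance of the other one.
    data Query : ℚ → Status → Status → Set where
      first  : Query p₁ fresh failed
      second : Query p₂ failed absent
      only   : Query p₂ fresh spare

    query-value : ∀ {a x y} → Query a x y → value x ≡ a + (1ℚ - a) * value y
    query-value first = p-split
    query-value second = identity p₂
      where
      identity : ∀ a → a ≡ a + (1ℚ - a) * 0ℚ
      identity = solve-∀ ℚ-ring
    query-value only = trans p-split (identity p₁ p₂)
      where
      identity : ∀ p₁ p₂ → p₁ + (1ℚ - p₁) * p₂ ≡ p₂ + (1ℚ - p₂) * p₁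
      identity = solve-∀ ℚ-ring

    query-chance : ∀ {a x y} → Query a x y → 0ℚ ≤ a × 0ℚ ≤ 1ℚ - a
    query-chance first  = 0≤p₁ , 0≤1- p₁≤1
    query-chance second = 0≤p₂ , 0≤1- p₂≤1
    query-chance only   = 0≤p₂ , 0≤1- p₂≤1

    Pr-query : ∀ {m a x y} → Query a x y → (q : Vec Status m) (i : Fin m) → lookup q i ≡ x → ∀ g →
      Pr q g ≡ a * Pr (q [ i ]≔ present) g + (1ℚ - a) * Pr (q [ i ]≔ y) g
    Pr-query {a = a} {y = y} κ (x ∷ q) zero refl g =
      trans (cong (λ v → v * Pr q (g ∘ (true ∷_)) + (1ℚ - v) * Pr q (g ∘ (false ∷_))) (query-value κ))
        (identity a (value y) (Pr q (g ∘ (true ∷_))) (Pr q (g ∘ (false ∷_))))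
      where
      identity : ∀ a y s t → (a + (1ℚ - a) * y) * s + (1ℚ - (a + (1ℚ - a) * y)) * t
        ≡ a * (1ℚ * s + (1ℚ - 1ℚ) * t) + (1ℚ - a) * (y * s + (1ℚ - y) * t)
      identity = solve-∀ ℚ-ring
    Pr-query {a = a} κ (x ∷ q) (suc i) h g =
      trans (cong₂ (λ s t → value x * s + (1ℚ - value x) * t) (Pr-query κ q i h (g ∘ (true ∷_))) (Pr-query κ q i h (g ∘ (false ∷_))))
        (identity a (value x) _ _ _ _)
      where
      identity : ∀ a v s t s′ t′ → v * (a * s + (1ℚ - a) * t) + (1ℚ - v) * (a * s′ + (1ℚ - a) * t′)
        ≡ a * (v * s + (1ℚ - v) * s′) + (1ℚ - a) * (v * t + (1ℚ - v) * t′)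
      identity = solve-∀ ℚ-ring

    record Likely {m} (E : Vec Bool m → Set) (q : Vec Status m) (r : ℚ) : Set where
      constructor likely
      field
        good  : Vec Bool m → Bool
        sound : ∀ s → good s ≡ true → E s
        bound : r ≤ Pr q good

    module _ {m} {E : Vec Bool m → Set} where

      likely-weaken : ∀ {q r r′} → r′ ≤ r → Likely E q r → Likely E q r′
      likely-weaken r′≤r (likely g s b) = likely g s (≤-trans r′≤r b)

      likely-trivial : ∀ {q r} → r ≤ 0ℚ → Likely E q r
      likely-trivial {q} r≤0 = likely (λ _ → false) (λ _ ()) (≤-trans r≤0 (≤-reflexive (sym (Pr-empty q))))

      likely-certain : ∀ {q} → (∀ s → respects q s ≡ true → E s) → Likely E q 1ℚ
      likely-certain {q} h = likely (respects q) h (≤-reflexive (sym (Pr-respects q)))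

      -- The good sets of the two branches are simply united. Each implies `E` for all outcomes,
      -- whatever the answer, so soundness needs no case distinction on the edge, and monotonicity
      -- of `Pr` does the rest.
      likely-query : ∀ {a x y q i r₁ r₂} → Query a x y → lookup q i ≡ x →
        Likely E (q [ i ]≔ present) r₁ → Likely E (q [ i ]≔ y) r₂ → Likely E q (a * r₁ + (1ℚ - a) * r₂)
      likely-query {a} {y = y} {q} {i} κ h (likely g₁ s₁ b₁) (likely g₂ s₂ b₂) =
        likely g (λ s e → cases s (∨-elim {g₁ s} e))
          (≤-trans (+-mono-≤ (*-monoˡ (proj₁ (query-chance κ)) (≤-trans b₁ (Pr-mono (q [ i ]≔ present) (λ s e → ∨-introˡ e))))
                             (*-monoˡ (proj₂ (query-chance κ)) (≤-trans b₂ (Pr-mono (q [ i ]≔ y) (λ s e → ∨-introʳ {g₁ s} e)))))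
            (≤-reflexive (sym (Pr-query κ q i h g))))
        where
        g : Vec Bool m → Bool
        g s = g₁ s ∨ g₂ s
        cases : ∀ s → g₁ s ≡ true ⊎ g₂ s ≡ true → E s
        cases s (inj₁ e) = s₁ s e
        cases s (inj₂ e) = s₂ s e

      -- The potential z^Y (1 + a(1 - z))^Q of Y successes in Q queries is a supermartingale.
      likely-potential : ∀ {a x y q i} c η z Y Q → 0ℚ ≤ η → 0ℚ ≤ z → z ≤ 1ℚ → Query a x y → lookup q i ≡ x →
        let w = 1ℚ + a * (1ℚ - z) in
        Likely E (q [ i ]≔ present) (c - η * (z ** suc Y * w ** suc Q)) →
        Likely E (q [ i ]≔ y) (c - η * (z ** Y * w ** suc Q)) → Likely E q (c - η * (z ** Y * w ** Q))
      likely-potential {a} c η z Y Q 0≤η 0≤z z≤1 κ h L₁ L₂ = likely-weaken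
        (linearℚ {0ℚ} {0ℚ} (η * (z ** Y * w ** Q) * (x * x))
          (0≤* (0≤* 0≤η (0≤* (0≤** Y 0≤z) (0≤** Q (0≤+ 0≤1 0≤x)))) (0≤* 0≤x 0≤x)) ≤-refl
          (trans (+-comm-middle (c - η * (z ** Y * w ** Q)) _ _) (cong₂ _+_ (sym (identity a z c η (z ** Y) (w ** Q))) refl)))
        (likely-query κ h L₁ L₂)
        where
        x w : ℚ
        x = a * (1ℚ - z)
        w = 1ℚ + a * (1ℚ - z)
        0≤x : 0ℚ ≤ x
        0≤x = 0≤* (proj₁ (query-chance κ)) (0≤1- z≤1)
        +-comm-middle : ∀ a b c → a + b + c ≡ a + c + b
        +-comm-middle = solve-∀ ℚ-ring
        identity : ∀ a z c h s t →
          a * (c - h * (z * s * ((1ℚ + a * (1ℚ - z)) * t))) + (1ℚ - a) * (c - h * (s * ((1ℚ + a * (1ℚ - z)) * t)))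
          ≡ c - h * (s * t) + h * (s * t) * (a * (1ℚ - z) * (a * (1ℚ - z)))
        identity = solve-∀ ℚ-ring

      -- Unlucky branches end here: once the potential reaches 1 the promised bound is not positive,
      -- and the empty event attains it.
      likely-exhausted : ∀ {q} c x → c ≤ 1ℚ → 1ℚ ≤ x → Likely E q (c - x)
      likely-exhausted c x c≤1 1≤x = likely-trivial (linearℚ 0ℚ ≤-refl (≤-trans c≤1 1≤x) (identity c x))
        where
        identity : ∀ c x → c - x + x + 0ℚ ≡ 0ℚ + c
        identity = solve-∀ ℚ-ring

    sumℚ-pairs : ∀ {m} (f : Vec Bool (suc m) → ℚ) (xs : List (Vec Bool m)) →
      sumℚ (map f (concatMap (λ v → (true ∷ v) ∷ (false ∷ v) ∷ []) xs))
        ≡ sumℚ (map (f ∘ (true ∷_)) xs) + sumℚ (map (f ∘ (false ∷_)) xs)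
    sumℚ-pairs f [] = refl
    sumℚ-pairs f (x ∷ xs) = trans (cong (λ z → f (true ∷ x) + (f (false ∷ x) + z)) (sumℚ-pairs f xs))
      (identity (f (true ∷ x)) (f (false ∷ x)) _ _)
      where
      identity : ∀ a b s t → a + (b + (s + t)) ≡ a + s + (b + t)
      identity = solve-∀ ℚ-ring

    sumℚ-* : ∀ {A : Set} c (f g : A → ℚ) xs → (∀ x → g x ≡ c * f x) → sumℚ (map g xs) ≡ c * sumℚ (map f xs)
    sumℚ-* c f g [] h = sym (*-zeroʳ c)
    sumℚ-* c f g (x ∷ xs) h = trans (cong₂ _+_ (h x) (sumℚ-* c f g xs h)) (sym (*-distribˡ-+ c (f x) _))

    Pr-fresh : ∀ m g → Pr (replicate m fresh) g ≡ sumℚ (map (λ s → if g s then weight p s else 0ℚ) (allBits m))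
    Pr-fresh zero g with g []
    ... | true  = refl
    ... | false = refl
    Pr-fresh (suc m) g = begin
      p * Pr (replicate m fresh) (g ∘ (true ∷_)) + (1ℚ - p) * Pr (replicate m fresh) (g ∘ (false ∷_))
        ≡⟨ cong₂ (λ s t → p * s + (1ℚ - p) * t) (Pr-fresh m (g ∘ (true ∷_))) (Pr-fresh m (g ∘ (false ∷_))) ⟩
      p * sumℚ (map (λ s → if g (true ∷ s) then weight p s else 0ℚ) (allBits m))
        + (1ℚ - p) * sumℚ (map (λ s → if g (false ∷ s) then weight p s else 0ℚ) (allBits m))
        ≡⟨ cong₂ _+_ (sumℚ-* p _ _ (allBits m) (λ s → scale (g (true ∷ s)) p (weight p s)))
                     (sumℚ-* (1ℚ - p) _ _ (allBits m) (λ s → scale (g (false ∷ s)) (1ℚ - p) (weight p s))) ⟨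
      sumℚ (map (λ s → if g (true ∷ s) then p * weight p s else 0ℚ) (allBits m))
        + sumℚ (map (λ s → if g (false ∷ s) then (1ℚ - p) * weight p s else 0ℚ) (allBits m))
        ≡⟨ sumℚ-pairs (λ s → if g s then weight p s else 0ℚ) (allBits m) ⟨
      sumℚ (map (λ s → if g s then weight p s else 0ℚ) (allBits (suc m))) ∎
      where
      open ≡-Reasoning
      scale : ∀ b c w → (if b then c * w else 0ℚ) ≡ c * (if b then w else 0ℚ)
      scale true  c w = refl
      scale false c w = sym (*-zeroʳ c)

    likely⇒probAtLeast : ∀ {n} (G : Graph n) {E : Rel n → Set} {r} →
      Likely (E ∘ keptAdj (edges G)) (replicate (length (edges G)) fresh) r → ProbAtLeast G p E r
    likely⇒probAtLeast G (likely g s b) = g , (λ v e → s v (T⇒≡true e)) , ≤-trans b (≤-reflexive (Pr-fresh (length (edges G)) g))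

-- The list of edges as an index set for sums

module EdgeSums where

  open FiniteSums
  open import Defs using (Graph; adj; irrefl; edges)
  open import Data.Bool using (true; false; _∧_; if_then_else_)
  open import Data.Empty using (⊥-elim)
  open import Data.Fin using (Fin; toℕ)
  open import Data.Fin.Properties using (toℕ-injective)
  open import Data.List using (List; []; _∷_; map; concatMap; allFin; lookup)
  open import Data.List.Membership.Propositional using (_∈_; lose)
  open import Data.List.Membership.Propositional.Properties using (∈-allFin)
  open import Data.List.Properties using (map-++)
  open import Data.List.Relation.Unary.Any using (index) renaming (here to first)
  open import Data.List.Relation.Unary.Any.Properties using (concatMap⁺; lookup-index)
  open import Data.Nat using (ℕ; _+_; _*_; _≤_; _<_; z≤n; _<ᵇ_)
  open import Data.Nat.ListAction using (sum)
  open import Data.Nat.ListAction.Properties using (sum-++)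
  open import Data.Nat.Properties hiding (_≟_)
  open import Data.Product using (∃-syntax; _×_; _,_; proj₁; proj₂)
  open import Data.Sum using (_⊎_; inj₁; inj₂)
  open import Relation.Binary.Definitions using (tri<; tri≈; tri>)
  open import Relation.Binary.PropositionalEquality using (_≡_; refl; sym; trans; cong; module ≡-Reasoning)

  edge-index-< : ∀ {n} (G : Graph n) u v → adj G u v ≡ true → toℕ u < toℕ v → ∃[ i ] lookup (edges G) i ≡ (u , v)
  edge-index-< {n} G u v uv u<v = index found , sym (lookup-index found)
    where
    cell : (u , v) ∈ (if (toℕ u <ᵇ toℕ v) ∧ adj G u v then (u , v) ∷ [] else [])
    cell rewrite T⇒≡true (<⇒<ᵇ u<v) | uv = first refl
    found : (u , v) ∈ edges G
    found = concatMap⁺ _ (lose (∈-allFin u) (concatMap⁺ _ (lose (∈-allFin v) cell)))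

  edge-index : ∀ {n} (G : Graph n) u v → adj G u v ≡ true →
    ∃[ i ] (lookup (edges G) i ≡ (u , v) ⊎ lookup (edges G) i ≡ (v , u))
  edge-index G u v uv with <-cmp (toℕ u) (toℕ v)
  ... | tri< u<v _ _ = let (i , e) = edge-index-< G u v uv u<v in i , inj₁ e
  ... | tri> _ _ v<u = let (i , e) = edge-index-< G v u (trans (Graph.sym G v u) uv) v<u in i , inj₂ e
  ... | tri≈ _ u≡v _ with toℕ-injective u≡v
  ...   | refl = ⊥-elim (true≢false uv (irrefl G u))

  sum-concatMap : ∀ {A B : Set} (h : B → ℕ) (f : A → List B) xs →
    sum (map h (concatMap f xs)) ≡ sum (map (λ x → sum (map h (f x))) xs)
  sum-concatMap h f []       = refl
  sum-concatMap h f (x ∷ xs) = trans (cong sum (map-++ h (f x) (concatMap f xs)))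
    (trans (sum-++ (map h (f x)) (map h (concatMap f xs))) (cong (sum (map h (f x)) +_) (sum-concatMap h f xs)))

  ∑-lookup : ∀ {A : Set} (h : A → ℕ) (xs : List A) → ∑ (λ i → h (lookup xs i)) ≡ sum (map h xs)
  ∑-lookup h []       = refl
  ∑-lookup h (x ∷ xs) = cong (h x +_) (∑-lookup h xs)

  ∑-edges : ∀ {n} (G : Graph n) (h : Fin n → Fin n → ℕ) →
    ∑ (λ i → h (proj₁ (lookup (edges G) i)) (proj₂ (lookup (edges G) i)))
      ≡ ∑ (λ u → ∑ (λ v → ι ((toℕ u <ᵇ toℕ v) ∧ adj G u v) * h u v))
  ∑-edges {n} G h = begin
    ∑ (λ i → h′ (lookup (edges G) i))                              ≡⟨ ∑-lookup h′ (edges G) ⟩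
    sum (map h′ (edges G))                                         ≡⟨ sum-concatMap h′ row (allFin n) ⟩
    sum (map (λ u → sum (map h′ (row u))) (allFin n))              ≡⟨ sum-allFin n (λ u → sum (map h′ (row u))) ⟩
    ∑ (λ u → sum (map h′ (row u)))                                 ≡⟨ ∑-cong (λ u → trans (sum-concatMap h′ (cell u) (allFin n)) (trans (sum-allFin n (λ v → sum (map h′ (cell u v)))) (∑-cong (single u)))) ⟩
    ∑ (λ u → ∑ (λ v → ι ((toℕ u <ᵇ toℕ v) ∧ adj G u v) * h u v))  ∎
    where
    open ≡-Reasoning
    h′ : Fin n × Fin n → ℕ
    h′ e = h (proj₁ e) (proj₂ e)
    cell : Fin n → Fin n → List (Fin n × Fin n)
    cell u v = if (toℕ u <ᵇ toℕ v) ∧ adj G u v then (u , v) ∷ [] else []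
    row : Fin n → List (Fin n × Fin n)
    row u = concatMap (cell u) (allFin n)
    single : ∀ u v → sum (map h′ (cell u v)) ≡ ι ((toℕ u <ᵇ toℕ v) ∧ adj G u v) * h u v
    single u v with (toℕ u <ᵇ toℕ v) ∧ adj G u v
    ... | true  = refl
    ... | false = refl

  ∑-symmetric-≤ : ∀ {n} (G : Graph n) (h : Fin n → Fin n → ℕ) → (∀ u v → h u v ≡ h v u) →
    ∑ (λ u → ∑ (λ v → ι (adj G u v) * h u v))
      ≤ 2 * ∑ (λ i → h (proj₁ (lookup (edges G) i)) (proj₂ (lookup (edges G) i)))
  ∑-symmetric-≤ {n} G h h-sym = begin
    ∑ (λ u → ∑ (λ v → ι (adj G u v) * h u v))                      ≤⟨ ∑-mono (λ u → ∑-mono (λ v → split u v)) ⟩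
    ∑ (λ u → ∑ (λ v → f u v + f v u))                              ≡⟨ ∑-cong (λ u → ∑-+ (f u) (λ v → f v u)) ⟩
    ∑ (λ u → ∑ (f u) + ∑ (λ v → f v u))                            ≡⟨ ∑-+ (λ u → ∑ (f u)) (λ u → ∑ (λ v → f v u)) ⟩
    ∑ (λ u → ∑ (f u)) + ∑ (λ u → ∑ (λ v → f v u))                  ≡⟨ cong (∑ (λ u → ∑ (f u)) +_) (trans (∑-swap (λ u v → f v u)) (sym (+-identityʳ _))) ⟩
    2 * ∑ (λ u → ∑ (f u))                                          ≡⟨ cong (2 *_) (sym (∑-edges G h)) ⟩
    2 * ∑ (λ i → h (proj₁ (lookup (edges G) i)) (proj₂ (lookup (edges G) i))) ∎
    where
    open ≤-Reasoning
    f : Fin n → Fin n → ℕ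
    f u v = ι ((toℕ u <ᵇ toℕ v) ∧ adj G u v) * h u v
    split : ∀ u v → ι (adj G u v) * h u v ≤ f u v + f v u
    split u v with adj G u v in uv
    ... | false = z≤n
    ... | true rewrite trans (Graph.sym G v u) uv | h-sym v u with <-cmp (toℕ u) (toℕ v)
    ...   | tri< u<v _ _ rewrite T⇒≡true (<⇒<ᵇ u<v) = m≤m+n _ _
    ...   | tri> _ _ v<u rewrite T⇒≡true (<⇒<ᵇ v<u) = m≤n+m _ (ι ((toℕ u <ᵇ toℕ v) ∧ true) * h u v)
    ...   | tri≈ _ u≡v _ with toℕ-injective u≡v
    ...     | refl = ⊥-elim (true≢false uv (irrefl G u))

-- Second round: joining different parts

module SecondRound where

  open FiniteSums
  open Minors
  open EdgeDensity using (arcs; Simple)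
  open Forests using (fibre-sum)
  open Rationals using (ℚ-ring; _**_; linearℚ; *-monoˡ; *-monoʳ; 0≤*; 0≤**; 0≤1; 0≤½; ½≤1; 0≤+)
  open RandomEdges
  open EdgeSums
  open import Defs using (Graph; adj; edges; keptAdj; Walk; HasCliqueMinor)
  open import Data.Bool using (Bool; true; false; _∧_; _∨_; not; if_then_else_)
  open import Data.Bool.Properties using (∨-comm; ∧-comm; ∨-identityʳ)
  open import Data.Empty using (⊥-elim)
  open import Data.Fin using (Fin; toℕ)
  open import Data.Fin.Properties using (_≟_)
  open import Data.List using (List; []; _∷_; allFin; length; lookup)
  open import Data.List.Membership.Propositional using (_∈_)
  open import Data.List.Membership.Propositional.Properties using (∈-allFin)
  open import Data.List.Relation.Unary.Any using () renaming (here to first; there to later)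
  open import Data.Maybe using (Maybe; just; nothing)
  open import Data.Nat using (ℕ; suc; _+_; _*_; _≤_; _<ᵇ_)
  open import Data.Nat.Properties hiding (_≟_)
  open import Data.Nat.Tactic.RingSolver using (solve-∀)
  open import Data.Product using (∃-syntax; _×_; _,_; proj₁; proj₂)
  open import Data.Rational using (ℚ; 0ℚ; 1ℚ; ½; _-_) renaming (_+_ to _+ℚ_; _*_ to _*ℚ_; _≤_ to _≤ℚ_)
  import Data.Rational.Properties as ℚ
  open import Data.Sum as Sum using (_⊎_; inj₁; inj₂; [_,_]′)
  open import Data.Vec using (Vec; _[_]≔_) renaming (lookup to lookupⱽ)
  open import Data.Vec.Properties using (lookup∘update′)
  open import Function using (_∘_)
  open import Relation.Nullary using (yes; no)
  open import Relation.Binary.PropositionalEquality using (_≡_; _≢_; refl; sym; trans; cong; cong₂; subst; module ≡-Reasoning)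
  import Tactic.RingSolver as Solver

  connect : ∀ {n} → Rel n → Fin n → Fin n → Rel n
  connect H x y a b = H a b ∨ (((a == x) ∧ (b == y)) ∨ ((a == y) ∧ (b == x)))

  module _ {n : ℕ} {H : Rel n} {S : Fin n → Bool} (simple : Simple H S) {x y : Fin n}
    (x≢y : x ≢ y) (new : H x y ≡ false) where
    open Simple simple

    connect-new : connect H x y x y ≡ true
    connect-new = ∨-introʳ {H x y} (∨-introˡ (∧-intro (==-refl x) (==-refl y)))

    connect-view : ∀ a b → connect H x y a b ≡ true → H a b ≡ true ⊎ (a ≡ x × b ≡ y) ⊎ (a ≡ y × b ≡ x)
    connect-view a b e with ∨-elim {H a b} e
    ... | inj₁ h = inj₁ h
    ... | inj₂ h with ∨-elim {(a == x) ∧ (b == y)} h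
    ...   | inj₁ h′ = let (p , q) = ∧-elim {a == x} h′ in inj₂ (inj₁ (==⇒≡ p , ==⇒≡ q))
    ...   | inj₂ h′ = let (p , q) = ∧-elim {a == y} h′ in inj₂ (inj₂ (==⇒≡ p , ==⇒≡ q))

    connect-simple : S x ≡ true → S y ≡ true → Simple (connect H x y) S
    connect-simple Sx Sy = record { symmetric = symm ; irreflexive = irr ; supported = supp }
      where
      symm : ∀ a b → connect H x y a b ≡ connect H x y b a
      symm a b = cong₂ _∨_ (symmetric a b) (trans (∨-comm ((a == x) ∧ (b == y)) _) (cong₂ _∨_ (∧-comm (a == y) _) (∧-comm (a == x) _)))
      irr : ∀ a → connect H x y a a ≡ false
      irr a = ¬true⇒false (λ e → [ (λ h → true≢false h (irreflexive a))
        , [ (λ { (p , q) → x≢y (trans (sym p) q) }) , (λ { (p , q) → x≢y (trans (sym q) p) }) ]′ ]′ (connect-view a a e))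
      supp : ∀ a b → connect H x y a b ≡ true → S a ≡ true
      supp a b e with connect-view a b e
      ... | inj₁ h                   = supported a b h
      ... | inj₂ (inj₁ (refl , _))   = Sx
      ... | inj₂ (inj₂ (refl , _))   = Sy

    arcs-connect : arcs (connect H x y) ≡ 2 + arcs H
    arcs-connect = begin
      ∑ (λ a → ∑ (λ b → ι (connect H x y a b)))
        ≡⟨ ∑-cong (λ a → ∑-cong (pointwise a)) ⟩
      ∑ (λ a → ∑ (λ b → ι (a == x) * ι (b == y) + (ι (a == y) * ι (b == x) + ι (H a b))))
        ≡⟨ ∑-cong inner ⟩
      ∑ (λ a → ι (a == x) * 1 + (ι (a == y) * 1 + # (H a)))
        ≡⟨ trans (∑-+ (λ a → ι (a == x) * 1) (λ a → ι (a == y) * 1 + # (H a)))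
             (cong₂ _+_ (∑-δ x (λ _ → 1)) (trans (∑-+ (λ a → ι (a == y) * 1) (λ a → # (H a))) (cong (_+ arcs H) (∑-δ y (λ _ → 1))))) ⟩
      2 + arcs H ∎
      where
      open ≡-Reasoning
      inner : ∀ a → ∑ (λ b → ι (a == x) * ι (b == y) + (ι (a == y) * ι (b == x) + ι (H a b))) ≡ ι (a == x) * 1 + (ι (a == y) * 1 + # (H a))
      inner a = trans (∑-+ (λ b → ι (a == x) * ι (b == y)) (λ b → ι (a == y) * ι (b == x) + ι (H a b)))
        (cong₂ _+_ (trans (∑-* (ι (a == x)) (λ b → ι (b == y))) (cong (ι (a == x) *_) (#-single y)))
          (trans (∑-+ (λ b → ι (a == y) * ι (b == x)) (λ b → ι (H a b)))
            (cong (_+ # (H a)) (trans (∑-* (ι (a == y)) (λ b → ι (b == x))) (cong (ι (a == y) *_) (#-single x))))))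
      pointwise : ∀ a b → ι (connect H x y a b) ≡ ι (a == x) * ι (b == y) + (ι (a == y) * ι (b == x) + ι (H a b))
      pointwise a b with a ≟ x | b ≟ y
      ... | yes refl | yes refl rewrite new | ≢⇒== x≢y = refl
      ... | yes refl | no _ rewrite ≢⇒== x≢y = cong ι (∨-identityʳ (H x b))
      ... | no _ | _ with a ≟ y | b ≟ x
      ...   | yes refl | yes refl rewrite trans (symmetric y x) new = refl
      ...   | yes refl | no _ = cong ι (∨-identityʳ (H y b))
      ...   | no _ | _ = cong ι (∨-identityʳ (H a b))

  -- The statuses that the first round can leave behind.
  data Ready : Status → Set where
    fresh   : Ready fresh
    failed  : Ready failed
    present : Ready present

  joins : ∀ {n} → (Fin n → Bool) → (Fin n → Fin n) → Fin n → Fin n → Bool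
  joins P rep u v = (P u ∧ P v) ∧ not (rep u == rep v)

  hit : ∀ {n} → (Fin n → Bool) → (Fin n → Fin n) → Rel n → Fin n → Fin n → Bool
  hit P rep H u v = P u ∧ (P v ∧ H (rep u) (rep v))

  -- An ordered pair of joined parts accounts for at most `b * b` edges. This bounds the edges that
  -- are never asked because their pair has been joined already.
  hit-count : ∀ {n} (G : Graph n) P rep H b → (∀ x → # (λ v → P v ∧ (rep v == x)) ≤ b) →
    # (λ i → hit P rep H (proj₁ (lookup (edges G) i)) (proj₂ (lookup (edges G) i))) ≤ arcs H * (b * b)
  hit-count {n} G P rep H b size≤b = begin
    # (λ i → hit P rep H (proj₁ (lookup (edges G) i)) (proj₂ (lookup (edges G) i)))  ≡⟨ ∑-edges G (λ u v → ι (hit P rep H u v)) ⟩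
    ∑ (λ u → ∑ (λ v → ι ((toℕ u <ᵇ toℕ v) ∧ adj G u v) * ι (hit P rep H u v)))
      ≤⟨ ∑-mono (λ u → ∑-mono (λ v → ≤-trans (*-monoˡ-≤ (ι (hit P rep H u v)) (ι≤1 ((toℕ u <ᵇ toℕ v) ∧ adj G u v))) (≤-reflexive (+-identityʳ _)))) ⟩
    ∑ (λ u → ∑ (λ v → ι (hit P rep H u v)))                      ≡⟨ ∑-cong (λ u → trans (∑-cong (factor u)) (∑-* (ι (P u)) (λ v → ι (P v) * ι (H (rep u) (rep v))))) ⟩
    ∑ (λ u → ι (P u) * ∑ (λ v → ι (P v) * ι (H (rep u) (rep v))))  ≤⟨ ∑-mono (λ u → *-monoʳ-≤ (ι (P u)) (fibres (ι ∘ H (rep u)))) ⟩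
    ∑ (λ u → ι (P u) * (# (H (rep u)) * b))                      ≤⟨ fibres (λ x → # (H x) * b) ⟩
    ∑ (λ x → # (H x) * b) * b                                    ≡⟨ trans (cong (_* b) (∑-*ʳ (λ x → # (H x)) b)) (*-assoc (arcs H) b b) ⟩
    arcs H * (b * b)                                             ∎
    where
    open ≤-Reasoning
    factor : ∀ u v → ι (hit P rep H u v) ≡ ι (P u) * (ι (P v) * ι (H (rep u) (rep v)))
    factor u v = trans (ι-∧ (P u) _) (cong (ι (P u) *_) (ι-∧ (P v) _))
    fibres : ∀ (g : Fin n → ℕ) → ∑ (λ v → ι (P v) * g (rep v)) ≤ ∑ g * b
    fibres g = begin
      ∑ (λ v → ι (P v) * g (rep v))                        ≡⟨ fibre-sum P rep g ⟨
      ∑ (λ x → g x * # (λ v → P v ∧ (rep v == x)))         ≤⟨ ∑-mono (λ x → *-monoʳ-≤ (g x) (size≤b x)) ⟩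
      ∑ (λ x → g x * b)                                    ≡⟨ ∑-*ʳ g b ⟩
      ∑ g * b                                              ∎

  -- Second round: the edges between different parts are queried until each pair of parts
  -- is either joined or has been queried completely.
  module Sprinkling (p p₁ p₂ : ℚ) (0≤p₁ : 0ℚ ≤ℚ p₁) (p₁≤1 : p₁ ≤ℚ 1ℚ) (0≤p₂ : 0ℚ ≤ℚ p₂) (p₂≤1 : p₂ ≤ℚ 1ℚ)
    (p-split : p ≡ p₁ +ℚ (1ℚ - p₁) *ℚ p₂)
    {n : ℕ} (G : Graph n) (Evt : Vec Bool (length (edges G)) → Set) (t : ℕ)
    (win : ∀ s → HasCliqueMinor (keptAdj (edges G) s) t → Evt s)
    (q₀ : Vec Status (length (edges G))) (ready₀ : ∀ i → Ready (lookupⱽ q₀ i))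
    (P : Fin n → Bool) (rep : Fin n → Fin n) (S : Fin n → Bool)
    (rep-P : ∀ v → P v ≡ true → P (rep v) ≡ true)
    (idempotent : ∀ v → P v ≡ true → rep (rep v) ≡ rep v)
    (reach : ∀ v → P v ≡ true → Walk (keptAdj (edges G) (known q₀)) (λ w → P w ≡ true × rep w ≡ rep v) (rep v) v)
    (rep-S : ∀ v → P v ≡ true → S (rep v) ≡ true)
    (S-rep : ∀ x → S x ≡ true → ∃[ v ] (P v ≡ true × rep v ≡ x))
    (b : ℕ) (size≤b : ∀ x → # (λ v → P v ∧ (rep v == x)) ≤ b)
    (η : ℚ) (0≤η : 0ℚ ≤ℚ η) (enough : Rel n → Set)
    (build : ∀ H → Simple H S → enough H → CliqueModel H S t)
    (verdict : ∀ H Y Q → arcs H ≡ 2 * Y →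
      # (λ i → joins P rep (proj₁ (lookup (edges G) i)) (proj₂ (lookup (edges G) i))) ≤ Q + arcs H * (b * b) →
      1ℚ ≤ℚ η *ℚ (½ ** Y *ℚ (1ℚ +ℚ p₂ *ℚ ½) ** Q) ⊎ enough H) where

    open Percolation p p₁ p₂ 0≤p₁ p₁≤1 0≤p₂ p₂≤1 p-split

    private
      es : List (Fin n × Fin n)
      es = edges G

      end₁ end₂ : Fin (length es) → Fin n
      end₁ i = proj₁ (lookup es i)
      end₂ i = proj₂ (lookup es i)

      joins? : Fin (length es) → Bool
      joins? i = joins P rep (end₁ i) (end₂ i)

      hit? : Rel n → Fin (length es) → Bool
      hit? H i = hit P rep H (end₁ i) (end₂ i)

      Known : Vec Status (length es) → Rel n
      Known q = keptAdj es (known q)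

    record State (q : Vec Status (length es)) (H : Rel n) (asked : Fin (length es) → Bool) (Y Q : ℕ)
      (rem : List (Fin (length es))) : Set where
      field
        grows    : ∀ u v → Known q₀ u v ≡ true → Known q u v ≡ true
        simple   : Simple H S
        count    : arcs H ≡ 2 * Y
        realised : ∀ x y → H x y ≡ true → ∃[ u ] ∃[ v ] (P u ≡ true × rep u ≡ x × P v ≡ true × rep v ≡ y × Known q u v ≡ true)
        ready    : ∀ i → asked i ≡ false → Ready (lookupⱽ q i)
        asked≡Q  : # asked ≡ Q
        -- Every edge is still to be visited, does not join two parts, has been asked, or belongs to
        -- a joined pair. With `rem` empty, the last two cases bound the number of joining edges by
        -- queries plus `hit-count`.
        progress : ∀ i → i ∈ rem ⊎ (joins? i ≡ true → asked i ≡ true ⊎ hit? H i ≡ true)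

    start : State q₀ (λ _ _ → false) (λ _ → false) 0 0 (allFin (length es))
    start = record
      { grows = λ _ _ e → e
      ; simple = record { symmetric = λ _ _ → refl ; irreflexive = λ _ → refl ; supported = λ _ _ () }
      ; count = trans (∑-cong {n} (λ _ → #-false n)) (∑-0 n)
      ; realised = λ _ _ () ; ready = λ i _ → ready₀ i ; asked≡Q = #-false (length es)
      ; progress = λ i → inj₁ (∈-allFin i) }

    finish : ∀ {q H asked Y Q} → State q H asked Y Q [] →
      Likely Evt q (1ℚ - η *ℚ (½ ** Y *ℚ (1ℚ +ℚ p₂ *ℚ ½) ** Q))
    finish {q} {H} {asked} {Y} {Q} σ = [ likely-exhausted 1ℚ _ ℚ.≤-refl , conclude ]′ (verdict H Y Q count bound)
      where
      open State σ
      bound : # joins? ≤ Q + arcs H * (b * b)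
      bound = begin
        # joins?                              ≤⟨ #-mono {P = joins?} {λ i → asked i ∨ hit? H i} covered ⟩
        # (λ i → asked i ∨ hit? H i)          ≤⟨ #-∨ asked (hit? H) ⟩
        # asked + # (hit? H)                  ≤⟨ +-mono-≤ (≤-reflexive asked≡Q) (hit-count G P rep H b size≤b) ⟩
        Q + arcs H * (b * b)                  ∎
        where
        open ≤-Reasoning
        covered : ∀ i → joins? i ≡ true → asked i ∨ hit? H i ≡ true
        covered i e = [ (λ ()) , (λ h → [ ∨-introˡ , ∨-introʳ {asked i} ]′ (h e)) ]′ (progress i)
      part : Fin n → Maybe (Fin n)
      part v = if P v then just (rep v) else nothing
      part-intro : ∀ {v x} → P v ≡ true → rep v ≡ x → part v ≡ just x
      part-intro e refl rewrite e = refl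
      part-elim : ∀ {v x} → part v ≡ just x → P v ≡ true × rep v ≡ x
      part-elim {v} e with P v
      part-elim refl | true = refl , refl
      part-elim () | false
      walk : ∀ {v x} → part v ≡ just x → Walk (Known q) (λ w → part w ≡ just x) x v
      walk {v} e with part-elim {v} e
      ... | Pv , refl = walk-map (λ {a} {c} h → ≡true⇒T (grows a c (T⇒≡true h)))
                          (λ { (Pw , r) → part-intro Pw r }) (reach v Pv)
      centre : ∀ {v x} → part v ≡ just x → part x ≡ just x
      centre {v} e with part-elim {v} e
      ... | Pv , refl = part-intro (rep-P v Pv) (idempotent v Pv)
      model : MinorModel (Known q) (λ _ → true) H S
      model = record
        { part = part ; inside = λ _ → refl
        ; nonempty = λ x Sx → let (v , Pv , r) = S-rep x Sx in v , part-intro Pv r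
        ; connected = λ x u v _ eu ev → walk-reverse (kept-sym es (known q)) (centre {u} eu) (walk {u} eu) ++ʷ walk {v} ev
        ; edge = λ x y e → let (u , v , Pu , ru , Pv , rv , k) = realised x y e in
            u , v , part-intro Pu ru , part-intro Pv rv , ≡true⇒T k }
      conclude : enough H → Likely Evt q (1ℚ - η *ℚ (½ ** Y *ℚ (1ℚ +ℚ p₂ *ℚ ½) ** Q))
      conclude h = likely-weaken below (likely-certain (λ s r → win s (hasCliqueMinor-mono
          (λ {u} {v} k → ≡true⇒T (kept-mono es q s r u v (T⇒≡true k)))
          (cliqueModel⇒hasCliqueMinor (minor-trans model (build H simple h))))))
        where
        below : 1ℚ - η *ℚ (½ ** Y *ℚ (1ℚ +ℚ p₂ *ℚ ½) ** Q) ≤ℚ 1ℚ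
        below = linearℚ 0ℚ ℚ.≤-refl (0≤* 0≤η (0≤* (0≤** Y 0≤½) (0≤** Q (0≤+ 0≤1 (0≤* 0≤p₂ 0≤½))))) (identity (η *ℚ (½ ** Y *ℚ (1ℚ +ℚ p₂ *ℚ ½) ** Q)))
          where
          identity : ∀ x → 1ℚ - x +ℚ x +ℚ 0ℚ ≡ 1ℚ +ℚ 0ℚ
          identity = Solver.solve-∀ ℚ-ring

    module Visit {q : Vec Status (length es)} {H : Rel n} {asked : Fin (length es) → Bool} {Y Q : ℕ}
      {i : Fin (length es)} {rem : List (Fin (length es))} (σ : State q H asked Y Q (i ∷ rem)) where
      open State σ

      later-progress : ∀ (asked′ : Fin (length es) → Bool) (H′ : Rel n) → (∀ j → asked j ≡ true → asked′ j ≡ true) → (∀ j → hit? H j ≡ true → hit? H′ j ≡ true) →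
        (joins? i ≡ true → asked′ i ≡ true ⊎ hit? H′ i ≡ true) →
        ∀ j → j ∈ rem ⊎ (joins? j ≡ true → asked′ j ≡ true ⊎ hit? H′ j ≡ true)
      later-progress asked′ H′ f g h j with progress j
      ... | inj₁ (first refl) = inj₂ h
      ... | inj₁ (later j∈)   = inj₁ j∈
      ... | inj₂ k            = inj₂ (λ e → Sum.map (f j) (g j) (k e))

      skip : (joins? i ≡ true → asked i ≡ true ⊎ hit? H i ≡ true) → State q H asked Y Q rem
      skip h = record { grows = grows ; simple = simple ; count = count ; realised = realised ; ready = ready
                      ; asked≡Q = asked≡Q ; progress = later-progress asked H (λ _ e → e) (λ _ e → e) h }

      module _ (ji : joins? i ≡ true) (ai : asked i ≡ false) (hi : hit? H i ≡ false) where
        private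
          u v x y : Fin n
          u = end₁ i
          v = end₂ i
          x = rep u
          y = rep v

          Pu : P u ≡ true
          Pu = proj₁ (∧-elim {P u} (proj₁ (∧-elim {P u ∧ P v} ji)))

          Pv : P v ≡ true
          Pv = proj₂ (∧-elim {P u} (proj₁ (∧-elim {P u ∧ P v} ji)))

          x≢y : x ≢ y
          x≢y e = true≢false (trans (cong (x ==_) (sym e)) (==-refl x)) (not-elim (proj₂ (∧-elim {P u ∧ P v} ji)))

          new : H x y ≡ false
          new = ¬true⇒false (λ e → true≢false (∧-intro Pu (∧-intro Pv e)) hi)

          asked′ : Fin (length es) → Bool
          asked′ j = asked j ∨ (j == i)

          asked′≡ : # asked′ ≡ suc Q
          asked′≡ = trans (#-insert {P = asked} {asked′} i ai (∨-introʳ {asked i} (==-refl i)) same) (cong suc asked≡Q)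
            where
            same : ∀ j → j ≢ i → asked′ j ≡ asked j
            same j j≢i rewrite ≢⇒== j≢i = ∨-identityʳ (asked j)

          ready′ : ∀ z j → asked′ j ≡ false → Ready (lookupⱽ (q [ i ]≔ z) j)
          ready′ z j e = subst Ready (sym (lookup∘update′ j≢i q z)) (ready j (∨-false e))
            where
            ∨-false : ∀ {a c} → a ∨ c ≡ false → a ≡ false
            ∨-false {false} _ = refl
            j≢i : j ≢ i
            j≢i refl = true≢false (∨-introʳ {asked i} (==-refl i)) e

        miss : ∀ z → isPresent (lookupⱽ q i) ≡ false → State (q [ i ]≔ z) H asked′ Y (suc Q) rem
        miss z not-yet = record
          { grows = λ a c e → kept-update es q i z not-yet a c (grows a c e)
          ; simple = simple ; count = count
          ; realised = λ a c e → let (u , v , Pu , ru , Pv , rv , k) = realised a c e in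
              u , v , Pu , ru , Pv , rv , kept-update es q i z not-yet u v k
          ; ready = ready′ z ; asked≡Q = asked′≡
          ; progress = later-progress asked′ H (λ _ → ∨-introˡ) (λ _ e → e) (λ _ → inj₁ (∨-introʳ {asked i} (==-refl i))) }

        private
          module Hit {q′ : Vec Status (length es)} {asked″ : Fin (length es) → Bool} {Q′ : ℕ}
            (mono : ∀ a c → Known q a c ≡ true → Known q′ a c ≡ true) (now : Known q′ u v ≡ true)
            (ready″ : ∀ j → asked″ j ≡ false → Ready (lookupⱽ q′ j)) (asked″≡ : # asked″ ≡ Q′)
            (more : ∀ j → asked j ≡ true → asked″ j ≡ true) where

            real : ∀ a c → connect H x y a c ≡ true →
              ∃[ u ] ∃[ v ] (P u ≡ true × rep u ≡ a × P v ≡ true × rep v ≡ c × Known q′ u v ≡ true)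
            real a c e with connect-view simple x≢y new a c e
            ... | inj₁ h = let (u , v , Pu , ru , Pv , rv , k) = realised a c h in u , v , Pu , ru , Pv , rv , mono u v k
            ... | inj₂ (inj₁ (refl , refl)) = u , v , Pu , refl , Pv , refl , now
            ... | inj₂ (inj₂ (refl , refl)) = v , u , Pv , refl , Pu , refl , trans (kept-sym es (known q′) v u) now

            hit-more : ∀ j → hit? H j ≡ true → hit? (connect H x y) j ≡ true
            hit-more j e = let (e₁ , e₂) = ∧-elim {P (end₁ j)} e ; (e₃ , e₄) = ∧-elim {P (end₂ j)} e₂ in
              ∧-intro e₁ (∧-intro e₃ (∨-introˡ e₄))

            next : State q′ (connect H x y) asked″ (suc Y) Q′ rem
            next = record
              { grows = λ a c e → mono a c (grows a c e)
              ; simple = connect-simple simple x≢y new (rep-S u Pu) (rep-S v Pv)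
              ; count = trans (arcs-connect simple x≢y new) (trans (cong (2 +_) count) (sym (*-suc 2 Y)))
              ; realised = real ; ready = ready″ ; asked≡Q = asked″≡
              ; progress = later-progress asked″ (connect H x y) more hit-more (λ _ → inj₂ (∧-intro Pu (∧-intro Pv (connect-new simple x≢y new)))) }

        success : isPresent (lookupⱽ q i) ≡ false → State (q [ i ]≔ present) (connect H x y) asked′ (suc Y) (suc Q) rem
        success not-yet = Hit.next (λ a c → kept-update es q i present not-yet a c) (kept-present es q i refl)
          (ready′ present) asked′≡ (λ _ → ∨-introˡ)

        already : lookupⱽ q i ≡ present → State q (connect H x y) asked (suc Y) Q rem
        already e = Hit.next (λ _ _ k → k) (kept-lookup es q i refl e) ready asked≡Q (λ _ k → k)

    Goal : Vec Status (length es) → ℕ → ℕ → Set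
    Goal q Y Q = Likely Evt q (1ℚ - η *ℚ (½ ** Y *ℚ (1ℚ +ℚ p₂ *ℚ ½) ** Q))

    private
      -- For an edge already present from the first round: it joins its pair without a query, and a
      -- success can only lower the potential, so the claim for `suc Y` is the stronger one.
      cheaper : ∀ q Y Q → Goal q (suc Y) Q → Goal q Y Q
      cheaper q Y Q = likely-weaken (linearℚ 0ℚ ℚ.≤-refl (*-monoˡ 0≤η smaller)
        (identity (η *ℚ (½ ** suc Y *ℚ (1ℚ +ℚ p₂ *ℚ ½) ** Q)) (η *ℚ (½ ** Y *ℚ (1ℚ +ℚ p₂ *ℚ ½) ** Q))))
        where
        smaller : ½ ** suc Y *ℚ (1ℚ +ℚ p₂ *ℚ ½) ** Q ≤ℚ ½ ** Y *ℚ (1ℚ +ℚ p₂ *ℚ ½) ** Q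
        smaller = *-monoʳ (0≤** Q (0≤+ 0≤1 (0≤* 0≤p₂ 0≤½)))
          (ℚ.≤-trans (*-monoʳ (0≤** Y 0≤½) ½≤1) (ℚ.≤-reflexive (ℚ.*-identityˡ (½ ** Y))))
        identity : ∀ x y → 1ℚ - y +ℚ y +ℚ 0ℚ ≡ 1ℚ - x +ℚ x
        identity = Solver.solve-∀ ℚ-ring

    explore : ∀ rem {q H asked Y Q} → State q H asked Y Q rem → Goal q Y Q
    explore [] σ = finish σ
    explore (i ∷ rem) {q} {H} {asked} {Y} {Q} σ =
      decide (dec-true (joins? i)) (dec-true (asked i)) (dec-true (hit? H i))
      where
      open Visit σ
      open State σ using (ready)
      ask : ∀ {x} → joins? i ≡ true → asked i ≡ false → hit? H i ≡ false → lookupⱽ q i ≡ x → Ready x → Goal q Y Q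
      ask ji ai hi e fresh = likely-potential 1ℚ η ½ Y Q 0≤η 0≤½ ½≤1 only e
        (explore rem (success ji ai hi (cong isPresent e))) (explore rem (miss ji ai hi spare (cong isPresent e)))
      ask ji ai hi e failed = likely-potential 1ℚ η ½ Y Q 0≤η 0≤½ ½≤1 second e
        (explore rem (success ji ai hi (cong isPresent e))) (explore rem (miss ji ai hi absent (cong isPresent e)))
      ask ji ai hi e present = cheaper q Y Q (explore rem (already ji ai hi e))
      decide : joins? i ≡ true ⊎ joins? i ≡ false → asked i ≡ true ⊎ asked i ≡ false →
        hit? H i ≡ true ⊎ hit? H i ≡ false → Goal q Y Q
      decide (inj₂ e) _ _ = explore rem (skip (λ e′ → ⊥-elim (true≢false e′ e)))
      decide (inj₁ _) (inj₁ e) _ = explore rem (skip (λ _ → inj₁ e))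
      decide (inj₁ _) (inj₂ _) (inj₁ e) = explore rem (skip (λ _ → inj₂ e))
      decide (inj₁ ji) (inj₂ ai) (inj₂ hi) = ask ji ai hi refl (ready i ai)

    sprinkle : Likely Evt q₀ (1ℚ - η)
    sprinkle = likely-weaken (ℚ.≤-reflexive (cong (λ x → 1ℚ - x) (sym (ℚ.*-identityʳ η)))) (explore (allFin (length es)) start)

-- First round: exploration of the forest

module FirstRound where

  open FiniteSums
  open Minors using (Rel)
  open Forests using (Arcs; spanned; children; Forest; forest-map)
  open Rationals using (_**_)
  open RandomEdges
  open EdgeSums using (edge-index)
  open SecondRound using (Ready; fresh; failed; present)
  open import Defs using (Graph; adj; edges; keptAdj)
  open import Data.Bool using (Bool; true; false; _∧_; not; T; if_then_else_) renaming (_≟_ to _≟ᵇ_)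
  open import Data.Empty using (⊥-elim)
  open import Data.Fin using (Fin)
  open import Data.Fin.Properties using (_≟_)
  open import Data.List using (List; []; _∷_; map; filter; allFin; length; lookup)
  open import Data.List.Membership.Propositional using (_∈_)
  open import Data.List.Membership.Propositional.Properties using (∈-filter⁻)
  open import Data.List.Relation.Unary.All as All using (All)
  open import Data.List.Relation.Unary.AllPairs using (_∷_)
  open import Data.List.Relation.Unary.Any using () renaming (here to first; there to later)
  open import Data.List.Relation.Unary.Unique.Propositional using (Unique)
  open import Data.List.Relation.Unary.Unique.Propositional.Properties using (filter⁺; allFin⁺)
  open import Data.Nat using (ℕ; zero; suc; _+_; _*_; _≤_; z≤n; s≤s⁻¹)
  open import Data.Nat.ListAction using (sum)
  open import Data.Nat.Properties hiding (_≟_)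
  open import Data.Nat.Tactic.RingSolver using (solve-∀)
  open import Data.Product using (_×_; _,_; proj₁; proj₂)
  open import Data.Rational using (ℚ; 0ℚ; 1ℚ; _-_) renaming (_+_ to _+ℚ_; _*_ to _*ℚ_; _≤_ to _≤ℚ_)
  open import Data.Sum as Sum using (_⊎_; inj₁; inj₂; [_,_]′)
  open import Data.Vec using (Vec; _[_]≔_) renaming (lookup to lookupⱽ)
  open import Data.Vec.Properties using (lookup∘update; lookup∘update′)
  open import Function using (_∘_)
  open import Relation.Nullary using (¬_; yes; no)
  open import Relation.Binary.PropositionalEquality using (_≡_; _≢_; refl; sym; trans; cong; subst)

  elements : ∀ {n} → (Fin n → Bool) → List (Fin n)
  elements {n} P = filter (λ v → P v ≟ᵇ true) (allFin n)

  length-elements : ∀ {n} (P : Fin n → Bool) → length (elements P) ≡ # P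
  length-elements {n} P = trans (go (allFin n)) (sum-allFin n (ι ∘ P))
    where
    go : ∀ xs → length (filter (λ v → P v ≟ᵇ true) xs) ≡ sum (map (ι ∘ P) xs)
    go []       = refl
    go (x ∷ xs) with P x
    ... | true  = cong suc (go xs)
    ... | false = go xs

  data Label : Set where
    out active done saturated : Label

  discovered isActive isDone isSaturated pending : Label → Bool
  discovered out = false
  discovered _   = true
  isActive active = true
  isActive _      = false
  isDone done = true
  isDone _    = false
  isSaturated saturated = true
  isSaturated _         = false
  pending out    = true
  pending active = true
  pending _      = false

  relabel : ∀ {n} → Fin n → Label → (Fin n → Label) → Fin n → Label
  relabel v ℓ lab u = if u == v then ℓ else lab u

  module _ {n : ℕ} {lab : Fin n → Label} {v : Fin n} {ℓ : Label} where

    relabel-new : relabel v ℓ lab v ≡ ℓ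
    relabel-new rewrite ==-refl v = refl

    relabel-old : ∀ {u} → u ≢ v → relabel v ℓ lab u ≡ lab u
    relabel-old u≢v rewrite ≢⇒== u≢v = refl

    relabel-same : ∀ (F : Label → Bool) → F ℓ ≡ F (lab v) → ∀ u → F (relabel v ℓ lab u) ≡ F (lab u)
    relabel-same F e u with u ≟ v
    ... | yes refl = e
    ... | no _     = refl

    relabel-insert : ∀ (F : Label → Bool) → F (lab v) ≡ false → F ℓ ≡ true →
      # (F ∘ relabel v ℓ lab) ≡ suc (# (F ∘ lab))
    relabel-insert F e e′ = #-insert v e (trans (cong F relabel-new) e′) (λ u u≢v → cong F (relabel-old u≢v))

    relabel-delete : ∀ (F : Label → Bool) → F (lab v) ≡ true → F ℓ ≡ false →
      # (F ∘ lab) ≡ suc (# (F ∘ relabel v ℓ lab))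
    relabel-delete F e e′ = #-insert v (trans (cong F relabel-new) e′) e (λ u u≢v → sym (cong F (relabel-old u≢v)))

  -- First round: a forest with the given roots is explored. An active vertex with at least
  -- σ discovered neighbours becomes saturated; otherwise its edges to undiscovered vertices
  -- are queried until it has C children or all of them have been queried.
  module Exploration (p p₁ p₂ : ℚ) (0≤p₁ : 0ℚ ≤ℚ p₁) (p₁≤1 : p₁ ≤ℚ 1ℚ) (0≤p₂ : 0ℚ ≤ℚ p₂) (p₂≤1 : p₂ ≤ℚ 1ℚ)
    (p-split : p ≡ p₁ +ℚ (1ℚ - p₁) *ℚ p₂)
    {n : ℕ} (G : Graph n) (Evt : Vec Bool (length (edges G)) → Set) (roots : Fin n → Bool)
    (σ L C : ℕ) (degree : ∀ u → σ + L ≤ # (adj G u))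
    (c η z : ℚ) (0≤η : 0ℚ ≤ℚ η) (0≤z : 0ℚ ≤ℚ z) (z≤1 : z ≤ℚ 1ℚ) where

    open Percolation p p₁ p₂ 0≤p₁ p₁≤1 0≤p₂ p₂≤1 p-split

    private
      es : List (Fin n × Fin n)
      es = edges G

      end₁ end₂ : Fin (length es) → Fin n
      end₁ i = proj₁ (lookup es i)
      end₂ i = proj₂ (lookup es i)

    Known : Vec Status (length es) → Rel n
    Known q = keptAdj es (known q)

    Goal : Vec Status (length es) → ℕ → ℕ → Set
    Goal q Y Q = Likely Evt q (c - η *ℚ (z ** Y *ℚ (1ℚ +ℚ p₁ *ℚ (1ℚ - z)) ** Q))

    -- f and g count the processed vertices with all edges queried and with C children.
    record Common (q : Vec Status (length es)) (lab : Fin n → Label) (A : Arcs n) (Y Q f g : ℕ) : Set where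
      field
        spans   : ∀ v → discovered (lab v) ≡ spanned roots A v
        forest  : Forest (λ x y → Known q x y) roots A
        satur   : ∀ v → lab v ≡ saturated → σ ≤ # (λ w → discovered (lab w) ∧ adj G v w)
        status  : ∀ i → Ready (lookupⱽ q i)
        #found  : # (discovered ∘ lab) ≡ Y + # roots
        #done   : # (isDone ∘ lab) ≡ f + g
        full    : L * f ≤ Q
        capped  : C * g ≤ Y

    record State (q : Vec Status (length es)) (lab : Fin n → Label) (A : Arcs n) (Y Q f g : ℕ) : Set where
      field
        common    : Common q lab A Y Q f g
        bounded   : ∀ v → children A v ≤ C
        childless : ∀ v → lab v ≡ active → children A v ≡ 0
        -- Queries start only from a vertex that ends as `done`, never from one that becomes
        -- `saturated`. Hence the edges from an active vertex to undiscovered ones are fresh, and no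
        -- edge is asked twice.
        untouched : ∀ i → isDone (lab (end₁ i)) ≡ false → isDone (lab (end₂ i)) ≡ false → lookupⱽ q i ≡ fresh
      open Common common public

    record Focus (v : Fin n) (ws : List (Fin n)) (r : ℕ)
      (q : Vec Status (length es)) (lab : Fin n → Label) (A : Arcs n) (Y Q f g : ℕ) : Set where
      field
        common    : Common q lab A Y Q f g
        focus     : lab v ≡ active
        bounded   : ∀ u → children A u ≤ C
        childless : ∀ u → u ≢ v → lab u ≡ active → children A u ≡ 0
        capacity  : children A v + r ≤ C
        -- `r` is the number of children that `v` may still receive and `ws` lists the neighbours
        -- still to be asked. At `r = 0` this field becomes `capped` for `suc g`; at `ws = []` the
        -- next one becomes `full` for `suc f`.
        produced  : C * g + C ≤ Y + r
        queried   : L * suc f ≤ Q + length ws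
        distinct  : Unique ws
        targets   : ∀ {w} → w ∈ ws → lab w ≡ out × adj G v w ≡ true
        untouched : ∀ i → isDone (lab (end₁ i)) ≡ false → isDone (lab (end₂ i)) ≡ false →
          (end₁ i ≡ v → end₂ i ∈ ws) → (end₂ i ≡ v → end₁ i ∈ ws) → lookupⱽ q i ≡ fresh
      open Common common public

    module Retire {q : Vec Status (length es)} {lab : Fin n → Label} {A : Arcs n} {Y Q f g : ℕ} {v : Fin n}
      (av : lab v ≡ active) (κ : Common q lab A Y Q f g) where
      open Common κ

      same-discovered : ∀ {ℓ} → discovered ℓ ≡ true → ∀ u → discovered (relabel v ℓ lab u) ≡ discovered (lab u)
      same-discovered {ℓ} e = relabel-same {lab = lab} {v} {ℓ} discovered (trans e (sym (cong discovered av)))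

      satur′ : ∀ {ℓ} → discovered ℓ ≡ true → (ℓ ≡ saturated → σ ≤ # (λ w → discovered (lab w) ∧ adj G v w)) →
        ∀ u → relabel v ℓ lab u ≡ saturated → σ ≤ # (λ w → discovered (relabel v ℓ lab w) ∧ adj G u w)
      satur′ {ℓ} e h u h′ = ≤-trans (before u h′)
        (≤-reflexive (#-cong (λ w → cong (_∧ adj G u w) (sym (same-discovered e w)))))
        where
        before : ∀ u → relabel v ℓ lab u ≡ saturated → σ ≤ # (λ w → discovered (lab w) ∧ adj G u w)
        before u h′ with u ≟ v
        ... | yes refl = h h′
        ... | no _     = satur u h′

      active-before : ∀ {ℓ u} → ℓ ≢ active → relabel v ℓ lab u ≡ active → u ≢ v × lab u ≡ active
      active-before {ℓ} {u} ℓ≢ e with u ≟ v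
      ... | yes refl = ⊥-elim (ℓ≢ e)
      ... | no u≢v   = u≢v , e

      retire : ∀ {f′ g′} → f′ + g′ ≡ suc (f + g) → L * f′ ≤ Q → C * g′ ≤ Y →
        Common q (relabel v done lab) A Y Q f′ g′
      retire e full′ capped′ = record
        { spans = λ u → trans (same-discovered refl u) (spans u) ; forest = forest ; satur = satur′ refl (λ ())
        ; status = status ; #found = trans (#-cong (same-discovered refl)) #found
        ; #done = trans (relabel-insert {lab = lab} {v} {done} isDone (cong isDone av) refl) (trans (cong suc #done) (sym e))
        ; full = full′ ; capped = capped′ }

      not-done-before : ∀ {u} → isDone (relabel v done lab u) ≡ false → u ≢ v × isDone (lab u) ≡ false
      not-done-before {u} e with u ≟ v
      not-done-before () | yes _
      ... | no u≢v = u≢v , e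

      fewer-pending : ∀ {ℓ} → pending ℓ ≡ false → # (pending ∘ lab) ≡ suc (# (pending ∘ relabel v ℓ lab))
      fewer-pending {ℓ} e = relabel-delete {lab = lab} {v} {ℓ} pending (cong pending av) e

      saturate : σ ≤ # (λ w → discovered (lab w) ∧ adj G v w) → Common q (relabel v saturated lab) A Y Q f g
      saturate h = record
        { spans = λ u → trans (same-discovered refl u) (spans u) ; forest = forest ; satur = satur′ refl (λ _ → h)
        ; status = status ; #found = trans (#-cong (same-discovered refl)) #found
        ; #done = trans (#-cong (relabel-same {lab = lab} {v} {saturated} isDone (sym (cong isDone av)))) #done
        ; full = full ; capped = capped }

    module Ask {q : Vec Status (length es)} {lab : Fin n → Label} {A : Arcs n} {Y Q f g : ℕ} {v w : Fin n}
      {ws : List (Fin n)} {r : ℕ} (φ : Focus v (w ∷ ws) (suc r) q lab A Y Q f g) where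
      open Focus φ

      w-out : lab w ≡ out
      w-out = proj₁ (targets (first refl))

      vw : adj G v w ≡ true
      vw = proj₂ (targets (first refl))

      w≢v : w ≢ v
      w≢v e = true≢false (trans (cong discovered (trans (cong lab e) focus)) refl) (cong discovered w-out)

      w∉ws : ¬ (w ∈ ws)
      w∉ws w∈ws with distinct
      ... | w≢ ∷ _ = All.lookup w≢ w∈ws refl

      distinct′ : Unique ws
      distinct′ with distinct
      ... | _ ∷ u = u

      i : Fin (length es)
      i = proj₁ (edge-index G v w vw)

      ends : (end₁ i ≡ v × end₂ i ≡ w) ⊎ (end₁ i ≡ w × end₂ i ≡ v)
      ends = Sum.map (λ e → cong proj₁ e , cong proj₂ e) (λ e → cong proj₁ e , cong proj₂ e) (proj₂ (edge-index G v w vw))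

      v-not-done : ∀ {u} → u ≡ v → isDone (lab u) ≡ false
      v-not-done e = cong isDone (trans (cong lab e) focus)

      w-not-done : ∀ {u} → u ≡ w → isDone (lab u) ≡ false
      w-not-done e = cong isDone (trans (cong lab e) w-out)

      i-fresh : lookupⱽ q i ≡ fresh
      i-fresh with ends
      ... | inj₁ (e₁ , e₂) = untouched i (v-not-done e₁) (w-not-done e₂) (λ _ → first e₂) (λ e → first (trans e₁ (trans (sym e) e₂)))
      ... | inj₂ (e₁ , e₂) = untouched i (w-not-done e₁) (v-not-done e₂) (λ e → first (trans e₂ (trans (sym e) e₁))) (λ _ → first e₁)

      i-unknown : isPresent (lookupⱽ q i) ≡ false
      i-unknown = cong isPresent i-fresh

      status′ : ∀ {x} → Ready x → ∀ j → Ready (lookupⱽ (q [ i ]≔ x) j)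
      status′ {x} rx j with j ≟ i
      ... | yes refl = subst Ready (sym (lookup∘update i q x)) rx
      ... | no j≢i   = subst Ready (sym (lookup∘update′ j≢i q x)) (status j)

      untouched′ : ∀ x j → isDone (lab (end₁ j)) ≡ false → isDone (lab (end₂ j)) ≡ false →
        (end₁ j ≡ v → end₂ j ∈ ws) → (end₂ j ≡ v → end₁ j ∈ ws) → lookupⱽ (q [ i ]≔ x) j ≡ fresh
      untouched′ x j d₁ d₂ h₁ h₂ = trans (lookup∘update′ j≢i q x) (untouched j d₁ d₂ (later ∘ h₁) (later ∘ h₂))
        where
        j≢i : j ≢ i
        j≢i refl = [ (λ { (e₁ , e₂) → w∉ws (subst (_∈ ws) e₂ (h₁ e₁)) })
                   , (λ { (e₁ , e₂) → w∉ws (subst (_∈ ws) e₁ (h₂ e₂)) }) ]′ ends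

      queried′ : L * suc f ≤ suc Q + length ws
      queried′ = ≤-trans queried (≤-reflexive (+-suc Q (length ws)))

      known′ : ∀ x {a b} → T (Known q a b) → T (Known (q [ i ]≔ x) a b)
      known′ x {a} {b} k = ≡true⇒T (kept-update es q i x i-unknown a b (T⇒≡true k))

      miss : Focus v ws (suc r) (q [ i ]≔ failed) lab A Y (suc Q) f g
      miss = record
        { common = record { spans = spans ; forest = forest-map (known′ failed) A forest ; satur = satur
            ; status = status′ failed ; #found = #found ; #done = #done ; full = ≤-trans full (n≤1+n Q) ; capped = capped }
        ; focus = focus ; bounded = bounded ; childless = childless ; capacity = capacity ; produced = produced
        ; queried = queried′ ; distinct = distinct′ ; targets = λ w∈ → targets (later w∈) ; untouched = untouched′ failed }

      lab′ : Fin n → Label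
      lab′ = relabel w active lab

      more-discovered : ∀ u → discovered (lab u) ≡ true → discovered (lab′ u) ≡ true
      more-discovered u e with u ≟ w
      ... | yes _ = refl
      ... | no _  = e

      same-done : ∀ u → isDone (lab′ u) ≡ isDone (lab u)
      same-done = relabel-same {lab = lab} {w} {active} isDone (sym (cong isDone w-out))

      old-label : ∀ {u} → u ≢ w → lab′ u ≡ lab u
      old-label = relabel-old {lab = lab} {w} {active}

      child-count : children ((w , v) ∷ A) v ≡ suc (children A v)
      child-count rewrite ==-refl v = refl

      child-other : ∀ {u} → u ≢ v → children ((w , v) ∷ A) u ≡ children A u
      child-other {u} u≢v rewrite ≢⇒== (λ e → u≢v (sym e)) = refl

      hit : Focus v ws r (q [ i ]≔ present) lab′ ((w , v) ∷ A) (suc Y) (suc Q) f g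
      hit = record
        { common = record
            { spans = spans′
            ; forest = trans (sym (spans w)) (cong discovered w-out) , trans (sym (spans v)) (cong discovered focus)
                     , joined , forest-map (known′ present) A forest
            ; satur = satur′ ; status = status′ present
            ; #found = trans (relabel-insert {lab = lab} {w} {active} discovered (cong discovered w-out) refl) (cong suc #found)
            ; #done = trans (#-cong same-done) #done
            ; full = ≤-trans full (n≤1+n Q) ; capped = ≤-trans capped (n≤1+n Y) }
        ; focus = trans (old-label (λ e → w≢v (sym e))) focus
        ; bounded = bounded′ ; childless = childless′
        ; capacity = ≤-trans (≤-reflexive (trans (cong (_+ r) child-count) (sym (+-suc (children A v) r)))) capacity
        ; produced = ≤-trans produced (≤-reflexive (+-suc Y r))
        ; queried = queried′ ; distinct = distinct′
        ; targets = λ {u} u∈ → trans (old-label (λ { refl → w∉ws u∈ })) (proj₁ (targets (later u∈))) , proj₂ (targets (later u∈))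
        ; untouched = λ j d₁ d₂ → untouched′ present j (trans (sym (same-done (end₁ j))) d₁) (trans (sym (same-done (end₂ j))) d₂) }
        where
        spans′ : ∀ u → discovered (lab′ u) ≡ spanned roots ((w , v) ∷ A) u
        spans′ u with u ≟ w
        ... | yes _ = refl
        ... | no _  = spans u
        joined : T (Known (q [ i ]≔ present) v w)
        joined = ≡true⇒T ([ (λ e → kept-present es q i e)
          , (λ e → trans (kept-sym es (known (q [ i ]≔ present)) v w) (kept-present es q i e)) ]′ (proj₂ (edge-index G v w vw)))
        satur′ : ∀ u → lab′ u ≡ saturated → σ ≤ # (λ x → discovered (lab′ x) ∧ adj G u x)
        satur′ u e = ≤-trans (satur u (was e)) (#-mono {P = λ x → discovered (lab x) ∧ adj G u x} {λ x → discovered (lab′ x) ∧ adj G u x}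
          (λ x h → let (h₁ , h₂) = ∧-elim {discovered (lab x)} h in ∧-intro (more-discovered x h₁) h₂))
          where
          was : lab′ u ≡ saturated → lab u ≡ saturated
          was e with u ≟ w
          was () | yes _
          ... | no _ = e
        bounded′ : ∀ u → children ((w , v) ∷ A) u ≤ C
        bounded′ u with u ≟ v
        ... | yes refl = ≤-trans (≤-reflexive child-count) (≤-trans (≤-trans (m≤m+n (suc (children A u)) r)
                           (≤-reflexive (sym (+-suc (children A u) r)))) capacity)
        ... | no u≢v   = ≤-trans (≤-reflexive (child-other u≢v)) (bounded u)
        childless′ : ∀ u → u ≢ v → lab′ u ≡ active → children ((w , v) ∷ A) u ≡ 0
        childless′ u u≢v e with u ≟ w
        ... | no u≢w   = trans (child-other u≢v) (childless u u≢v e)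
        ... | yes refl = trans (child-other u≢v) (no-children A forest (trans (sym (spans w)) (cong discovered w-out)))
          where
          no-children : ∀ A → Forest (λ x y → Known q x y) roots A → spanned roots A w ≡ false → children A w ≡ 0
          no-children [] _ _ = refl
          no-children ((c′ , p′) ∷ A) (_ , p′∈ , _ , F) e with p′ ≟ w | w == c′
          no-children ((c′ , p′) ∷ A) (_ , p′∈ , _ , F) () | _ | true
          ... | yes refl | false = ⊥-elim (true≢false p′∈ e)
          ... | no _     | false = no-children A F e

      same-pending : # (pending ∘ lab′) ≡ # (pending ∘ lab)
      same-pending = #-cong (relabel-same {lab = lab} {w} {active} pending (sym (cong pending w-out)))

    -- The induction runs on the number of vertices labelled `out` or `active`. Discovering a vertex
    -- moves it from one label to the other and keeps the number; processing an active vertex lowers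
    -- it for good.
    Continue : ℕ → Set
    Continue b = ∀ {q lab A Y Q f g} → State q lab A Y Q f g → # (pending ∘ lab) ≤ b → Goal q Y Q

    process : ∀ {b} → Continue b → ∀ v ws r {q lab A Y Q f g} → Focus v ws r q lab A Y Q f g →
      # (pending ∘ lab) ≤ suc b → Goal q Y Q
    process {b} continue v ws zero {q} {lab} {A} {Y} {Q} {f} {g} φ le = continue
      (record { common = retire (+-suc f g) full (≤-trans (≤-reflexive (*-suc′ C g)) (≤-trans produced (≤-reflexive (+-identityʳ Y))))
              ; bounded = bounded
              ; childless = λ u e → let (u≢v , e′) = active-before {done} (λ ()) e in childless u u≢v e′
              ; untouched = λ i d₁ d₂ → let (n₁ , d₁′) = not-done-before d₁ ; (n₂ , d₂′) = not-done-before d₂ in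
                  untouched i d₁′ d₂′ (λ e → ⊥-elim (n₁ e)) (λ e → ⊥-elim (n₂ e)) })
      (s≤s⁻¹ (≤-trans (≤-reflexive (sym (fewer-pending {done} refl))) le))
      where
      open Focus φ
      open Retire focus common
      *-suc′ : ∀ c g → c * suc g ≡ c * g + c
      *-suc′ = solve-∀
    process {b} continue v [] (suc r) {q} {lab} {A} {Y} {Q} {f} {g} φ le = continue
      (record { common = retire refl (≤-trans queried (≤-reflexive (+-identityʳ Q))) capped
              ; bounded = bounded
              ; childless = λ u e → let (u≢v , e′) = active-before {done} (λ ()) e in childless u u≢v e′
              ; untouched = λ i d₁ d₂ → let (n₁ , d₁′) = not-done-before d₁ ; (n₂ , d₂′) = not-done-before d₂ in
                  untouched i d₁′ d₂′ (λ e → ⊥-elim (n₁ e)) (λ e → ⊥-elim (n₂ e)) })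
      (s≤s⁻¹ (≤-trans (≤-reflexive (sym (fewer-pending {done} refl))) le))
      where
      open Focus φ
      open Retire focus common
    process {b} continue v (w ∷ ws) (suc r) {q} {lab} {A} {Y} {Q} {f} {g} φ le =
      likely-potential c η z Y Q 0≤η 0≤z z≤1 first i-fresh
        (process continue v ws r hit (≤-trans (≤-reflexive same-pending) le))
        (process continue v ws (suc r) miss le)
      where open Ask φ

    module _ (finish : ∀ {q lab A Y Q f g} → State q lab A Y Q f g → (∀ v → isActive (lab v) ≡ false) → Goal q Y Q) where

      module Pick {b : ℕ} (continue : Continue b) {q : Vec Status (length es)} {lab : Fin n → Label} {A : Arcs n} {Y Q f g : ℕ}
        (ς : State q lab A Y Q f g) (le : # (pending ∘ lab) ≤ suc b) (v : Fin n) (av : lab v ≡ active) where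
        open State ς
        open Retire av common

        inside outside : Fin n → Bool
        inside w = discovered (lab w) ∧ adj G v w
        outside w = not (discovered (lab w)) ∧ adj G v w

        is-out : ∀ {ℓ} → not (discovered ℓ) ≡ true → ℓ ≡ out
        is-out {out} _ = refl

        saturating : σ ≤ # inside → Goal q Y Q
        saturating h = continue
          (record { common = saturate h ; bounded = bounded
                  ; childless = λ u e → childless u (proj₂ (active-before {saturated} (λ ()) e))
                  ; untouched = λ i d₁ d₂ → untouched i (trans (sym (same-done (end₁ i))) d₁) (trans (sym (same-done (end₂ i))) d₂) })
          (s≤s⁻¹ (≤-trans (≤-reflexive (sym (fewer-pending {saturated} refl))) le))
          where
          same-done : ∀ u → isDone (relabel v saturated lab u) ≡ isDone (lab u)
          same-done = relabel-same {lab = lab} {v} {saturated} isDone (sym (cong isDone av))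

        querying : # inside ≤ σ → Goal q Y Q
        querying h = process continue v (elements outside) C record
          { common = common ; focus = av ; bounded = bounded ; childless = λ u _ → childless u
          ; capacity = ≤-reflexive (cong (_+ C) (childless v av))
          ; produced = +-monoˡ-≤ C capped
          ; queried = ≤-trans (≤-reflexive (trans (*-suc L f) (+-comm L (L * f)))) (+-mono-≤ full (≤-trans many (≤-reflexive (sym (length-elements outside)))))
          ; distinct = filter⁺ (λ w → outside w ≟ᵇ true) (allFin⁺ n)
          ; targets = λ {w} w∈ → let (e₁ , e₂) = ∧-elim {not (discovered (lab w))} (proj₂ (∈-filter⁻ (λ w → outside w ≟ᵇ true) {xs = allFin n} w∈)) in is-out e₁ , e₂
          ; untouched = λ i d₁ d₂ _ _ → untouched i d₁ d₂ }
          le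
          where
          split : # (adj G v) ≤ # inside + # outside
          split = ≤-trans (∑-mono (λ w → lem (discovered (lab w)) (adj G v w))) (≤-reflexive (∑-+ (ι ∘ inside) (ι ∘ outside)))
            where
            lem : ∀ a b → ι b ≤ ι (a ∧ b) + ι (not a ∧ b)
            lem true  b = m≤m+n _ _
            lem false b = ≤-refl
          many : L ≤ # outside
          many = +-cancelˡ-≤ σ L (# outside) (≤-trans (degree v) (≤-trans split (+-monoˡ-≤ (# outside) h)))

        pick : Goal q Y Q
        pick = [ saturating , querying ]′ (≤-total σ (# inside))

      is-active : ∀ {ℓ} → isActive ℓ ≡ true → ℓ ≡ active
      is-active {active} _ = refl

      explore : ∀ b → Continue b
      explore zero {lab = lab} ς le = finish ς (λ v → ¬true⇒false (λ e → true≢false (cong pending (is-active e))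
        (#≡0⇒false {P = pending ∘ lab} (n≤0⇒n≡0 le) v)))
      explore (suc b) {lab = lab} ς le =
        [ (λ { (v , e) → Pick.pick (explore b) ς le v (is-active e) }) , finish ς ]′ (find (isActive ∘ lab))

      run : ∀ {q} → (∀ i → lookupⱽ q i ≡ fresh) → Goal q 0 0
      run {q} all-fresh = explore n start (#≤n (pending ∘ lab₀))
        where
        lab₀ : Fin n → Label
        lab₀ v = if roots v then active else out
        discovered₀ : ∀ v → discovered (lab₀ v) ≡ roots v
        discovered₀ v with roots v
        ... | true  = refl
        ... | false = refl
        not-done₀ : ∀ v → isDone (lab₀ v) ≡ false
        not-done₀ v with roots v
        ... | true  = refl
        ... | false = refl
        not-saturated₀ : ∀ v → lab₀ v ≢ saturated
        not-saturated₀ v e with roots v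
        not-saturated₀ v () | true
        not-saturated₀ v () | false
        start : State q lab₀ [] 0 0 0 0
        start = record
          { common = record { spans = discovered₀ ; forest = _ ; satur = λ v e → ⊥-elim (not-saturated₀ v e)
              ; status = λ i → subst Ready (sym (all-fresh i)) fresh ; #found = #-cong discovered₀
              ; #done = all-false⇒#≡0 not-done₀ ; full = ≤-reflexive (*-zeroʳ L) ; capped = ≤-reflexive (*-zeroʳ C) }
          ; bounded = λ _ → z≤n ; childless = λ _ _ → refl ; untouched = λ i _ _ → all-fresh i }

-- Counting the parts and the edges between them

module PartCounts where

  open FiniteSums
  open Minors
  open Forests
  open EdgeSums using (∑-symmetric-≤)
  open SecondRound using (joins)
  open import Defs using (Graph; adj; edges; Walk)
  open import Data.Bool using (Bool; true; false; _∧_; not)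
  open import Data.Bool.Properties using (∧-comm)
  open import Data.Empty using (⊥-elim)
  open import Data.Fin using (Fin)
  open import Data.List using ([]; length; lookup)
  open import Data.Nat using (ℕ; zero; suc; _+_; _*_; _≤_; _<_; z≤n; s≤s; _≤ᵇ_)
  open import Data.Nat.Properties hiding (_≟_)
  open import Data.Nat.Tactic.RingSolver using (solve-∀)
  open import Data.Product using (∃-syntax; _×_; _,_; proj₁; proj₂)
  open import Data.Sum using (inj₁; inj₂)
  open import Function using (_∘_; id)
  open import Relation.Binary.PropositionalEquality using (_≡_; refl; sym; trans; cong; cong₂)

  joins-sym : ∀ {n} (P : Fin n → Bool) rep u v → joins P rep u v ≡ joins P rep v u
  joins-sym P rep u v = cong₂ _∧_ (∧-comm (P u) (P v)) (cong not (==-sym (rep u) (rep v)))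

  module Parts {n : ℕ} (G : Graph n) (a : Rel n) (roots R X : Fin n → Bool) (s C σ β : ℕ)
    (stage : Decomposition.Stage a roots R s C [])
    (X⊆R : ∀ v → X v ≡ true → R v ≡ true)
    (degree : ∀ v → X v ≡ true → σ ≤ # (λ w → R w ∧ adj G v w))
    (1≤s : 1 ≤ s) (few-roots : 4 * suc β * (# roots * s) ≤ σ) (small-parts : 8 * (1 + s * C) ≤ σ)
    (many-X : # R ≤ 2 * suc β * # X) (1≤X : 1 ≤ # X) where

    open Decomposition a roots R s C using (size)
    open Decomposition.Stage stage

    big S P lost : Fin n → Bool
    big x = s ≤ᵇ size rep x
    S = big
    P v = R v ∧ big (rep v)
    lost v = R v ∧ not (big (rep v))

    b : ℕ
    b = 1 + s * C

    size≤ : ∀ x → size rep x ≤ b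
    size≤ x with dec-true (roots x)
    ... | inj₁ e = ≤-trans (m≤m+n (size rep x) _) (growing x e)
    ... | inj₂ e = proj₁ (finished x e)

    part≤b : ∀ x → # (λ v → P v ∧ (rep v == x)) ≤ b
    part≤b x = ≤-trans (#-mono {P = λ v → P v ∧ (rep v == x)} {λ v → R v ∧ (rep v == x)}
      (λ v e → let (e₁ , e₂) = ∧-elim {P v} e in ∧-intro (proj₁ (∧-elim {R v} e₁)) e₂)) (size≤ x)

    -- By `finished`, a nonempty part with fewer than `s` vertices is represented by a root.
    lost-few : # lost ≤ # roots * s
    lost-few = begin
      # lost                                        ≡⟨ ∑-cong (λ v → ι-∧ (R v) (not (big (rep v)))) ⟩
      ∑ (λ v → ι (R v) * ι (not (big (rep v))))     ≡⟨ fibre-sum R rep (λ x → ι (not (big x))) ⟨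
      ∑ (λ x → ι (not (big x)) * size rep x)        ≤⟨ ∑-mono pointwise ⟩
      ∑ (λ x → ι (roots x) * s)                     ≡⟨ ∑-*ʳ (ι ∘ roots) s ⟩
      # roots * s                                   ∎
      where
      open ≤-Reasoning
      pointwise : ∀ x → ι (not (big x)) * size rep x ≤ ι (roots x) * s
      pointwise x with dec-true (big x)
      ... | inj₁ e rewrite e = z≤n
      ... | inj₂ e rewrite e with dec-true (roots x)
      ...   | inj₁ r rewrite r = *-monoʳ-≤ 1 (<⇒≤ (≰⇒> (λ h → true≢false (T⇒≡true (≤⇒≤ᵇ h)) e)))
      ...   | inj₂ r with proj₂ (finished x r)
      ...     | inj₁ h = ⊥-elim (true≢false (T⇒≡true (≤⇒≤ᵇ h)) e)
      ...     | inj₂ h = ≤-trans (≤-reflexive (trans (+-identityʳ (size rep x)) h)) z≤n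

    S-few : # S * s ≤ # R
    S-few = begin
      # S * s                                       ≡⟨ ∑-*ʳ (ι ∘ S) s ⟨
      ∑ (λ x → ι (S x) * s)                         ≤⟨ ∑-mono (λ x → ι-*-≤ (S x) (λ e → ≤ᵇ⇒≤ s _ (≡true⇒T e))) ⟩
      ∑ (λ x → ι (S x) * size rep x)                ≤⟨ ∑-mono (λ x → *-monoˡ-≤ (size rep x) (ι≤1 (S x))) ⟩
      ∑ (λ x → 1 * size rep x)                      ≡⟨ fibre-sum R rep (λ _ → 1) ⟩
      ∑ (λ v → ι (R v) * 1)                         ≡⟨ ∑-cong (λ v → *-identityʳ (ι (R v))) ⟩
      # R                                           ∎
      where open ≤-Reasoning

    rep-P : ∀ v → P v ≡ true → P (rep v) ≡ true
    rep-P v e = let (Rv , bv) = ∧-elim {R v} e in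
      ∧-intro (rep-in v Rv) (trans (cong big (idempotent v Rv)) bv)

    S-rep : ∀ x → S x ≡ true → ∃[ v ] (P v ≡ true × rep v ≡ x)
    S-rep x Sx =
      let (v , e) = #>0⇒∃ (λ v → R v ∧ (rep v == x)) (≤-trans 1≤s (≤ᵇ⇒≤ s _ (≡true⇒T Sx)))
          (Rv , r) = ∧-elim {R v} e in
      v , ∧-intro Rv (trans (cong big (==⇒≡ r)) Sx) , ==⇒≡ r

    reach-P : ∀ v → P v ≡ true → Walk a (λ w → P w ≡ true × rep w ≡ rep v) (rep v) v
    reach-P v e = let (Rv , bv) = ∧-elim {R v} e in
      walk-map id (λ { (Rw , r) → ∧-intro Rw (trans (cong big r) bv) , r }) (reach v Rv)

    X-kept : # X ≤ # (λ u → X u ∧ P u) + # lost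
    X-kept = ≤-trans (∑-mono (λ u → lem (X u) (R u) (big (rep u)) (X⊆R u)))
      (≤-reflexive (∑-+ (λ u → ι (X u ∧ P u)) (ι ∘ lost)))
      where
      lem : ∀ x r g → (x ≡ true → r ≡ true) → ι x ≤ ι (x ∧ (r ∧ g)) + ι (r ∧ not g)
      lem false r g h = z≤n
      lem true r g h rewrite h refl with g
      ... | true  = s≤s z≤n
      ... | false = s≤s z≤n

    cross-from : Fin n → ℕ
    cross-from u = ∑ (λ v → ι (adj G u v) * ι (joins P rep u v))

    -- A discovered neighbour of `u` that does not lie in another kept part is lost or belongs to
    -- the part of `u`, and both sets are small compared with σ.
    cross-degree : ∀ u → X u ∧ P u ≡ true → σ ≤ cross-from u + (# lost + b)
    cross-degree u e = begin
      σ                                             ≤⟨ degree u (proj₁ (∧-elim {X u} e)) ⟩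
      # (λ v → R v ∧ adj G u v)                     ≤⟨ ∑-mono (λ v → lem (R v) (adj G u v) (big (rep v)) (rep u == rep v) (rep v == rep u) (==-sym (rep u) (rep v))) ⟩
      ∑ (λ v → ι (adj G u v) * ι (P v ∧ not (rep u == rep v)) + (ι (lost v) + ι (P v ∧ (rep v == rep u))))
        ≡⟨ trans (∑-+ (λ v → ι (adj G u v) * ι (P v ∧ not (rep u == rep v))) (λ v → ι (lost v) + ι (P v ∧ (rep v == rep u))))
             (cong₂ _+_ (∑-cong (λ v → cong (λ c → ι (adj G u v) * ι ((c ∧ P v) ∧ not (rep u == rep v))) (sym Pu)))
                        (∑-+ (ι ∘ lost) (λ v → ι (P v ∧ (rep v == rep u))))) ⟩
      cross-from u + (# lost + # (λ v → P v ∧ (rep v == rep u)))  ≤⟨ +-monoʳ-≤ (cross-from u) (+-monoʳ-≤ (# lost) (part≤b (rep u))) ⟩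
      cross-from u + (# lost + b)                   ∎
      where
      open ≤-Reasoning
      Pu : P u ≡ true
      Pu = proj₂ (∧-elim {X u} e)
      lem : ∀ r a g e e′ → e ≡ e′ → ι (r ∧ a) ≤ ι a * ι ((r ∧ g) ∧ not e) + (ι (r ∧ not g) + ι ((r ∧ g) ∧ e′))
      lem false a     g     e     _ refl = z≤n
      lem true  false g     e     _ refl = z≤n
      lem true  true  true  true  _ refl = s≤s z≤n
      lem true  true  true  false _ refl = s≤s z≤n
      lem true  true  false e     _ refl = s≤s z≤n

    joined : Fin (length (edges G)) → Bool
    joined i = joins P rep (proj₁ (lookup (edges G) i)) (proj₂ (lookup (edges G) i))

    total : # (λ u → X u ∧ P u) * σ ≤ 2 * # joined + # X * (# lost + b)
    total = begin
      # (λ u → X u ∧ P u) * σ                                     ≡⟨ ∑-*ʳ (λ u → ι (X u ∧ P u)) σ ⟨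
      ∑ (λ u → ι (X u ∧ P u) * σ)                                 ≤⟨ ∑-mono (λ u → ι-*-≤ (X u ∧ P u) (cross-degree u)) ⟩
      ∑ (λ u → ι (X u ∧ P u) * (cross-from u + (# lost + b)))     ≤⟨ ∑-mono (λ u → lem (X u) (P u) (cross-from u) (# lost + b)) ⟩
      ∑ (λ u → cross-from u + ι (X u) * (# lost + b))             ≡⟨ trans (∑-+ cross-from (λ u → ι (X u) * (# lost + b))) (cong (∑ cross-from +_) (∑-*ʳ (ι ∘ X) (# lost + b))) ⟩
      ∑ cross-from + # X * (# lost + b)                           ≤⟨ +-monoˡ-≤ (# X * (# lost + b)) (∑-symmetric-≤ G (λ u v → ι (joins P rep u v)) (λ u v → cong ι (joins-sym P rep u v))) ⟩
      2 * # joined + # X * (# lost + b)                           ∎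
      where
      open ≤-Reasoning
      lem : ∀ x p c y → ι (x ∧ p) * (c + y) ≤ c + ι x * y
      lem false p     c y = z≤n
      lem true  false c y = z≤n
      lem true  true  c y = ≤-reflexive (trans (+-identityʳ (c + y)) (cong (c +_) (sym (+-identityʳ y))))

    -- One saturated vertex has σ neighbours in `R`, so `R`, and with it the proportional set `X`,
    -- is large as soon as `X` is nonempty. This makes the bound on lost vertices, which is stated
    -- in terms of σ, comparable with `# X`.
    σ≤X : σ ≤ 2 * suc β * # X
    σ≤X = let (u , Xu) = #>0⇒∃ X 1≤X in
      ≤-trans (≤-trans (degree u Xu) (#-mono {P = λ w → R w ∧ adj G u w} {R} (λ w e → proj₁ (∧-elim {R w} e)))) many-X

    2lost≤X : 2 * # lost ≤ # X
    2lost≤X = *-cancelˡ-≤ (2 * suc β) (≤-trans (≤-reflexive (identity (suc β) (# lost)))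
      (≤-trans (*-monoʳ-≤ (4 * suc β) lost-few) (≤-trans few-roots σ≤X)))
      where
      identity : ∀ x l → 2 * x * (2 * l) ≡ 4 * x * l
      identity = solve-∀

    many-joined : # X * σ ≤ 16 * # joined
    many-joined = arith (# X) σ (# (λ u → X u ∧ P u)) (# lost) b (# joined) X-kept total 2lost≤X
        (≤-trans (*-mono-≤ {4} {4 * suc β} (m≤m*n 4 (suc β)) lost-few) few-roots) small-parts
      where
      -- x σ ≤ (y + l) σ, where y σ ≤ 2j + x (l + b), l σ ≤ x σ / 2, x l ≤ x σ / 4 and x b ≤ x σ / 8.
      arith : ∀ x σ y l b j → x ≤ y + l → y * σ ≤ 2 * j + x * (l + b) → 2 * l ≤ x → 4 * l ≤ σ → 8 * b ≤ σ → x * σ ≤ 16 * j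
      arith x σ y l b j h₁ h₂ h₃ h₄ h₅ = linear 0
        (+-mono-≤ (*-monoʳ-≤ 8 (*-monoˡ-≤ σ h₁)) (+-mono-≤ (*-monoʳ-≤ 8 h₂) (+-mono-≤ (*-monoʳ-≤ 4 (*-monoˡ-≤ σ h₃)) (+-mono-≤ (*-monoʳ-≤ 2 (*-monoʳ-≤ x h₄)) (*-monoʳ-≤ x h₅)))))
        (identity x σ y l b j)
        where
        identity : ∀ x σ y l b j → x * σ + (8 * ((y + l) * σ) + (8 * (2 * j + x * (l + b)) + (4 * (x * σ) + (2 * (x * σ) + x * σ)))) + 0
          ≡ 16 * j + (8 * (x * σ) + (8 * (y * σ) + (4 * (2 * l * σ) + (2 * (x * (4 * l)) + x * (8 * b)))))
        identity = solve-∀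

    1≤S : 1 ≤ # S
    1≤S = let (u , e) = #>0⇒∃ (λ u → X u ∧ P u) kept ; (_ , Pu) = ∧-elim {X u} e in
      ≤-trans (≤-reflexive (sym (cong ι (proj₂ (∧-elim {R u} Pu))))) (≤∑ (ι ∘ S) (rep u))
      where
      kept : 0 < # (λ u → X u ∧ P u)
      kept = arith (# X) (# (λ u → X u ∧ P u)) (# lost) 1≤X X-kept 2lost≤X
        where
        arith : ∀ x y l → 1 ≤ x → x ≤ y + l → 2 * l ≤ x → 1 ≤ y
        arith x (suc y) l _ _ _ = s≤s z≤n
        arith x zero    l h₁ h₂ h₃ = ⊥-elim (<⇒≱ h₁ (linear 0 (+-mono-≤ (*-monoʳ-≤ 2 h₂) h₃) (identity x l)))
          where
          identity : ∀ x l → x + (2 * l + x) + 0 ≡ 0 + (2 * x + 2 * l)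
          identity = solve-∀

-- Combining the two rounds

module TwoRounds where

  open FiniteSums
  open Minors
  open EdgeDensity using (arcs; Simple; module Density)
  open Forests
  open Rationals using (ℚ-ring; _**_; linearℚ; 0≤*; 0≤**; 0≤1; 0≤+; 0≤1-)
  open RandomEdges
  open SecondRound using (module Sprinkling)
  open FirstRound
  open PartCounts using (module Parts)
  open import Defs using (Graph; adj; edges; keptAdj; HasCliqueMinor)
  open import Data.Bool using (Bool; true; false)
  open import Data.Empty using (⊥-elim)
  open import Data.Fin using (Fin; toℕ)
  open import Data.List using ([]; length)
  open import Data.Nat using (ℕ; zero; suc; _+_; _*_; _^_; _≤_; _<_; z≤n; s≤s; _<ᵇ_)
  open import Data.Nat.Properties hiding (_≟_)
  open import Data.Nat.Tactic.RingSolver using (solve-∀)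
  open import Data.Product using (_,_; proj₁; proj₂)
  open import Data.Rational using (ℚ; 0ℚ; 1ℚ; ½; _-_) renaming (_+_ to _+ℚ_; _*_ to _*ℚ_; _≤_ to _≤ℚ_)
  import Data.Rational.Properties as ℚ
  open import Data.Sum as Sum using (_⊎_; inj₁; inj₂; [_,_]′)
  open import Data.Vec using (Vec; replicate)
  open import Data.Vec.Properties using (lookup-replicate)
  open import Function using (_∘_)
  open import Relation.Binary.PropositionalEquality using (_≡_; refl; sym; trans; cong)
  import Tactic.RingSolver as Solver

  -- r = |R| discovered vertices, x of them saturated, f and g processed.
  saturated-proportion : ∀ β r x f g Y ρ f₀ → 1 ≤ β → r ≡ Y + ρ → r ≤ f + g + x → 2 * suc β * g ≤ Y →
    4 * f₀ ≤ ρ → f ≤ f₀ ⊎ suc β * f ≤ β * Y → r ≤ 2 * suc β * x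
  saturated-proportion β r x f g Y ρ f₀ 1≤β r≡ r≤ capped 4f₀≤ρ (inj₁ f≤f₀) = ≤-trans
    (linear (2 * r) (+-mono-≤ (*-monoʳ-≤ 4 r≤) (+-mono-≤ (*-monoʳ-≤ 4 f≤f₀) (+-mono-≤ 4f₀≤ρ (+-mono-≤ 4g≤Y (≤-reflexive (sym r≡))))))
      (identity r x f g Y ρ f₀))
    (*-monoˡ-≤ x (*-monoʳ-≤ 2 (s≤s 1≤β)))
    where
    4g≤Y : 2 * 2 * g ≤ Y
    4g≤Y = ≤-trans (*-monoˡ-≤ g (*-monoʳ-≤ 2 (s≤s 1≤β))) capped
    identity : ∀ r x f g Y ρ f₀ → r + (4 * (f + g + x) + (4 * f₀ + (ρ + (Y + r)))) + 2 * r
      ≡ 2 * 2 * x + (4 * r + (4 * f + (4 * f₀ + (2 * 2 * g + (Y + ρ)))))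
    identity = solve-∀
  -- Here f is at most βY/(β + 1) and g at most Y/(2(β + 1)), which leaves at least r/(2(β + 1))
  -- saturated vertices. The cap 2(β + 1) is chosen so that g consumes only half of the gap Y/(β +
  -- 1).
  saturated-proportion β r x f g Y ρ f₀ 1≤β r≡ r≤ capped 4f₀≤ρ (inj₂ h) =
    linear ((2 * β + 1) * ρ) (+-mono-≤ (*-monoʳ-≤ (2 * suc β) r≤) (+-mono-≤ (*-monoʳ-≤ 2 h) (+-mono-≤ capped (*-monoʳ-≤ (2 * β + 1) (≤-reflexive (sym r≡))))))
      (identity β r x f g Y ρ)
    where
    identity : ∀ β r x f g Y ρ → r + (2 * suc β * (f + g + x) + (2 * (β * Y) + (Y + (2 * β + 1) * r))) + (2 * β + 1) * ρ
      ≡ 2 * suc β * x + (2 * suc β * r + (2 * (suc β * f) + (2 * suc β * g + (2 * β + 1) * (Y + ρ))))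
    identity = solve-∀

  module Combine (p p₁ p₂ : ℚ) (0≤p₁ : 0ℚ ≤ℚ p₁) (p₁≤1 : p₁ ≤ℚ 1ℚ) (0≤p₂ : 0ℚ ≤ℚ p₂) (p₂≤1 : p₂ ≤ℚ 1ℚ)
    (p-split : p ≡ p₁ +ℚ (1ℚ - p₁) *ℚ p₂)
    {n : ℕ} (G : Graph n) (Evt : Vec Bool (length (edges G)) → Set) (t : ℕ)
    (win : ∀ s → HasCliqueMinor (keptAdj (edges G) s) t → Evt s)
    (β σ L s ρ f₀ κ d m : ℕ) (1≤β : 1 ≤ β)
    (degree : ∀ u → σ + L ≤ # (adj G u)) (ρ≤n : ρ ≤ n) (1≤s : 1 ≤ s) (1≤ρ : 1 ≤ ρ) (4f₀≤ρ : 4 * f₀ ≤ ρ)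
    (few-roots : 4 * suc β * (ρ * s) ≤ σ) (small-parts : 8 * (1 + s * (2 * suc β)) ≤ σ)
    (d-small : d * (2 * suc β * κ) ≤ s)
    (0<t : 0 < t) (few : 2 * t < 2 ^ (m * (6 * (2 + m)))) (room : 192 * (6 * (2 + m) * t) ≤ d)
    (η z : ℚ) (0≤η : 0ℚ ≤ℚ η) (0≤z : 0ℚ ≤ℚ z) (z≤1 : z ≤ℚ 1ℚ)
    (unlucky₁ : ∀ Y Q f → f₀ ≤ f → L * f ≤ Q → β * Y ≤ suc β * f → 1ℚ ≤ℚ η *ℚ (z ** Y *ℚ (1ℚ +ℚ p₁ *ℚ (1ℚ - z)) ** Q))
    (unlucky₂ : ∀ x Y Q → σ ≤ 2 * suc β * x → x * σ ≤ 16 * (Q + 2 * Y * ((1 + s * (2 * suc β)) * (1 + s * (2 * suc β)))) →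
      1ℚ ≤ℚ η *ℚ (½ ** Y *ℚ (1ℚ +ℚ p₂ *ℚ ½) ** Q) ⊎ x ≤ κ * Y) where

    open Percolation p p₁ p₂ 0≤p₁ p₁≤1 0≤p₂ p₂≤1 p-split

    private
      C : ℕ
      C = 2 * suc β

      roots : Fin n → Bool
      roots v = toℕ v <ᵇ ρ

      #roots : # roots ≡ ρ
      #roots = #-initial n ρ ρ≤n

      -- The constant `1ℚ - η` is what the second round guarantees at each leaf of the exploration;
      -- the potential of the first round costs another `η`.
      module Ex = Exploration p p₁ p₂ 0≤p₁ p₁≤1 0≤p₂ p₂≤1 p-split G Evt roots σ L C degree (1ℚ - η) η z 0≤η 0≤z z≤1

    module Finish {q : Vec Status (length (edges G))} {lab : Fin n → Label} {A : Arcs n} {Y Q f g : ℕ}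
      (ς : Ex.State q lab A Y Q f g) (inactive : ∀ v → isActive (lab v) ≡ false) where
      open Ex.State ς

      R X : Fin n → Bool
      R v = discovered (lab v)
      X v = isSaturated (lab v)

      R-split : # R ≤ f + g + # X
      R-split = ≤-trans (∑-mono (λ v → lem (lab v) (inactive v)))
        (≤-reflexive (trans (∑-+ (ι ∘ isDone ∘ lab) (ι ∘ X)) (cong (_+ # X) #done)))
        where
        lem : ∀ ℓ → isActive ℓ ≡ false → ι (discovered ℓ) ≤ ι (isDone ℓ) + ι (isSaturated ℓ)
        lem out       _ = z≤n
        lem done      _ = s≤s z≤n
        lem saturated _ = s≤s z≤n

      #R : # R ≡ Y + ρ
      #R = trans #found (cong (Y +_) #roots)

      module Lucky (many-X : # R ≤ 2 * suc β * # X) where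

        1≤X : 1 ≤ # X
        1≤X = positive (2 * suc β) (# X) (≤-trans 1≤ρ (≤-trans (m≤n+m ρ Y) (≤-trans (≤-reflexive (sym #R)) many-X)))
          where
          positive : ∀ c x → 1 ≤ c * x → 1 ≤ x
          positive c (suc x) _ = s≤s z≤n
          positive c zero    h = ⊥-elim (<⇒≱ h (≤-reflexive (*-zeroʳ c)))

        saturated? : ∀ {ℓ} → isSaturated ℓ ≡ true → ℓ ≡ saturated
        saturated? {saturated} _ = refl

        stage : Decomposition.Stage (Ex.Known q) roots R s C []
        stage = Decomposition.decompose (Ex.Known q) roots R s C A forest (λ v e → trans (spans v) e)
          (Decomposition.initial (Ex.Known q) roots R s C A spans bounded)

        module Pt = Parts G (Ex.Known q) roots R X s C σ β stage
          (λ v e → cong discovered (saturated? e)) (λ v e → satur v (saturated? e)) 1≤s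
          (≤-trans (≤-reflexive (cong (λ r → 4 * suc β * (r * s)) #roots)) few-roots) small-parts many-X 1≤X

        enough : Rel n → Set
        enough H = 2 * d * # Pt.S ≤ arcs H

        build : ∀ H → Simple H Pt.S → enough H → CliqueModel H Pt.S t
        build H simple h = nonempty (# Pt.S) refl Pt.1≤S
          where
          nonempty : ∀ c → # Pt.S ≡ c → 1 ≤ c → CliqueModel H Pt.S t
          nonempty (suc c) e _ = Density.density-minor m t d 0<t few room c H Pt.S simple e h

        verdict : ∀ H Y Q → arcs H ≡ 2 * Y → # Pt.joined ≤ Q + arcs H * (Pt.b * Pt.b) →
          1ℚ ≤ℚ η *ℚ (½ ** Y *ℚ (1ℚ +ℚ p₂ *ℚ ½) ** Q) ⊎ enough H
        verdict H Y Q count bound = Sum.map₂ convert (unlucky₂ (# X) Y Q Pt.σ≤X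
          (≤-trans Pt.many-joined (*-monoʳ-≤ 16 (≤-trans bound (≤-reflexive (cong (λ e → Q + e * (Pt.b * Pt.b)) count))))))
          where
          convert : # X ≤ κ * Y → enough H
          convert h = ≤-trans (≤-trans (≤-reflexive (*-assoc 2 d (# Pt.S))) (*-monoʳ-≤ 2 dS≤Y)) (≤-reflexive (sym count))
            where
            scaled : ∀ c → 1 ≤ c → d * c ≤ s → # Pt.S * s ≤ c * Y → d * # Pt.S ≤ Y
            scaled (suc c) _ h₁ h₂ = *-cancelˡ-≤ (suc c) (≤-trans (≤-reflexive (identity (suc c) d (# Pt.S))) (≤-trans (*-monoʳ-≤ (# Pt.S) h₁) h₂))
              where
              identity : ∀ c d S → c * (d * S) ≡ S * (d * c)
              identity = solve-∀
            1≤κ : ∀ κ → # X ≤ κ * Y → 1 ≤ κ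
            1≤κ zero    h = ⊥-elim (<⇒≱ 1≤X h)
            1≤κ (suc _) _ = s≤s z≤n
            dS≤Y : d * # Pt.S ≤ Y
            -- There are at most `# R / s` parts, and `# R` is at most `2 * suc β * κ * Y`;
            -- `d-small` compares this factor with `s`.
            dS≤Y = scaled (2 * suc β * κ) (*-mono-≤ {1} {2 * suc β} (s≤s z≤n) (1≤κ κ h)) d-small (≤-trans Pt.S-few
              (≤-trans many-X (≤-trans (*-monoʳ-≤ (2 * suc β) h) (≤-reflexive (sym (*-assoc (2 * suc β) κ Y))))))

        lucky : Likely Evt q (1ℚ - η)
        lucky = Sprinkling.sprinkle p p₁ p₂ 0≤p₁ p₁≤1 0≤p₂ p₂≤1 p-split G Evt t win q status Pt.P
          (Decomposition.Stage.rep stage) Pt.S Pt.rep-P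
          (λ v e → Decomposition.Stage.idempotent stage v (proj₁ (∧-elim {R v} e))) Pt.reach-P
          (λ v e → proj₂ (∧-elim {R v} e)) Pt.S-rep Pt.b Pt.part≤b η 0≤η enough build verdict

      0≤potential : 0ℚ ≤ℚ η *ℚ (z ** Y *ℚ (1ℚ +ℚ p₁ *ℚ (1ℚ - z)) ** Q)
      0≤potential = 0≤* 0≤η (0≤* (0≤** Y 0≤z) (0≤** Q (0≤+ 0≤1 (0≤* 0≤p₁ (0≤1- z≤1)))))

      below : ∀ {c x} → 0ℚ ≤ℚ x → c - x ≤ℚ c
      below {c} {x} 0≤x = linearℚ 0ℚ ℚ.≤-refl 0≤x (identity c x)
        where
        identity : ∀ c x → c - x +ℚ x +ℚ 0ℚ ≡ c +ℚ 0ℚ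
        identity = Solver.solve-∀ ℚ-ring

      continue : f ≤ f₀ ⊎ suc β * f ≤ β * Y → Ex.Goal q Y Q
      continue h = likely-weaken (below 0≤potential) (Lucky.lucky
        (saturated-proportion β (# R) (# X) f g Y ρ f₀ 1≤β #R R-split capped 4f₀≤ρ h))

      finish : Ex.Goal q Y Q
      -- Either few vertices were exhausted, and the roots alone outweigh them; or many were and
      -- produced too few children, when the potential has reached 1; or the children outnumber them
      -- as expected.
      finish = [ (λ h → continue (inj₁ h))
               , (λ h → [ (λ h′ → likely-exhausted (1ℚ - η) _ (below 0≤η) (unlucky₁ Y Q f h full h′))
                        , (λ h′ → continue (inj₂ h′)) ]′ (≤-total (β * Y) (suc β * f))) ]′ (≤-total f f₀)

    combine : Likely Evt (replicate (length (edges G)) fresh) (1ℚ - η - η)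
    combine = likely-weaken (ℚ.≤-reflexive (cong (λ x → 1ℚ - η - x) (sym (ℚ.*-identityʳ η))))
      (Ex.run Finish.finish (λ i → lookup-replicate i fresh))

-- Exponential bound, integer roots and logarithms

module Logarithms where

  open FiniteSums using (linear)
  open Rationals
  open import Defs using (ℕ→ℚ; expTerm; expPartial; ExpAtMost; AtLeastBound)
  open import Data.Empty using (⊥-elim)
  open import Data.Nat as ℕ using (ℕ; zero; suc; z≤n; s≤s)
  import Data.Nat.Properties as ℕ
  open import Data.Nat.Tactic.RingSolver using () renaming (solve-∀ to ℕ-solve-∀)
  open import Data.Product using (∃-syntax; _×_; _,_)
  open import Data.Rational using (ℚ; 0ℚ; 1ℚ; ½; _+_; _*_; _≤_)
  open import Data.Rational.Properties
  open import Data.Sum using (inj₁; inj₂)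
  open import Relation.Nullary using (yes; no)
  open import Relation.Binary.PropositionalEquality using (_≡_; refl; sym; trans; cong; cong₂; subst₂)
  open import Tactic.RingSolver using (solve-∀)

  -- The number of multisets of size j over M elements; ∑ⱼ multichoose M j 2⁻ʲ = 2ᴹ
  -- dominates the exponential series at M/2 term by term.
  multichoose : ℕ → ℕ → ℕ
  multichoose zero    zero    = 1
  multichoose zero    (suc j) = 0
  multichoose (suc M) zero    = 1
  multichoose (suc M) (suc j) = multichoose M (suc j) ℕ.+ multichoose (suc M) j

  multichoose-zero : ∀ M → multichoose M 0 ≡ 1
  multichoose-zero zero    = refl
  multichoose-zero (suc M) = refl

  multichoose-suc : ∀ M j → suc j ℕ.* multichoose M (suc j) ≡ (M ℕ.+ j) ℕ.* multichoose M j
  multichoose-suc zero zero    = refl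
  multichoose-suc zero (suc j) = trans (ℕ.*-zeroʳ (suc (suc j))) (sym (ℕ.*-zeroʳ (suc j)))
  multichoose-suc (suc M) zero = trans (cong (λ x → 1 ℕ.* (x ℕ.+ 1)) first) (identity M)
    where
    first : multichoose M 1 ≡ M
    first = trans (sym (ℕ.*-identityˡ _)) (trans (multichoose-suc M 0) (trans (cong ((M ℕ.+ 0) ℕ.*_) (multichoose-zero M)) (trans (ℕ.*-identityʳ _) (ℕ.+-identityʳ M))))
    identity : ∀ M → 1 ℕ.* (M ℕ.+ 1) ≡ (suc M ℕ.+ 0) ℕ.* 1
    identity = ℕ-solve-∀
  multichoose-suc (suc M) (suc j) = trans (expand j a b)
    (trans (cong₂ (λ x y → x ℕ.+ (y ℕ.+ b)) (multichoose-suc M (suc j)) (multichoose-suc (suc M) j)) (collect M j (multichoose M (suc j)) (multichoose (suc M) j)))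
    where
    a b : ℕ
    a = multichoose M (suc (suc j))
    b = multichoose (suc M) (suc j)
    expand : ∀ j a b → suc (suc j) ℕ.* (a ℕ.+ b) ≡ suc (suc j) ℕ.* a ℕ.+ (suc j ℕ.* b ℕ.+ b)
    expand = ℕ-solve-∀
    collect : ∀ M j c d → (M ℕ.+ suc j) ℕ.* c ℕ.+ ((suc M ℕ.+ j) ℕ.* d ℕ.+ (c ℕ.+ d)) ≡ (suc M ℕ.+ suc j) ℕ.* (c ℕ.+ d)
    collect = ℕ-solve-∀

  series : ℕ → ℕ → ℚ
  series M zero    = 1ℚ
  series M (suc j) = series M j + ℕ→ℚ (multichoose M (suc j)) * ½ ** suc j

  series-zero : ∀ j → series 0 j ≡ 1ℚ
  series-zero zero    = refl
  series-zero (suc j) = trans (cong₂ _+_ (series-zero j) (*-zeroˡ (½ ** suc j))) (+-identityʳ 1ℚ)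

  -- The truncated form of the functional equation of (1 - x)⁻ᴹ at x = ½: the series for M + 1 is
  -- the series for M plus x times itself.
  series-suc : ∀ M j → series (suc M) (suc j) ≡ series M (suc j) + ½ * series (suc M) j
  series-suc M zero = trans (cong (λ x → 1ℚ + x * ½ ** 1) (ℕ→ℚ-+ (multichoose M 1) 1)) (identity (ℕ→ℚ (multichoose M 1)) ½)
    where
    identity : ∀ a h → 1ℚ + (a + 1ℚ) * (h * 1ℚ) ≡ 1ℚ + a * (h * 1ℚ) + h * 1ℚ
    identity = solve-∀ ℚ-ring
  series-suc M (suc j) = trans (cong₂ _+_ (series-suc M j) (cong (_* ½ ** suc (suc j)) (ℕ→ℚ-+ (multichoose M (suc (suc j))) (multichoose (suc M) (suc j)))))
    (identity (series M (suc j)) (series (suc M) j) (ℕ→ℚ (multichoose M (suc (suc j)))) (ℕ→ℚ (multichoose (suc M) (suc j))) (½ ** suc j) ½)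
    where
    identity : ∀ s r a b x h → s + h * r + (a + b) * (h * x) ≡ s + a * (h * x) + h * (r + b * x)
    identity = solve-∀ ℚ-ring

  series≤2^ : ∀ M j → series M j ≤ ℕ→ℚ (2 ℕ.^ M)
  series≤2^ zero    j       = ≤-reflexive (series-zero j)
  series≤2^ (suc M) zero    = ℕ→ℚ-mono (ℕ.m^n>0 2 (suc M))
  series≤2^ (suc M) (suc j) = begin
    series (suc M) (suc j)                       ≡⟨ series-suc M j ⟩
    series M (suc j) + ½ * series (suc M) j      ≤⟨ +-mono-≤ (series≤2^ M (suc j)) (*-monoˡ 0≤½ (series≤2^ (suc M) j)) ⟩
    ℕ→ℚ (2 ℕ.^ M) + ½ * ℕ→ℚ (2 ℕ.^ suc M)        ≡⟨ cong (ℕ→ℚ (2 ℕ.^ M) +_) (trans (cong (½ *_) (ℕ→ℚ-* 2 (2 ℕ.^ M))) (trans (sym (*-assoc ½ (ℕ→ℚ 2) (ℕ→ℚ (2 ℕ.^ M)))) (*-identityˡ (ℕ→ℚ (2 ℕ.^ M))))) ⟩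
    ℕ→ℚ (2 ℕ.^ M) + ℕ→ℚ (2 ℕ.^ M)                ≡⟨ trans (cong ℕ→ℚ (cong (2 ℕ.^ M ℕ.+_) (ℕ.+-identityʳ (2 ℕ.^ M)))) (ℕ→ℚ-+ (2 ℕ.^ M) (2 ℕ.^ M)) ⟨
    ℕ→ℚ (2 ℕ.^ suc M)                            ∎
    where open ≤-Reasoning

  module _ (q : ℚ) (M : ℕ) (0≤q : 0ℚ ≤ q) (q≤ : q ≤ ½ * ℕ→ℚ M) where

    0≤expTerm : ∀ j → 0ℚ ≤ expTerm q j
    0≤expTerm zero    = 0≤1
    0≤expTerm (suc j) = 0≤* (0≤* (0≤expTerm j) 0≤q) (0≤unit j)

    -- The ratio of consecutive terms is q / (j + 1) on the left and (M + j) / (2(j + 1)) on the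
    -- right, and q is at most M / 2.
    expTerm≤ : ∀ j → expTerm q j ≤ ℕ→ℚ (multichoose M j) * ½ ** j
    expTerm≤ zero = ≤-reflexive (sym (trans (cong (λ x → ℕ→ℚ x * 1ℚ) (multichoose-zero M)) refl))
    expTerm≤ (suc j) = begin
      expTerm q j * q * unit j                                         ≤⟨ *-monoʳ (0≤unit j) (*-mono (0≤expTerm j) (0≤* 0≤½ (0≤ℕ→ℚ M)) (expTerm≤ j) q≤) ⟩
      ℕ→ℚ (multichoose M j) * ½ ** j * (½ * ℕ→ℚ M) * unit j            ≡⟨ regroup (ℕ→ℚ (multichoose M j)) (½ ** j) ½ (ℕ→ℚ M) (unit j) ⟩
      ℕ→ℚ M * ℕ→ℚ (multichoose M j) * (½ ** suc j * unit j)            ≤⟨ *-monoʳ (0≤* (0≤** (suc j) 0≤½) (0≤unit j)) bound ⟩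
      ℕ→ℚ (suc j) * ℕ→ℚ (multichoose M (suc j)) * (½ ** suc j * unit j)  ≡⟨ regroup′ (ℕ→ℚ (suc j)) (ℕ→ℚ (multichoose M (suc j))) (½ ** suc j) (unit j) ⟩
      unit j * ℕ→ℚ (suc j) * (ℕ→ℚ (multichoose M (suc j)) * ½ ** suc j)  ≡⟨ trans (cong (_* (ℕ→ℚ (multichoose M (suc j)) * ½ ** suc j)) (unit-inverse j)) (*-identityˡ _) ⟩
      ℕ→ℚ (multichoose M (suc j)) * ½ ** suc j                         ∎
      where
      open ≤-Reasoning
      regroup : ∀ a x h m u → a * x * (h * m) * u ≡ m * a * (h * x * u)
      regroup = solve-∀ ℚ-ring
      regroup′ : ∀ n a x u → n * a * (x * u) ≡ u * n * (a * x)
      regroup′ = solve-∀ ℚ-ring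
      bound : ℕ→ℚ M * ℕ→ℚ (multichoose M j) ≤ ℕ→ℚ (suc j) * ℕ→ℚ (multichoose M (suc j))
      bound = subst₂ _≤_ (ℕ→ℚ-* M (multichoose M j)) (ℕ→ℚ-* (suc j) (multichoose M (suc j)))
        (ℕ→ℚ-mono (ℕ.≤-trans (ℕ.*-monoˡ-≤ (multichoose M j) (ℕ.m≤m+n M j)) (ℕ.≤-reflexive (sym (multichoose-suc M j)))))

    expPartial≤series : ∀ j → expPartial q j ≤ series M j
    expPartial≤series zero    = ≤-refl
    expPartial≤series (suc j) = +-mono-≤ (expPartial≤series j) (expTerm≤ (suc j))

    expAtMost : ∀ N → 2 ℕ.^ M ℕ.≤ N → ExpAtMost q N
    expAtMost N 2^M≤N j = ≤-trans (expPartial≤series j) (≤-trans (series≤2^ M j) (ℕ→ℚ-mono 2^M≤N))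

  -- With c² = 1 / (2(Λ + 1)) the exponent c²k / t² is at most μ² / 2, and exp(μ² / 2) ≤ 2^(μ²) ≤ k.
  -- The factor ½ is the price of replacing the base e by 2.
  atLeastBound : ∀ Λ k μ t → 1 ℕ.≤ t → 2 ℕ.^ (μ ℕ.* μ) ℕ.≤ k → k ℕ.≤ suc Λ ℕ.* (μ ℕ.* μ) ℕ.* (t ℕ.* t) →
    AtLeastBound (½ * unit Λ) k t
  atLeastBound Λ k μ (suc t) _ 2^≤k k≤ = expAtMost q (μ ℕ.* μ) nonneg upper k 2^≤k
    where
    c q : ℚ
    c = ½ * unit Λ
    q = c * ℕ→ℚ k * unit t * unit t
    0≤c : 0ℚ ≤ c
    0≤c = 0≤* 0≤½ (0≤unit Λ)
    nonneg : 0ℚ ≤ q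
    nonneg = 0≤* (0≤* (0≤* 0≤c (0≤ℕ→ℚ k)) (0≤unit t)) (0≤unit t)
    upper : q ≤ ½ * ℕ→ℚ (μ ℕ.* μ)
    upper = begin
      c * ℕ→ℚ k * unit t * unit t
        ≤⟨ *-monoʳ (0≤unit t) (*-monoʳ (0≤unit t) (*-monoˡ 0≤c (ℕ→ℚ-mono k≤))) ⟩
      c * ℕ→ℚ (suc Λ ℕ.* (μ ℕ.* μ) ℕ.* (suc t ℕ.* suc t)) * unit t * unit t
        ≡⟨ cong (λ x → c * x * unit t * unit t) (trans (ℕ→ℚ-* (suc Λ ℕ.* (μ ℕ.* μ)) (suc t ℕ.* suc t)) (cong₂ _*_ (ℕ→ℚ-* (suc Λ) (μ ℕ.* μ)) (ℕ→ℚ-* (suc t) (suc t)))) ⟩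
      c * (ℕ→ℚ (suc Λ) * ℕ→ℚ (μ ℕ.* μ) * (ℕ→ℚ (suc t) * ℕ→ℚ (suc t))) * unit t * unit t
        ≡⟨ regroup ½ (unit Λ) (ℕ→ℚ (suc Λ)) (ℕ→ℚ (μ ℕ.* μ)) (ℕ→ℚ (suc t)) (unit t) ⟩
      ½ * ℕ→ℚ (μ ℕ.* μ) * ((unit Λ * ℕ→ℚ (suc Λ)) * ((unit t * ℕ→ℚ (suc t)) * (unit t * ℕ→ℚ (suc t))))
        ≡⟨ cong₂ (λ x y → ½ * ℕ→ℚ (μ ℕ.* μ) * (x * (y * y))) (unit-inverse Λ) (unit-inverse t) ⟩
      ½ * ℕ→ℚ (μ ℕ.* μ) * 1ℚ                     ≡⟨ *-identityʳ _ ⟩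
      ½ * ℕ→ℚ (μ ℕ.* μ)                          ∎
      where
      open ≤-Reasoning
      regroup : ∀ h l L m t u → h * l * (L * m * (t * t)) * u * u ≡ h * m * ((l * L) * ((u * t) * (u * t)))
      regroup = solve-∀ ℚ-ring

  -- A crossing point of `F`, found by descending from `b`; integer square roots, quotients and
  -- logarithms are all instances.
  bracket : ∀ (F : ℕ → ℕ) k b → F 0 ℕ.≤ k → k ℕ.< F b → ∃[ x ] (F x ℕ.≤ k × k ℕ.< F (suc x))
  bracket F k zero    lo hi = ⊥-elim (ℕ.<⇒≱ hi lo)
  bracket F k (suc b) lo hi with F b ℕ.≤? k
  ... | yes h = b , h , hi
  ... | no h  = bracket F k b lo (ℕ.≰⇒> h)

  square-root : ∀ k → ∃[ s ] (s ℕ.* s ℕ.≤ k × k ℕ.< suc s ℕ.* suc s)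
  square-root k = bracket (λ s → s ℕ.* s) k (suc k) z≤n (ℕ.m≤m*n (suc k) (suc k))

  divide : ∀ k D → 1 ℕ.≤ D → ∃[ x ] (D ℕ.* x ℕ.≤ k × k ℕ.< D ℕ.* suc x)
  divide k D 1≤D = bracket (D ℕ.*_) k (suc k) (ℕ.≤-trans (ℕ.≤-reflexive (ℕ.*-zeroʳ D)) z≤n) (ℕ.m≤n*m (suc k) D {{ℕ.>-nonZero 1≤D}})

  below-quotient : ∀ {k x} D c → k ℕ.< D ℕ.* suc x → D ℕ.* c ℕ.≤ k → c ℕ.≤ x
  below-quotient {k} {x} D c hi h = ℕ.m<1+n⇒m≤n (ℕ.*-cancelˡ-< D c (suc x) (ℕ.≤-<-trans h hi))

  n<2^n : ∀ n → n ℕ.< 2 ℕ.^ n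
  n<2^n zero    = s≤s z≤n
  n<2^n (suc n) = ℕ.≤-trans (ℕ.+-mono-≤ (ℕ.m^n>0 2 n) (n<2^n n)) (ℕ.≤-reflexive (cong (2 ℕ.^ n ℕ.+_) (sym (ℕ.+-identityʳ (2 ℕ.^ n)))))

  -- μ approximates the square root of the binary logarithm, the quantity by which √k is divided in
  -- the theorem, without taking two roundings.
  square-logarithm : ∀ k → 1 ℕ.≤ k → ∃[ μ ] (2 ℕ.^ (μ ℕ.* μ) ℕ.≤ k × k ℕ.< 2 ℕ.^ (suc μ ℕ.* suc μ))
  square-logarithm k 1≤k = bracket (λ μ → 2 ℕ.^ (μ ℕ.* μ)) k (suc k) 1≤k
    (ℕ.<-≤-trans (n<2^n k) (ℕ.^-monoʳ-≤ 2 (ℕ.≤-trans (ℕ.n≤1+n k) (ℕ.m≤m*n (suc k) (suc k)))))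

  square-mono : ∀ {a b} → a ℕ.≤ b → a ℕ.* a ℕ.≤ b ℕ.* b
  square-mono h = ℕ.*-mono-≤ h h

  below-root : ∀ {k s} a → k ℕ.< suc s ℕ.* suc s → a ℕ.* a ℕ.≤ k → a ℕ.≤ s
  below-root {k} {s} a hi h with a ℕ.≤? s
  ... | yes p = p
  ... | no p  = ⊥-elim (ℕ.<⇒≱ hi (ℕ.≤-trans (square-mono (ℕ.≰⇒> p)) h))

  -- For μ ≥ Γ + 4 one has 2^(μ²) ≥ 2^(4μ) ≥ (Γ (3 + μ))².
  root-beats-log : ∀ Γ k μ → (Γ ℕ.* (Γ ℕ.+ 7)) ℕ.* (Γ ℕ.* (Γ ℕ.+ 7)) ℕ.≤ k → 2 ℕ.^ (μ ℕ.* μ) ℕ.≤ k →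
    (Γ ℕ.* (3 ℕ.+ μ)) ℕ.* (Γ ℕ.* (3 ℕ.+ μ)) ℕ.≤ k
  root-beats-log Γ k μ large 2^≤k with ℕ.≤-total μ (Γ ℕ.+ 4)
  ... | inj₁ h = ℕ.≤-trans (square-mono (ℕ.*-monoʳ-≤ Γ (ℕ.≤-trans (ℕ.+-monoʳ-≤ 3 h) (ℕ.≤-reflexive (identity Γ))))) large
    where
    identity : ∀ Γ → 3 ℕ.+ (Γ ℕ.+ 4) ≡ Γ ℕ.+ 7
    identity = ℕ-solve-∀
  ... | inj₂ h = ℕ.≤-trans (ℕ.≤-trans (square-mono (ℕ.*-mono-≤ Γ≤ 3+μ≤)) (ℕ.≤-reflexive fourth)) (ℕ.≤-trans (ℕ.^-monoʳ-≤ 2 (ℕ.*-monoˡ-≤ μ 4≤μ)) 2^≤k)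
    where
    4≤μ : 4 ℕ.≤ μ
    4≤μ = ℕ.≤-trans (ℕ.m≤n+m 4 Γ) h
    Γ≤ : Γ ℕ.≤ 2 ℕ.^ μ
    Γ≤ = ℕ.≤-trans (ℕ.≤-trans (ℕ.m≤m+n Γ 4) h) (ℕ.<⇒≤ (n<2^n μ))
    3+μ≤ : 3 ℕ.+ μ ℕ.≤ 2 ℕ.^ μ
    3+μ≤ = go μ 4≤μ
      where
      go : ∀ μ → 4 ℕ.≤ μ → 3 ℕ.+ μ ℕ.≤ 2 ℕ.^ μ
      go (suc (suc (suc (suc μ)))) _ = ℕ.≤-trans (linear (9 ℕ.+ 15 ℕ.* μ) (ℕ.*-monoʳ-≤ 16 (n<2^n μ)) (identity μ (2 ℕ.^ μ))) (ℕ.≤-reflexive (sym (power (2 ℕ.^ μ))))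
        where
        power : ∀ x → 2 ℕ.* (2 ℕ.* (2 ℕ.* (2 ℕ.* x))) ≡ 16 ℕ.* x
        power = ℕ-solve-∀
        identity : ∀ μ x → 7 ℕ.+ μ ℕ.+ 16 ℕ.* x ℕ.+ (9 ℕ.+ 15 ℕ.* μ) ≡ 16 ℕ.* x ℕ.+ 16 ℕ.* suc μ
        identity = ℕ-solve-∀
      go (suc zero) (s≤s ())
      go (suc (suc zero)) (s≤s (s≤s ()))
      go (suc (suc (suc zero))) (s≤s (s≤s (s≤s ())))
    fourth : (2 ℕ.^ μ ℕ.* 2 ℕ.^ μ) ℕ.* (2 ℕ.^ μ ℕ.* 2 ℕ.^ μ) ≡ 2 ℕ.^ (4 ℕ.* μ)
    fourth = trans (power (2 ℕ.^ μ)) (trans (ℕ.^-*-assoc 2 μ 4) (cong (2 ℕ.^_) (ℕ.*-comm μ 4)))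
      where
      power : ∀ x → (x ℕ.* x) ℕ.* (x ℕ.* x) ≡ x ℕ.* (x ℕ.* (x ℕ.* (x ℕ.* 1)))
      power = ℕ-solve-∀

-- Arithmetic of the second round and of the order of the minor

module QueryCounts where

  open FiniteSums using (linear)
  open Logarithms using (divide; below-quotient; square-mono)
  open import Data.Nat using (ℕ; suc; _+_; _*_; _≤_; _<_; z≤n; s≤s; >-nonZero)
  open import Data.Nat.Properties
  open import Data.Nat.Tactic.RingSolver using (solve-∀)
  open import Data.Product using (∃-syntax; _×_; _,_; proj₁; proj₂)
  open import Relation.Binary.PropositionalEquality using (_≡_; sym; trans; cong; subst)

  -- If few pairs were joined, the edges hidden behind them, at most `2 * Y` times (1 + C)²k,
  -- account for at most half of the bound: this is the share `2 * c₁` of κ. So `Q` is of order x k,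
  -- enough for `H` blocks of `4 * suc B * k` queries, where `H` is `x / c₂`; the share `4 * c₂` of
  -- κ makes `2 * Y ≤ H`.
  many-queries : ∀ B β C c₁ c₂ κ k s σ g x Y Q → 1 ≤ β → c₁ ≡ 64 * β * ((1 + C) * (1 + C)) → c₂ ≡ 256 * β * suc B →
    κ ≡ 2 * c₁ + 4 * c₂ → s * s ≤ k → 1 ≤ s → k ≤ 2 * β * σ → σ ≤ 2 * suc β * x →
    2 * suc β * (c₂ * (2 * g)) ≤ σ →
    x * σ ≤ 16 * (Q + 2 * Y * ((1 + s * C) * (1 + s * C))) → κ * Y ≤ x →
    ∃[ H ] (4 * suc B * k * H ≤ Q × 2 * Y ≤ H × 2 * g ≤ H)
  many-queries B β C c₁ c₂ κ k s σ g x Y Q 1≤β c₁≡ c₂≡ κ≡ s²≤k 1≤s k≤ σ≤ g≤ x≤ Y≤ =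
    H , enough , below-quotient c₂ (2 * Y) (proj₂ (proj₂ quotient)) 2Y , below-quotient c₂ (2 * g) (proj₂ (proj₂ quotient)) 2g
    where
    open ≤-Reasoning
    quotient : ∃[ H ] (c₂ * H ≤ x × x < c₂ * suc H)
    quotient = divide x c₂ (subst (1 ≤_) (sym c₂≡) (*-mono-≤ {1} {256 * β} (*-mono-≤ {1} {256} (s≤s z≤n) 1≤β) (s≤s z≤n)))
    H e : ℕ
    H = proj₁ quotient
    e = (1 + C) * (1 + C)
    κY : 2 * c₁ * Y + 4 * c₂ * Y ≤ x
    κY = ≤-trans (≤-reflexive (trans (sym (*-distribʳ-+ Y (2 * c₁) (4 * c₂))) (cong (_* Y) (sym κ≡)))) Y≤
    2Y : c₂ * (2 * Y) ≤ x
    2Y = ≤-trans (linear (2 * c₂ * Y) ≤-refl (identity c₂ Y)) (≤-trans (m≤n+m (4 * c₂ * Y) (2 * c₁ * Y)) κY)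
      where
      identity : ∀ c Y → c * (2 * Y) + 0 + 2 * c * Y ≡ 4 * c * Y + 0
      identity = solve-∀
    2g : c₂ * (2 * g) ≤ x
    2g = *-cancelˡ-≤ (2 * suc β) (≤-trans g≤ σ≤)
    part : (1 + s * C) * (1 + s * C) ≤ k * e
    part = begin
      (1 + s * C) * (1 + s * C)           ≤⟨ square-mono (+-monoˡ-≤ (s * C) 1≤s) ⟩
      (s + s * C) * (s + s * C)           ≡⟨ identity s C ⟩
      s * s * ((1 + C) * (1 + C))         ≤⟨ *-monoˡ-≤ e s²≤k ⟩
      k * e                               ∎
      where
      identity : ∀ s C → (s + s * C) * (s + s * C) ≡ s * s * ((1 + C) * (1 + C))
      identity = solve-∀
    xk : x * k ≤ 32 * β * Q + c₁ * Y * k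
    xk = begin
      x * k                                           ≤⟨ *-monoʳ-≤ x k≤ ⟩
      x * (2 * β * σ)                                 ≡⟨ swap x β σ ⟩
      2 * β * (x * σ)                                 ≤⟨ *-monoʳ-≤ (2 * β) (≤-trans x≤ (*-monoʳ-≤ 16 (+-monoʳ-≤ Q (*-monoʳ-≤ (2 * Y) part)))) ⟩
      2 * β * (16 * (Q + 2 * Y * (k * e)))            ≡⟨ identity β Q Y k e ⟩
      32 * β * Q + 64 * β * e * Y * k                 ≡⟨ cong (λ c → 32 * β * Q + c * Y * k) (sym c₁≡) ⟩
      32 * β * Q + c₁ * Y * k                         ∎
      where
      swap : ∀ x β σ → x * (2 * β * σ) ≡ 2 * β * (x * σ)
      swap = solve-∀
      identity : ∀ β Q Y k e → 2 * β * (16 * (Q + 2 * Y * (k * e))) ≡ 32 * β * Q + 64 * β * e * Y * k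
      identity = solve-∀
    xk≤ : x * k ≤ 64 * β * Q
    xk≤ = linear 0 (+-mono-≤ (*-monoʳ-≤ 2 xk) (*-monoˡ-≤ k (≤-trans (m≤m+n (2 * c₁ * Y) (4 * c₂ * Y)) κY))) (identity (x * k) β Q c₁ Y k)
      where
      identity : ∀ z β Q c Y k → z + (2 * (32 * β * Q + c * Y * k) + z) + 0 ≡ 64 * β * Q + (2 * z + 2 * c * Y * k)
      identity = solve-∀
    enough : 4 * suc B * k * H ≤ Q
    enough = *-cancelˡ-≤ (64 * β) {{>-nonZero (*-mono-≤ {1} {64} (s≤s z≤n) 1≤β)}} (begin
      64 * β * (4 * suc B * k * H)        ≡⟨ identity β (suc B) k H ⟩
      256 * β * suc B * H * k             ≡⟨ cong (λ c → c * H * k) (sym c₂≡) ⟩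
      c₂ * H * k                          ≤⟨ *-monoˡ-≤ k (proj₁ (proj₂ quotient)) ⟩
      x * k                               ≤⟨ xk≤ ⟩
      64 * β * Q                          ∎)
      where
      identity : ∀ β B k H → 64 * β * (4 * B * k * H) ≡ 256 * β * B * H * k
      identity = solve-∀

  -- Absorbing the roundings `suc s ≤ 2 * s`, `3 + μ ≤ 4 * μ` and `suc t ≤ 2 * t` costs (2 · 4 · 2)²
  -- = 256.
  order-bound : ∀ Γ k s μ t → k < suc s * suc s → s < Γ * (3 + μ) * suc t → 1 ≤ s → 1 ≤ μ → 1 ≤ t →
    k ≤ 256 * (Γ * Γ) * (μ * μ) * (t * t)
  order-bound Γ k s μ t k< s< 1≤s 1≤μ 1≤t = begin
    k                                             ≤⟨ <⇒≤ k< ⟩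
    suc s * suc s                                 ≤⟨ square-mono (+-monoˡ-≤ s 1≤s) ⟩
    (s + s) * (s + s)                             ≤⟨ square-mono (+-mono-≤ s≤ s≤) ⟩
    (Γ * (4 * μ) * (2 * t) + Γ * (4 * μ) * (2 * t)) * (Γ * (4 * μ) * (2 * t) + Γ * (4 * μ) * (2 * t))  ≡⟨ identity Γ μ t ⟩
    256 * (Γ * Γ) * (μ * μ) * (t * t)             ∎
    where
    open ≤-Reasoning
    s≤ : s ≤ Γ * (4 * μ) * (2 * t)
    s≤ = ≤-trans (<⇒≤ s<) (*-mono-≤ (*-monoʳ-≤ Γ (≤-trans (+-monoˡ-≤ μ (*-monoʳ-≤ 3 1≤μ)) (≤-reflexive (four μ))))
      (≤-trans (+-monoˡ-≤ t 1≤t) (≤-reflexive (cong (t +_) (sym (+-identityʳ t))))))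
      where
      four : ∀ μ → 3 * μ + μ ≡ 4 * μ
      four = solve-∀
    identity : ∀ Γ μ t → (Γ * (4 * μ) * (2 * t) + Γ * (4 * μ) * (2 * t)) * (Γ * (4 * μ) * (2 * t) + Γ * (4 * μ) * (2 * t))
      ≡ 256 * (Γ * Γ) * (μ * μ) * (t * t)
    identity = solve-∀

-- The probabilities of the two rounds

module Parameters where

  open FiniteSums using (#; sum-allFin; ι; ∑-cong)
  open Rationals
  open import Defs using (Graph; adj; degree; ℕ→ℚ)
  open import Data.Bool using (true; false; if_then_else_)
  import Data.Integer as ℤ
  import Data.Integer.Properties as ℤ
  open import Data.Nat as ℕ using (ℕ; suc; z≤n; s≤s)
  import Data.Nat.Properties as ℕ
  open import Data.Nat.Tactic.RingSolver using () renaming (solve-∀ to ℕ-solve-∀)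
  open import Data.Product using (∃-syntax; _×_; _,_)
  open import Data.Rational using (ℚ; 0ℚ; 1ℚ; ½; _+_; _*_; _-_; -_; _≤_; _<_; *≤*; *<*; mkℚ; 1/_; positive; NonZero)
  open import Data.Rational.Properties
  import Data.Rational.Unnormalised as ℚᵘ
  import Data.Rational.Unnormalised.Properties as ℚᵘ
  open import Relation.Binary.PropositionalEquality using (_≡_; refl; sym; trans; cong; cong₂; subst; subst₂)
  open import Tactic.RingSolver using (solve-∀)

  ceiling : ∀ x → ∃[ N ] x ≤ ℕ→ℚ N
  ceiling x@(mkℚ (ℤ.-[1+ _ ]) d c) = 0 , *≤* ℤ.-≤+
  ceiling x@(mkℚ (ℤ.+ a) d c) = a , toℚᵘ-cancel-≤ (ℚᵘ.≤-respʳ-≃ (ℚᵘ.≃-sym (toℚᵘ-fromℚᵘ (ℚᵘ.mkℚᵘ (ℤ.+ a) 0)))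
    (ℚᵘ.*≤* (subst₂ ℤ._≤_ (ℤ.pos-* a 1) (ℤ.pos-* a (suc d)) (ℤ.+≤+ (ℕ.*-monoʳ-≤ a (s≤s z≤n))))))

  0<½ : 0ℚ < ½
  0<½ = *<* (ℤ.+<+ (s≤s z≤n))

  -- `p₂` is `(p - p₁) / (1 - p₁)`, the solution of 1 - p = (1 - p₁)(1 - p₂). The bound `p ≤ ½`
  -- keeps the divisor positive, and a divisor of at most 1 gives `p - p₁ ≤ p₂`.
  two-rounds : ∀ p p₁ → 0ℚ ≤ p₁ → p₁ ≤ p → p ≤ ½ →
    ∃[ p₂ ] (0ℚ ≤ p₂ × p₂ ≤ 1ℚ × p ≡ p₁ + (1ℚ - p₁) * p₂ × p - p₁ ≤ p₂)
  two-rounds p p₁ 0≤p₁ p₁≤p p≤½ = p₂ , 0≤p₂ , p₂≤1 , split , lower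
    where
    r : ℚ
    r = 1ℚ - p₁
    0<r : 0ℚ < r
    0<r = <-≤-trans 0<½ (linearℚ 0ℚ ≤-refl (≤-trans p₁≤p p≤½) (identity p₁))
      where
      identity : ∀ p₁ → ½ + ½ + 0ℚ ≡ 1ℚ - p₁ + p₁
      identity = solve-∀ ℚ-ring
    instance
      r-nonzero : NonZero r
      r-nonzero = pos⇒nonZero r {{positive 0<r}}
    p₂ : ℚ
    p₂ = (p - p₁) * 1/ r
    0≤1/r : 0ℚ ≤ 1/ r
    0≤1/r = <⇒≤ (positive⁻¹ (1/ r) {{1/pos⇒pos r {{positive 0<r}}}})
    0≤p-p₁ : 0ℚ ≤ p - p₁
    0≤p-p₁ = linearℚ 0ℚ ≤-refl p₁≤p (identity p p₁)
      where
      identity : ∀ p p₁ → 0ℚ + p + 0ℚ ≡ p - p₁ + p₁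
      identity = solve-∀ ℚ-ring
    0≤p₂ : 0ℚ ≤ p₂
    0≤p₂ = 0≤* 0≤p-p₁ 0≤1/r
    p₂≤1 : p₂ ≤ 1ℚ
    p₂≤1 = ≤-trans (*-monoʳ 0≤1/r (+-monoˡ-≤ (- p₁) (≤-trans p≤½ ½≤1))) (≤-reflexive (*-inverseʳ r))
    split : p ≡ p₁ + r * p₂
    split = sym (trans (cong (p₁ +_) (trans (regroup r (p - p₁) (1/ r)) (trans (cong ((p - p₁) *_) (*-inverseʳ r)) (*-identityʳ (p - p₁))))) (cancel p₁ p))
      where
      regroup : ∀ r x y → r * (x * y) ≡ x * (r * y)
      regroup = solve-∀ ℚ-ring
      cancel : ∀ a b → a + (b - a) ≡ b
      cancel = solve-∀ ℚ-ring
    lower : p - p₁ ≤ p₂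
    lower = linearℚ 0ℚ ≤-refl (0≤* 0≤p₁ 0≤p₂) (trans (cong (λ x → x - p₁ + p₁ * p₂ + 0ℚ) split) (identity p₁ p₂))
      where
      identity : ∀ p₁ p₂ → p₁ + (1ℚ - p₁) * p₂ - p₁ + p₁ * p₂ + 0ℚ ≡ p₂ + 0ℚ
      identity = solve-∀ ℚ-ring

  module Chances (ε : ℚ) (B Nε k : ℕ) (0<ε : 0ℚ < ε) (1≤Bε : 1ℚ ≤ ℕ→ℚ (suc B) * ε) (ε≤Nε : ε ≤ ℕ→ℚ Nε)
    (k-large : 2 ℕ.* suc Nε ℕ.≤ suc k) where

    -- `h` is `1 / (2 * suc B)`, at most ε / 2; its index is the normal form of `2 * suc B` without
    -- the leading `suc`. The degree is `suc k` here, so `u` is its inverse.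
    h u p p₁ : ℚ
    h = unit (B ℕ.+ suc (B ℕ.+ 0))
    u = unit k
    p = (1ℚ + ε) * u
    p₁ = (1ℚ + h) * u

    h-inverse : h * ℕ→ℚ (2 ℕ.* suc B) ≡ 1ℚ
    h-inverse = unit-inverse (B ℕ.+ suc (B ℕ.+ 0))

    0≤h : 0ℚ ≤ h
    0≤h = 0≤unit (B ℕ.+ suc (B ℕ.+ 0))

    h+h≤ε : h + h ≤ ε
    h+h≤ε = begin
      h + h                                   ≡⟨ identity h ⟩
      h * ((1ℚ + 1ℚ) * 1ℚ)                    ≤⟨ *-monoˡ 0≤h (*-monoˡ (0≤+ 0≤1 0≤1) 1≤Bε) ⟩
      h * ((1ℚ + 1ℚ) * (ℕ→ℚ (suc B) * ε))     ≡⟨ regroup h (1ℚ + 1ℚ) (ℕ→ℚ (suc B)) ε ⟩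
      h * ((1ℚ + 1ℚ) * ℕ→ℚ (suc B)) * ε       ≡⟨ cong (λ x → h * x * ε) (sym (ℕ→ℚ-* 2 (suc B))) ⟩
      h * ℕ→ℚ (2 ℕ.* suc B) * ε               ≡⟨ trans (cong (_* ε) h-inverse) (*-identityˡ ε) ⟩
      ε                                       ∎
      where
      open ≤-Reasoning
      identity : ∀ h → h + h ≡ h * ((1ℚ + 1ℚ) * 1ℚ)
      identity = solve-∀ ℚ-ring
      regroup : ∀ h t b e → h * (t * (b * e)) ≡ h * (t * b) * e
      regroup = solve-∀ ℚ-ring

    0≤u : 0ℚ ≤ u
    0≤u = 0≤unit k

    0≤p₁ : 0ℚ ≤ p₁
    0≤p₁ = 0≤* (0≤+ 0≤1 0≤h) 0≤u

    hu≤p-p₁ : h * u ≤ p - p₁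
    hu≤p-p₁ = linearℚ 0ℚ ≤-refl (*-monoʳ 0≤u h+h≤ε) (identity h u ε)
      where
      identity : ∀ h u ε → h * u + ε * u + 0ℚ ≡ (1ℚ + ε) * u - (1ℚ + h) * u + (h + h) * u
      identity = solve-∀ ℚ-ring

    p₁≤p : p₁ ≤ p
    p₁≤p = linearℚ 0ℚ ≤-refl (≤-trans (0≤* 0≤h 0≤u) hu≤p-p₁) (identity p p₁)
      where
      identity : ∀ p p₁ → p₁ + (p - p₁) + 0ℚ ≡ p + 0ℚ
      identity = solve-∀ ℚ-ring

    p≤½ : p ≤ ½
    p≤½ = begin
      (1ℚ + ε) * u                       ≤⟨ *-monoʳ 0≤u (+-monoʳ-≤ 1ℚ ε≤Nε) ⟩
      (1ℚ + ℕ→ℚ Nε) * u                  ≡⟨ cong (_* u) (sym (ℕ→ℚ-suc Nε)) ⟩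
      ℕ→ℚ (suc Nε) * u                   ≡⟨ cong (_* u) (*-identityˡ (ℕ→ℚ (suc Nε))) ⟨
      ½ * ℕ→ℚ 2 * ℕ→ℚ (suc Nε) * u       ≡⟨ cong (_* u) (trans (*-assoc ½ (ℕ→ℚ 2) (ℕ→ℚ (suc Nε))) (cong (½ *_) (sym (ℕ→ℚ-* 2 (suc Nε))))) ⟩
      ½ * ℕ→ℚ (2 ℕ.* suc Nε) * u         ≤⟨ *-monoʳ 0≤u (*-monoˡ 0≤½ (ℕ→ℚ-mono k-large)) ⟩
      ½ * ℕ→ℚ (suc k) * u                ≡⟨ regroup ½ (ℕ→ℚ (suc k)) u ⟩
      ½ * (u * ℕ→ℚ (suc k))              ≡⟨ trans (cong (½ *_) (unit-inverse k)) (*-identityʳ ½) ⟩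
      ½                                  ∎
      where
      open ≤-Reasoning
      regroup : ∀ h k u → h * k * u ≡ h * (u * k)
      regroup = solve-∀ ℚ-ring

    p₁≤1 : p₁ ≤ 1ℚ
    p₁≤1 = ≤-trans p₁≤p (≤-trans p≤½ ½≤1)

    -- β = 8 (B + 1) and L = k - ⌊k / β⌋.
    drift : ∀ L → 8 ℕ.* suc B ℕ.* suc k ℕ.≤ 8 ℕ.* suc B ℕ.* L ℕ.+ suc k →
      ℕ→ℚ (2 ℕ.+ 8 ℕ.* suc B) ≤ ℕ→ℚ (8 ℕ.* suc B) * (ℕ→ℚ L * p₁)
    -- The choice of β gives `h * β = 4`, so β L p₁ is at least (β - 1)(1 + h) = β + 3 - h; what
    -- exceeds β + 2 is the slack `1ℚ - h`.
    drift L bound = linearℚ (1ℚ - h) (0≤1- h≤1) (*-monoʳ (0≤* (0≤+ 0≤1 0≤h) 0≤u) bound′) eq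
      where
      b : ℚ
      b = ℕ→ℚ (8 ℕ.* suc B)
      bound′ : b * ℕ→ℚ (suc k) ≤ b * ℕ→ℚ L + ℕ→ℚ (suc k)
      bound′ = subst₂ _≤_ (ℕ→ℚ-* (8 ℕ.* suc B) (suc k))
        (trans (ℕ→ℚ-+ (8 ℕ.* suc B ℕ.* L) (suc k)) (cong (_+ ℕ→ℚ (suc k)) (ℕ→ℚ-* (8 ℕ.* suc B) L))) (ℕ→ℚ-mono bound)
      h≤1 : h ≤ 1ℚ
      h≤1 = subst (_≤ 1ℚ) (*-identityˡ h) (ℕ→ℚ-*-≤1 {1} {2 ℕ.* suc B} 0≤h (s≤s z≤n) (trans (*-comm (ℕ→ℚ (2 ℕ.* suc B)) h) h-inverse))
      hb : h * b ≡ ℕ→ℚ 4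
      hb = trans (cong (λ n → h * ℕ→ℚ n) (regroup B)) (trans (cong (h *_) (ℕ→ℚ-* (2 ℕ.* suc B) 4))
        (trans (sym (*-assoc h (ℕ→ℚ (2 ℕ.* suc B)) (ℕ→ℚ 4))) (trans (cong (_* ℕ→ℚ 4) h-inverse) (*-identityˡ (ℕ→ℚ 4)))))
        where
        regroup : ∀ B → 8 ℕ.* suc B ≡ 2 ℕ.* suc B ℕ.* 4
        regroup = ℕ-solve-∀
      K : ℚ
      K = ℕ→ℚ (suc k)
      X : ℚ
      X = b * (ℕ→ℚ L * ((1ℚ + h) * u))
      eq : ℕ→ℚ (2 ℕ.+ 8 ℕ.* suc B) + (b * ℕ→ℚ L + K) * ((1ℚ + h) * u) + (1ℚ - h) ≡ X + b * K * ((1ℚ + h) * u)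
      eq = trans (cong (λ x → x + (b * ℕ→ℚ L + K) * ((1ℚ + h) * u) + (1ℚ - h)) (ℕ→ℚ-+ 2 (8 ℕ.* suc B)))
        (trans (expand (ℕ→ℚ 2) b (ℕ→ℚ L) K h u)
        (trans (cong (λ x → ℕ→ℚ 2 + b + x * (1ℚ + h) + (1ℚ - h) + X) (unit-inverse k))
        (trans (collect (ℕ→ℚ 2) b h X) (sym
        (trans (expand′ X b K h u)
        (trans (cong₂ (λ x y → X + x * (b + y)) (unit-inverse k) hb) (collect′ X b (ℕ→ℚ 4))))))))
        where
        expand : ∀ t b l K h u → t + b + (b * l + K) * ((1ℚ + h) * u) + (1ℚ - h)
          ≡ t + b + u * K * (1ℚ + h) + (1ℚ - h) + b * (l * ((1ℚ + h) * u))
        expand = solve-∀ ℚ-ring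
        collect : ∀ t b h X → t + b + 1ℚ * (1ℚ + h) + (1ℚ - h) + X ≡ b + (t + 1ℚ + 1ℚ) + X
        collect = solve-∀ ℚ-ring
        expand′ : ∀ X b K h u → X + b * K * ((1ℚ + h) * u) ≡ X + u * K * (b + h * b)
        expand′ = solve-∀ ℚ-ring
        collect′ : ∀ X b f → X + 1ℚ * (b + f) ≡ b + f + X
        collect′ = solve-∀ ℚ-ring

    second-round : ∀ p₂ → p - p₁ ≤ p₂ → ℕ→ℚ 2 ≤ ℕ→ℚ (4 ℕ.* suc B ℕ.* suc k) * p₂
    second-round p₂ lower = begin
      ℕ→ℚ 2                                              ≡⟨ trans (cong₂ (λ x y → ℕ→ℚ 2 * x * y) h-inverse (unit-inverse k)) refl ⟨
      ℕ→ℚ 2 * (h * ℕ→ℚ (2 ℕ.* suc B)) * (u * ℕ→ℚ (suc k))  ≡⟨ regroup (ℕ→ℚ 2) h (ℕ→ℚ (2 ℕ.* suc B)) u (ℕ→ℚ (suc k)) ⟩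
      ℕ→ℚ 2 * ℕ→ℚ (2 ℕ.* suc B) * ℕ→ℚ (suc k) * (h * u)    ≡⟨ cong (_* (h * u)) (trans (cong (_* ℕ→ℚ (suc k)) (sym (ℕ→ℚ-* 2 (2 ℕ.* suc B)))) (trans (sym (ℕ→ℚ-* (2 ℕ.* (2 ℕ.* suc B)) (suc k))) (cong (λ n → ℕ→ℚ (n ℕ.* suc k)) (sym (ℕ.*-assoc 2 2 (suc B)))))) ⟩
      ℕ→ℚ (4 ℕ.* suc B ℕ.* suc k) * (h * u)              ≤⟨ *-monoˡ (0≤ℕ→ℚ (4 ℕ.* suc B ℕ.* suc k)) (≤-trans hu≤p-p₁ lower) ⟩
      ℕ→ℚ (4 ℕ.* suc B ℕ.* suc k) * p₂                   ∎
      where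
      open ≤-Reasoning
      regroup : ∀ t h b u k → t * (h * b) * (u * k) ≡ t * b * k * (h * u)
      regroup = solve-∀ ℚ-ring

  degree≡# : ∀ {n} (G : Graph n) u → degree G u ≡ # (adj G u)
  degree≡# {n} G u = trans (sum-allFin n (λ v → if adj G u v then 1 else 0)) (∑-cong (λ v → lem (adj G u v)))
    where
    lem : ∀ b → (if b then 1 else 0) ≡ ι b
    lem true  = refl
    lem false = refl

-- Choice of the parameters for large `k`

module LargeDegree where

  open FiniteSums using (#; #≤n; linear)
  open Rationals hiding (<⇒≱)
  open RandomEdges using (module Percolation)
  open TwoRounds using (module Combine)
  open Logarithms
  open Parameters
  open QueryCounts
  open import Defs using (Graph; adj; MinDegreeAtLeast; HasCliqueMinor; edges; keptAdj; ProbAtLeast; pOf; ℕ→ℚ; AtLeastBound)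
  open import Data.Empty using (⊥-elim)
  open import Data.Fin using (zero)
  open import Data.Nat using (ℕ; zero; suc; _+_; _*_; _^_; _∸_; _≤_; _<_; z≤n; s≤s; >-nonZero)
  open import Data.Nat.Properties hiding (_≟_)
  open import Data.Nat.Tactic.RingSolver using (solve-∀)
  open import Data.Product using (∃-syntax; _×_; _,_; proj₁; proj₂)
  open import Data.Rational using (ℚ; 0ℚ; 1ℚ; ½; _-_) renaming (_+_ to _+ℚ_; _*_ to _*ℚ_; _≤_ to _≤ℚ_; _<_ to _<ℚ_)
  import Data.Rational.Properties as ℚ
  open import Data.Sum using (_⊎_; inj₁; inj₂; [_,_]′)
  open import Relation.Binary.PropositionalEquality using (_≡_; sym; trans; cong; subst)
  import Tactic.RingSolver as Solver

  -- ε enters through B and Nε, where 1/(B+1) ≤ ε ≤ Nε, and η through f₀ and g₀.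
  module Bounds (ε : ℚ) (B Nε : ℕ) (0<ε : 0ℚ <ℚ ε) (1≤Bε : 1ℚ ≤ℚ ℕ→ℚ (suc B) *ℚ ε) (ε≤Nε : ε ≤ℚ ℕ→ℚ Nε)
    (β c₁ c₂ κ Γ Λ : ℕ) (β≡ : β ≡ 8 * suc B) (c₁≡ : c₁ ≡ 64 * β * ((1 + 2 * suc β) * (1 + 2 * suc β)))
    (c₂≡ : c₂ ≡ 256 * β * suc B) (κ≡ : κ ≡ 2 * c₁ + 4 * c₂) (Γ≡ : Γ ≡ 1152 * (2 * suc β * κ)) (Λ≡ : suc Λ ≡ 256 * (Γ * Γ))
    (1≤β : 1 ≤ β) (1≤Γ : 1 ≤ Γ)
    (η : ℚ) (0<η : 0ℚ <ℚ η) (Nτ f₀ g₀ : ℕ) (Nτ≡ : suc Nτ ≡ 2 * (suc β * (2 + β)))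
    (f₀-big : 1ℚ ≤ℚ η ** β *ℚ (ℕ→ℚ f₀ *ℚ (½ *ℚ unit Nτ))) (g₀-big : 1ℚ ≤ℚ ℕ→ℚ g₀ *ℚ η) where

    -- Each summand of `N` is one lower bound on `s`: `τ₁` for `small-parts`, `τ₂` for more than
    -- `4 * f₀` roots, `τ₃` for enough query blocks, `2 * suc Nε` for p ≤ ½, and the last one for
    -- `1 ≤ t` and `2 ≤ s`.
    C τ₁ τ₂ τ₃ N : ℕ
    C = 2 * suc β
    τ₁ = 8 * β * (1 + C)
    τ₂ = β * (4 * suc β * suc (4 * f₀))
    τ₃ = β * (2 * suc β * (c₂ * (2 * g₀)))
    N = τ₁ + (τ₂ + (τ₃ + (2 * suc Nε + (Γ * (Γ + 7) + 2))))

    module _ (k′ : ℕ) (N²≤k : N * N ≤ suc k′) where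

      k : ℕ
      k = suc k′

      root : ∃[ s ] (s * s ≤ k × k < suc s * suc s)
      root = square-root k

      s : ℕ
      s = proj₁ root

      s²≤k : s * s ≤ k
      s²≤k = proj₁ (proj₂ root)

      k<s² : k < suc s * suc s
      k<s² = proj₂ (proj₂ root)

      N≤s : N ≤ s
      N≤s = below-root N k<s² N²≤k

      τ₁≤s : τ₁ ≤ s
      τ₁≤s = ≤-trans (m≤m+n τ₁ _) N≤s

      τ₂≤s : τ₂ ≤ s
      τ₂≤s = ≤-trans (≤-trans (m≤m+n τ₂ _) (m≤n+m _ τ₁)) N≤s

      τ₃≤s : τ₃ ≤ s
      τ₃≤s = ≤-trans (≤-trans (≤-trans (m≤m+n τ₃ _) (m≤n+m _ τ₂)) (m≤n+m _ τ₁)) N≤s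

      Nε≤s : 2 * suc Nε ≤ s
      Nε≤s = ≤-trans (≤-trans (≤-trans (≤-trans (m≤m+n (2 * suc Nε) _) (m≤n+m _ τ₃)) (m≤n+m _ τ₂)) (m≤n+m _ τ₁)) N≤s

      Γ+2≤N : Γ * (Γ + 7) + 2 ≤ N
      Γ+2≤N = ≤-trans (≤-trans (≤-trans (m≤n+m _ (2 * suc Nε)) (m≤n+m _ τ₃)) (m≤n+m _ τ₂)) (m≤n+m _ τ₁)

      2≤s : 2 ≤ s
      2≤s = ≤-trans (≤-trans (m≤n+m 2 (Γ * (Γ + 7))) Γ+2≤N) N≤s

      1≤s : 1 ≤ s
      1≤s = ≤-trans (s≤s z≤n) 2≤s

      s≤s² : s ≤ s * s
      s≤s² = m≤m*n s s {{>-nonZero 1≤s}}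

      s≤k : s ≤ k
      s≤k = ≤-trans s≤s² s²≤k

      quotient : ∃[ σ ] (β * σ ≤ k × k < β * suc σ)
      quotient = divide k β 1≤β

      σ : ℕ
      σ = proj₁ quotient

      βσ≤k : β * σ ≤ k
      βσ≤k = proj₁ (proj₂ quotient)

      ≤σ : ∀ c → β * c ≤ k → c ≤ σ
      ≤σ c h = below-quotient β c (proj₂ (proj₂ quotient)) h

      small-parts : 8 * (1 + s * C) ≤ σ
      small-parts = ≤σ _ (begin
        β * (8 * (1 + s * C))       ≤⟨ *-monoʳ-≤ β (*-monoʳ-≤ 8 (+-monoˡ-≤ (s * C) 1≤s)) ⟩
        β * (8 * (s + s * C))       ≡⟨ identity β s C ⟩
        8 * β * (1 + C) * s         ≤⟨ *-monoˡ-≤ s τ₁≤s ⟩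
        s * s                       ≤⟨ s²≤k ⟩
        k                           ∎)
        where
        open ≤-Reasoning
        identity : ∀ β s C → β * (8 * (s + s * C)) ≡ 8 * β * (1 + C) * s
        identity = solve-∀

      1≤σ : 1 ≤ σ
      1≤σ = ≤-trans (s≤s z≤n) small-parts

      k≤2βσ : k ≤ 2 * β * σ
      k≤2βσ = ≤-trans (<⇒≤ (proj₂ (proj₂ quotient))) (≤-trans (*-monoʳ-≤ β (+-monoˡ-≤ σ 1≤σ)) (≤-reflexive (identity β σ)))
        where
        identity : ∀ β σ → β * (σ + σ) ≡ 2 * β * σ
        identity = solve-∀

      g₀≤σ : 2 * suc β * (c₂ * (2 * g₀)) ≤ σ
      g₀≤σ = ≤σ _ (≤-trans τ₃≤s s≤k)

      -- The quotient of σ by `D` is the largest number of roots that `few-roots` permits, of order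
      -- √k.
      D : ℕ
      D = 4 * suc β * s

      1≤D : 1 ≤ D
      1≤D = *-mono-≤ {1} {4 * suc β} (s≤s z≤n) 1≤s

      roots : ∃[ ρ ] (D * ρ ≤ σ × σ < D * suc ρ)
      roots = divide σ D 1≤D

      ρ : ℕ
      ρ = proj₁ roots

      4f₀<ρ : suc (4 * f₀) ≤ ρ
      4f₀<ρ = below-quotient D (suc (4 * f₀)) (proj₂ (proj₂ roots)) (≤σ _ (≤-trans (≤-reflexive (identity β (4 * suc β) s (suc (4 * f₀))))
        (≤-trans (*-monoˡ-≤ s τ₂≤s) s²≤k)))
        where
        identity : ∀ β b s f → β * (b * s * f) ≡ β * (b * f) * s
        identity = solve-∀

      few-roots : 4 * suc β * (ρ * s) ≤ σ
      few-roots = ≤-trans (≤-reflexive (identity (4 * suc β) ρ s)) (proj₁ (proj₂ roots))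
        where
        identity : ∀ b ρ s → b * (ρ * s) ≡ b * s * ρ
        identity = solve-∀

      σ≤k : σ ≤ k
      σ≤k = ≤-trans (m≤n*m σ β {{>-nonZero 1≤β}}) βσ≤k

      ρ≤k : ρ ≤ k
      ρ≤k = ≤-trans (≤-trans (m≤n*m ρ D {{>-nonZero 1≤D}}) (proj₁ (proj₂ roots))) σ≤k

      L : ℕ
      L = k ∸ σ

      σ+L : σ + L ≡ k
      σ+L = m+[n∸m]≡n σ≤k

      logarithm : ∃[ μ ] (2 ^ (μ * μ) ≤ k × k < 2 ^ (suc μ * suc μ))
      logarithm = square-logarithm k (s≤s z≤n)

      μ : ℕ
      μ = proj₁ logarithm

      1≤μ : 1 ≤ μ
      1≤μ = positive μ (proj₂ (proj₂ logarithm))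
        where
        positive : ∀ μ → k < 2 ^ (suc μ * suc μ) → 1 ≤ μ
        positive zero    h = ⊥-elim (<⇒≱ h (≤-trans 2≤s s≤k))
        positive (suc _) _ = s≤s z≤n

      E : ℕ
      E = Γ * (3 + μ)

      1≤E : 1 ≤ E
      1≤E = *-mono-≤ {1} {Γ} {1} {3 + μ} 1≤Γ (s≤s z≤n)

      order : ∃[ t ] (E * t ≤ s × s < E * suc t)
      order = divide s E 1≤E

      t : ℕ
      t = proj₁ order

      1≤t : 1 ≤ t
      1≤t = below-quotient E 1 (proj₂ (proj₂ order)) (≤-trans (≤-reflexive (*-identityʳ E))
        (below-root E k<s² (root-beats-log Γ k μ (≤-trans (square-mono (≤-trans (m≤m+n (Γ * (Γ + 7)) 2) Γ+2≤N)) N²≤k) (proj₁ (proj₂ logarithm)))))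

      -- `m = μ + 1` gives `k < 2 ^ (m * m)`, from which `few` follows. `d` is the smallest value
      -- that meets `room`, and `E` carries the same factor 2 + m = 3 + μ, so that `E * t ≤ s`
      -- becomes `d-small`.
      m d : ℕ
      m = suc μ
      d = 192 * (6 * (2 + m) * t)

      d-small : d * (2 * suc β * κ) ≤ s
      d-small = ≤-trans (≤-reflexive (trans (identity (2 * suc β * κ) μ t) (cong (λ x → x * (3 + μ) * t) (sym Γ≡)))) (proj₁ (proj₂ order))
        where
        identity : ∀ c μ t → 192 * (6 * (2 + suc μ) * t) * c ≡ 1152 * c * (3 + μ) * t
        identity = solve-∀

      few : 2 * t < 2 ^ (m * (6 * (2 + m)))
      few = <-≤-trans (*-monoʳ-< 2 (≤-<-trans (≤-trans t≤s s≤k) (proj₂ (proj₂ logarithm)))) (^-monoʳ-≤ 2 (exponent m (s≤s z≤n)))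
        where
        t≤s : t ≤ s
        t≤s = ≤-trans (m≤n*m t E {{>-nonZero 1≤E}}) (proj₁ (proj₂ order))
        exponent : ∀ m → 1 ≤ m → suc (m * m) ≤ m * (6 * (2 + m))
        exponent m 1≤m = ≤-trans (+-monoˡ-≤ (m * m) 1≤m) (linear (11 * m + 5 * (m * m)) (≤-refl {0}) (identity m))
          where
          identity : ∀ m → m + m * m + 0 + (11 * m + 5 * (m * m)) ≡ m * (6 * (2 + m)) + 0
          identity = solve-∀

      bound : AtLeastBound (½ *ℚ unit Λ) k t
      bound = atLeastBound Λ k μ t 1≤t (proj₁ (proj₂ logarithm))
        (≤-trans (order-bound Γ k s μ t k<s² (proj₂ (proj₂ order)) 1≤s 1≤μ 1≤t)
          (≤-reflexive (cong (λ x → x * (μ * μ) * (t * t)) (sym Λ≡))))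

      open Chances ε B Nε k′ 0<ε 1≤Bε ε≤Nε (≤-trans Nε≤s s≤k) using (p₁; 0≤p₁; p₁≤1; p₁≤p; p≤½; drift; second-round)

      rounds : ∃[ p₂ ] (0ℚ ≤ℚ p₂ × p₂ ≤ℚ 1ℚ × pOf ε k ≡ p₁ +ℚ (1ℚ - p₁) *ℚ p₂ × pOf ε k - p₁ ≤ℚ p₂)
      rounds = two-rounds (pOf ε k) p₁ 0≤p₁ p₁≤p p≤½

      p₂ τ : ℚ
      p₂ = proj₁ rounds
      τ = unit Nτ

      τ-eq : ℕ→ℚ (2 * (suc β * (2 + β))) *ℚ τ ≡ 1ℚ
      τ-eq = trans (cong (λ x → ℕ→ℚ x *ℚ τ) (sym Nτ≡)) (trans (ℚ.*-comm (ℕ→ℚ (suc Nτ)) τ) (unit-inverse Nτ))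

      τ≤1 : τ ≤ℚ 1ℚ
      τ≤1 = subst (_≤ℚ 1ℚ) (ℚ.*-identityˡ τ) (ℕ→ℚ-*-≤1 {1} {2 * (suc β * (2 + β))} (0≤unit Nτ) (s≤s z≤n) τ-eq)

      drift′ : ℕ→ℚ (2 + β) ≤ℚ ℕ→ℚ β *ℚ (ℕ→ℚ L *ℚ p₁)
      drift′ = subst (λ b → ℕ→ℚ (2 + b) ≤ℚ ℕ→ℚ b *ℚ (ℕ→ℚ L *ℚ p₁)) (sym β≡)
        (drift L (subst (λ b → b * k ≤ b * L + k) β≡ (begin
          β * k             ≡⟨ cong (β *_) σ+L ⟨
          β * (σ + L)       ≡⟨ *-distribˡ-+ β σ L ⟩
          β * σ + β * L     ≤⟨ +-monoˡ-≤ (β * L) βσ≤k ⟩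
          k + β * L         ≡⟨ +-comm k (β * L) ⟩
          β * L + k         ∎)))
        where open ≤-Reasoning

      unlucky₁ : ∀ Y Q f → f₀ ≤ f → L * f ≤ Q → β * Y ≤ suc β * f →
        1ℚ ≤ℚ η *ℚ ((1ℚ - τ) ** Y *ℚ (1ℚ +ℚ p₁ *ℚ (1ℚ - (1ℚ - τ))) ** Q)
      unlucky₁ Y Q f h₁ h₂ h₃ = subst (λ x → 1ℚ ≤ℚ η *ℚ ((1ℚ - τ) ** Y *ℚ (1ℚ +ℚ p₁ *ℚ x) ** Q)) (cancel τ)
        (FewSuccesses.few-successes β L f₀ τ p₁ η (0≤unit Nτ) 0≤p₁ 0<η τ-eq drift′ f₀-big Y Q f h₁ h₂ h₃)
        where
        cancel : ∀ x → x ≡ 1ℚ - (1ℚ - x)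
        cancel = Solver.solve-∀ ℚ-ring

      unlucky₂ : ∀ x Y Q → σ ≤ 2 * suc β * x → x * σ ≤ 16 * (Q + 2 * Y * ((1 + s * C) * (1 + s * C))) →
        1ℚ ≤ℚ η *ℚ (½ ** Y *ℚ (1ℚ +ℚ p₂ *ℚ ½) ** Q) ⊎ x ≤ κ * Y
      unlucky₂ x Y Q h₁ h₂ = [ inj₂ , (λ h →
        let (H , TH≤Q , 2Y≤H , 2g≤H) = many-queries B β C c₁ c₂ κ k s σ g₀ x Y Q 1≤β c₁≡ c₂≡ κ≡ s²≤k 1≤s k≤2βσ h₁ g₀≤σ h₂ h in
        inj₁ (fewer-than-half (4 * suc B * k) g₀ p₂ η (proj₁ (proj₂ rounds)) (ℚ.<⇒≤ 0<η)
          (second-round p₂ (proj₂ (proj₂ (proj₂ (proj₂ rounds))))) g₀-big Y Q H TH≤Q 2Y≤H 2g≤H)) ]′ (≤-total x (κ * Y))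

      conclusion : ∀ n → 1 ≤ n → (G : Graph n) → MinDegreeAtLeast G k →
        ProbAtLeast G (pOf ε k) (λ H → ∃[ t ] (HasCliqueMinor H t × AtLeastBound (½ *ℚ unit Λ) k t)) (1ℚ - η - η)
      conclusion n 1≤n G δ≥k = Percolation.likely⇒probAtLeast (pOf ε k) p₁ p₂ 0≤p₁ p₁≤1
        (proj₁ (proj₂ rounds)) (proj₁ (proj₂ (proj₂ rounds))) (proj₁ (proj₂ (proj₂ (proj₂ rounds)))) G
        {λ H → ∃[ t ] (HasCliqueMinor H t × AtLeastBound (½ *ℚ unit Λ) k t)}
        (Combine.combine (pOf ε k) p₁ p₂ 0≤p₁ p₁≤1
          (proj₁ (proj₂ rounds)) (proj₁ (proj₂ (proj₂ rounds))) (proj₁ (proj₂ (proj₂ (proj₂ rounds)))) G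
          (λ x → ∃[ t ] (HasCliqueMinor (keptAdj (edges G) x) t × AtLeastBound (½ *ℚ unit Λ) k t)) t
          (λ _ minor → t , minor , bound)
          β σ L s ρ f₀ κ d m 1≤β degrees (≤-trans ρ≤k k≤n) 1≤s (≤-trans (s≤s z≤n) 4f₀<ρ) (≤-trans (n≤1+n (4 * f₀)) 4f₀<ρ)
          few-roots small-parts d-small 1≤t few ≤-refl η (1ℚ - τ) (ℚ.<⇒≤ 0<η) (0≤1- τ≤1) z≤1 unlucky₁ unlucky₂)
        where
        degrees : ∀ u → σ + L ≤ # (adj G u)
        degrees u = ≤-trans (≤-reflexive σ+L) (≤-trans (δ≥k u) (≤-reflexive (degree≡# G u)))
        k≤n : k ≤ n
        -- The minimum degree condition is vacuous on the empty graph, so a vertex has to be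
        -- produced from `1 ≤ n`; the roots require ρ ≤ n.
        k≤n = vertex n 1≤n G δ≥k
          where
          vertex : ∀ n → 1 ≤ n → (G : Graph n) → MinDegreeAtLeast G k → k ≤ n
          vertex (suc n) _ G δ≥k = ≤-trans (δ≥k zero) (≤-trans (≤-reflexive (degree≡# G zero)) (#≤n (adj G zero)))
        z≤1 : 1ℚ - τ ≤ℚ 1ℚ
        z≤1 = linearℚ 0ℚ ℚ.≤-refl (0≤unit Nτ) (identity τ)
          where
          identity : ∀ x → 1ℚ - x +ℚ x +ℚ 0ℚ ≡ 1ℚ +ℚ 0ℚ
          identity = Solver.solve-∀ ℚ-ring

-- The constants and the final quantifiers

module Conclusion where

  open Rationals
  open Parameters
  open LargeDegree
  open import Defs using (Graph; MinDegreeAtLeast; HasCliqueMinor; ProbAtLeast; pOf; ℕ→ℚ; AtLeastBound)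
  open import Data.Nat using (ℕ; suc; _+_; _*_; _≤_; z≤n; s≤s; pred; >-nonZero)
  import Data.Nat.Properties as ℕ
  open import Data.Product using (∃-syntax; _×_; _,_; proj₁; proj₂)
  open import Data.Rational using (ℚ; 0ℚ; 1ℚ; ½; _-_) renaming (_+_ to _+ℚ_; _*_ to _*ℚ_; _≤_ to _≤ℚ_; _<_ to _<ℚ_)
  import Data.Rational.Properties as ℚ
  open import Relation.Binary.PropositionalEquality using (_≡_; refl; trans; cong; subst)
  open import Tactic.RingSolver using (solve-∀)

  record Constants (B : ℕ) : Set where
    field
      β c₁ c₂ κ Γ Λ Nτ : ℕ
      β≡  : β ≡ 8 * suc B
      c₁≡ : c₁ ≡ 64 * β * ((1 + 2 * suc β) * (1 + 2 * suc β))
      c₂≡ : c₂ ≡ 256 * β * suc B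
      κ≡  : κ ≡ 2 * c₁ + 4 * c₂
      Γ≡  : Γ ≡ 1152 * (2 * suc β * κ)
      Λ≡  : suc Λ ≡ 256 * (Γ * Γ)
      1≤β : 1 ≤ β
      1≤Γ : 1 ≤ Γ
      Nτ≡ : suc Nτ ≡ 2 * (suc β * (2 + β))

  positive-* : ∀ {a b} → 1 ≤ a → 1 ≤ b → 1 ≤ a * b
  positive-* = ℕ.*-mono-≤

  constants : ∀ B → Constants B
  constants B = record
    { β = β ; c₁ = c₁ ; c₂ = c₂ ; κ = κ ; Γ = Γ ; Λ = pred (256 * (Γ * Γ)) ; Nτ = pred (2 * (suc β * (2 + β)))
    ; β≡ = refl ; c₁≡ = refl ; c₂≡ = refl ; κ≡ = refl ; Γ≡ = refl
    ; Λ≡ = ℕ.suc-pred (256 * (Γ * Γ)) {{>-nonZero (positive-* {256} (s≤s z≤n) (positive-* {Γ} {Γ} 1≤Γ 1≤Γ))}}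
    ; 1≤β = 1≤β ; 1≤Γ = 1≤Γ
    ; Nτ≡ = ℕ.suc-pred (2 * (suc β * (2 + β))) {{>-nonZero (positive-* {2} (s≤s z≤n) (positive-* {suc β} {2 + β} (s≤s z≤n) (s≤s z≤n)))}} }
    where
    β c₁ c₂ κ Γ : ℕ
    β = 8 * suc B
    c₁ = 64 * β * ((1 + 2 * suc β) * (1 + 2 * suc β))
    c₂ = 256 * β * suc B
    κ = 2 * c₁ + 4 * c₂
    Γ = 1152 * (2 * suc β * κ)
    1≤β : 1 ≤ β
    1≤β = positive-* {8} (s≤s z≤n) (s≤s z≤n)
    1≤κ : 1 ≤ κ
    1≤κ = ℕ.≤-trans (positive-* {4} {c₂} (s≤s z≤n) (positive-* {256 * β} {suc B} (positive-* {256} {β} (s≤s z≤n) 1≤β) (s≤s z≤n))) (ℕ.m≤n+m (4 * c₂) (2 * c₁))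
    1≤Γ : 1 ≤ Γ
    1≤Γ = positive-* {1152} (s≤s z≤n) (positive-* {2 * suc β} {κ} (positive-* {2} {suc β} (s≤s z≤n) (s≤s z≤n)) 1≤κ)

  module _ (ε : ℚ) (0<ε : 0ℚ <ℚ ε) (B Nε : ℕ) (1≤Bε : 1ℚ ≤ℚ ℕ→ℚ (suc B) *ℚ ε) (ε≤Nε : ε ≤ℚ ℕ→ℚ Nε) (𝒞 : Constants B) where
    open Constants 𝒞

    conclude : (η : ℚ) → 0ℚ <ℚ η → ∃[ K ] ((k : ℕ) → K ≤ k → (n : ℕ) → 1 ≤ n → (G : Graph n) → MinDegreeAtLeast G k →
      ProbAtLeast G (pOf ε k) (λ H → ∃[ t ] (HasCliqueMinor H t × AtLeastBound (½ *ℚ unit Λ) k t)) (1ℚ - η))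
    -- `suc (N * N)` rather than `N * N` makes `k` a successor, as `pOf` and `unit` require.
    conclude η 0<η = suc (N * N) , large
      where
      η′ : ℚ
      -- Each of the two rounds fails with probability at most half of `η`.
      η′ = ½ *ℚ η
      0<η′ : 0ℚ <ℚ η′
      0<η′ = 0<* 0<½ 0<η
      f : ∃[ f₀ ] 1ℚ ≤ℚ ℕ→ℚ (suc f₀) *ℚ (η′ ** β *ℚ (½ *ℚ unit Nτ))
      f = archimedean (η′ ** β *ℚ (½ *ℚ unit Nτ)) (0<* (0<** β 0<η′) (0<* 0<½ (0<unit Nτ)))
      g : ∃[ g₀ ] 1ℚ ≤ℚ ℕ→ℚ (suc g₀) *ℚ η′
      g = archimedean η′ 0<η′
      swap : ∀ x y z → x *ℚ (y *ℚ z) ≡ y *ℚ (x *ℚ z)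
      swap = solve-∀ ℚ-ring
      halves : ∀ x h → 1ℚ - h *ℚ x - h *ℚ x ≡ 1ℚ - (h +ℚ h) *ℚ x
      halves = solve-∀ ℚ-ring
      open Bounds ε B Nε 0<ε 1≤Bε ε≤Nε β c₁ c₂ κ Γ Λ β≡ c₁≡ c₂≡ κ≡ Γ≡ Λ≡ 1≤β 1≤Γ η′ 0<η′ Nτ (suc (proj₁ f)) (suc (proj₁ g)) Nτ≡
        (subst (1ℚ ≤ℚ_) (swap (ℕ→ℚ (suc (proj₁ f))) (η′ ** β) (½ *ℚ unit Nτ)) (proj₂ f)) (proj₂ g) using (N; conclusion)
      large : (k : ℕ) → suc (N * N) ≤ k → (n : ℕ) → 1 ≤ n → (G : Graph n) → MinDegreeAtLeast G k →
        ProbAtLeast G (pOf ε k) (λ H → ∃[ t ] (HasCliqueMinor H t × AtLeastBound (½ *ℚ unit Λ) k t)) (1ℚ - η)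
      large (suc k) (s≤s N²≤k) n 1≤n G δ≥k =
        subst (ProbAtLeast G (pOf ε (suc k)) (λ H → ∃[ t ] (HasCliqueMinor H t × AtLeastBound (½ *ℚ unit Λ) (suc k) t)))
          (trans (halves η ½) (cong (λ x → 1ℚ - x) (ℚ.*-identityˡ η)))
          (conclusion k (ℕ.m≤n⇒m≤1+n N²≤k) n 1≤n G δ≥k)

open import Defs
open import Data.Nat using (ℕ; _≤_)
open import Data.Product using (Σ; ∃-syntax; _×_; _,_; proj₁; proj₂)
open import Data.Rational using (ℚ; 0ℚ; 1ℚ; ½; _<_; _-_; _*_)
open import Data.Rational using () renaming (_≤_ to _≤ℚ_)
open Rationals using (unit; archimedean; 0<*; 0<unit)
open Parameters using (ceiling; 0<½)
open Conclusion using (Constants; constants; conclude)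

theorem1p2 : (ε : ℚ) → 0ℚ < ε →
    ∃[ c2 ] (0ℚ < c2 ×
    ((η : ℚ) → 0ℚ < η →
    ∃[ K ] ((k : ℕ) → K ≤ k →
    (n : ℕ) → 1 ≤ n → (G : Graph n) → MinDegreeAtLeast G k →
    ProbAtLeast G (pOf ε k)
    (λ H → ∃[ t ] (HasCliqueMinor H t × AtLeastBound c2 k t))
    (1ℚ - η))))
theorem1p2 ε 0<ε =
  -- The constant depends on `ε` through `B` alone; the upper bound `Nε` and the error `η` affect
  -- only the threshold for `k`.
  let (B , 1≤Bε) = archimedean ε 0<ε
      (Nε , ε≤Nε) = ceiling ε
      𝒞 = constants B in
  ½ * unit (Constants.Λ 𝒞) , 0<* 0<½ (0<unit (Constants.Λ 𝒞)) , conclude ε 0<ε B Nε 1≤Bε ε≤Nε 𝒞
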